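{- Let $p$ be a prime, $q=p^l$, $n\ge 2$ and $k\ge1$ integers, $d=\gcd(k,q-1)$, and let $\ell$ be the divisor of $l$ such that the set of all finite sums of $k$-th powers of elements of $\mathbb F_q$ equals $\mathbb F_{p^\ell}$. Assume $\ell=l$ and $p\nmid k$. Then every matrix in $M_n(\mathbb F_q)$ is of the form $A^k+B^k$ with $A,B\in M_n(\mathbb F_q)$ in each of the following cases: (i) $q\ge 3d+1$ and either ($d>2$ and $n>\max\{\frac{d-1}{2},\frac{4\ln(k-1)}{\ln q}\}$) or $d=2$; (ii) $q=2d+1$ and either ($d>2$ and $n>\max\{2d-1,\frac{4\ln(k-1)}{\ln q}\}$) or $d=2$.
   Context: Convention: $\ln(0)=-\infty$. -}

module Defs where

open import Level using (Level; _⊔_) renaming (suc to lsuc)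
open import Algebra.Bundles using (CommutativeRing)
open import Data.Nat using (ℕ; zero; suc)
open import Data.Fin using (Fin; zero; suc; _≟_)
open import Data.Product using (Σ; ∃; _×_; _,_)
open import Relation.Nullary using (¬_; yes; no)
open import Relation.Binary.PropositionalEquality using (_≡_)

record Field (c ℓ : Level) : Set (lsuc (c ⊔ ℓ)) where
  field
    commutativeRing : CommutativeRing c ℓ
  open CommutativeRing commutativeRing public
  field
    1≉0     : ¬ (1# ≈ 0#)
    inverse : ∀ x → ¬ (x ≈ 0#) → ∃ λ y → x * y ≈ 1#

module FieldOps {c ℓ} (F : Field c ℓ) where
  open Field F using (Carrier; _≈_; _+_; _*_; 0#; 1#)

  HasSize : ℕ → Set (c ⊔ ℓ)
  HasSize q = Σ (Fin q → Carrier) λ e →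
                (∀ i j → e i ≈ e j → i ≡ j) × (∀ x → ∃ λ i → e i ≈ x)

  pow : Carrier → ℕ → Carrier
  pow x zero    = 1#
  pow x (suc k) = x * pow x k

  data SumOfPowers (k : ℕ) : Carrier → Set (c ⊔ ℓ) where
    empty : ∀ {x} → x ≈ 0# → SumOfPowers k x
    step  : ∀ {x y} z → SumOfPowers k y → x ≈ y + pow z k → SumOfPowers k x

  Mat : ℕ → Set c
  Mat n = Fin n → Fin n → Carrier

  ∑ : ∀ {n} → (Fin n → Carrier) → Carrier
  ∑ {zero}  f = 0#
  ∑ {suc n} f = f zero + ∑ (λ i → f (suc i))

  _⊕_ : ∀ {n} → Mat n → Mat n → Mat n
  (A ⊕ B) i j = A i j + B i j

  _⊗_ : ∀ {n} → Mat n → Mat n → Mat n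
  (A ⊗ B) i j = ∑ (λ m → A i m * B m j)

  I : ∀ {n} → Mat n
  I i j with i ≟ j
  ... | yes _ = 1#
  ... | no  _ = 0#

  mpow : ∀ {n} → Mat n → ℕ → Mat n
  mpow A zero    = I
  mpow A (suc k) = A ⊗ mpow A k

  _≋_ : ∀ {n} → Mat n → Mat n → Set ℓ
  A ≋ B = ∀ i j → A i j ≈ B i j

{-# OPTIONS --safe #-}
-- Put P for the nonzero k-th powers of F = F_q.  Since p ∤ k, a triangular matrix whose diagonal entries are k-th powers, at most
-- one of them zero, is a k-th power.  A nonscalar matrix is similar to one with any prescribed diagonal of the same trace, hence it
-- suffices to write the trace as a sum of 2n k-th powers, n on each of the two diagonals, with at most one zero on each: then the
-- matrix is the sum of a lower and an upper triangular k-th power.  Such a sum exists because the sets of sums of exactly m elements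
-- of P grow by a coset of P at each step until they fill F.
-- A scalar c is a sum of two k-th powers already in F if d = 2.  Otherwise (k - 1)⁴ < qⁿ, and an elementary second moment argument
-- (in place of the Weil bound) gives xᵏ + yᵏ = c in the field with qⁿ elements, which acts on Fⁿ.  That field is a residue field of
-- F[x]/(x^(qⁿ-1) - 1), on which no x^(q^e) - x with 1 ≤ e < n vanishes.
module Submission where

open import Defs
open import Level using (0ℓ)
open import Algebra.Bundles using (CommutativeRing; CommutativeSemiring; RawRing)
open import Algebra.Structures using (IsCommutativeRing; IsCommutativeSemiring)
open import Algebra.Morphism.Structures using (IsRingMonomorphism)
open import Algebra.Solver.Ring.AlmostCommutativeRing using (fromCommutativeRing; _-Raw-AlmostCommutative⟶_)
open import Data.Empty using (⊥; ⊥-elim)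
open import Data.Fin as Fin using (Fin; zero; suc; toℕ; fromℕ; inject₁; finToFun; funToFin)
open import Data.Fin.Permutation using (Permutation; _⟨$⟩ʳ_; permutation)
open import Data.Integer as ℤ using (ℤ)
open import Data.Maybe using (Maybe; just; nothing)
open import Data.Nat as ℕ using (ℕ; zero; suc; _!)
open import Data.Nat.Combinatorics.Specification using (nCk≡n!/k![n-k]!)
open import Data.Nat.Coprimality using (Coprime; coprime-Bézout)
open import Data.Nat.DivMod using (_%_; _/_; m≡m%n+[m/n]*n; m%n<n; m/n*n≡m)
open import Data.Nat.Divisibility using (_∣_; divides; ∣m∣n⇒∣m+n; ∣-refl; _∣0; m∣m*n; ∣⇒≤)
open import Data.Nat.GCD using (gcd; gcd-GCD; module Bézout)
open import Data.Nat.Primality using (Prime; prime⇒irreducible; euclidsLemma; ¬prime[0]; ¬prime[1])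
open import Data.Nat.Solver using (module +-*-Solver)
open import Data.Product using (Σ; ∃; ∃₂; _×_; _,_; proj₁; proj₂)
open import Data.Sum using (_⊎_; inj₁; inj₂)
open import Data.Unit using (⊤; tt)
open import Data.Vec.Functional using (init; tail)
open import Function using (case_of_)
open import Relation.Binary.Definitions using (tri<; tri≈; tri>)
open import Relation.Binary.PropositionalEquality as ≡ using (_≡_; _≢_)
open import Relation.Nullary using (¬_; yes; no; Dec; ¬?; _×-dec_; _⊎-dec_)
open import Relation.Nullary.Decidable using (map′)
import Algebra.Construct.Pointwise as Pointwise
import Algebra.Morphism.RingMonomorphism as RingMonomorphism
import Algebra.Properties.CommutativeMonoid.Sum
import Algebra.Properties.CommutativeSemiring.Binomial as Binomial
import Algebra.Properties.CommutativeSemiring.Exp as CommExp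
import Algebra.Properties.Ring as RingProperties
import Algebra.Properties.Semiring.Exp as Exp
import Algebra.Properties.Semiring.Mult as Mult
import Algebra.Properties.Semiring.Sum
import Algebra.Solver.Ring as RingSolver
import Data.Fin.Properties as Fin
import Data.Integer.Properties as ℤ
import Data.Integer.Solver as ℤSolver
import Data.Nat.Combinatorics as Comb
import Data.Nat.Properties as ℕ
import Relation.Binary.Reasoning.Setoid as SetoidReasoning

-- Integer coefficients for the ring solver, finite sums, counting

-- Two zeros on a triangular diagonal may hide a nilpotent Jordan block, which has no k-th root for
-- k > 1, whereas equal nonzero powers are harmless because k is invertible in F. So the number of
-- nonzero summands has to be controlled. With D the number of k-th roots of unity and t = |P|, one
-- has D t = q - 1: growth by t reaches every nonzero element with D summands, and 0 with one more.
-- Three situations resist: trace 0 when 2n = D leaves no summand to spare; P ⊆ {1, -1} offers the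
-- growth argument no power whose square differs from 1; and a scalar matrix keeps its diagonal
-- under conjugation. The condition n > 4 ln(k-1)/ln q is (k - 1)⁴ < qⁿ, the size at which the
-- moment estimate rules out that xᵏ + yᵏ = c is unsolvable. The extension field comes without an
-- irreducible polynomial: in F[x]/(x^(qⁿ-1) - 1) every element satisfies a^(qⁿ) = a, so powers
-- supply idempotents, and the product of the x^(q^e) - x has too small a degree to vanish.
-- Existence claims are settled by search, which is why the given field is first replaced by an
-- isomorphic one on `Fin q`.

module IntegerCoefficients {c ℓ} (R : CommutativeRing c ℓ) where
  open CommutativeRing R
  open import Data.Integer using (+_; -[1+_])
  open import Algebra.Properties.Ring ring using (-‿involutive; -‿distribˡ-*; -‿distribʳ-*; -0#≈0#; -‿+-comm)
  open import Algebra.Properties.Semiring.Mult semiring using (×-homo-+; ×1-homo-*) renaming (_×_ to _·_)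
  open import Relation.Binary.Reasoning.Setoid setoid

  ⟦_⟧ : ℤ → Carrier
  ⟦ + n ⟧      = n · 1#
  ⟦ -[1+ n ] ⟧ = - (suc n · 1#)

  ⟦⟧-⊖ : ∀ m n → ⟦ m ℤ.⊖ n ⟧ ≈ (m · 1#) + - (n · 1#)
  ⟦⟧-⊖ zero zero = sym (-‿inverseʳ 0#)
  ⟦⟧-⊖ zero (suc n) = sym (+-identityˡ _)
  ⟦⟧-⊖ (suc m) zero = sym (trans (+-congˡ -0#≈0#) (+-identityʳ _))
  ⟦⟧-⊖ (suc m) (suc n) = begin
    ⟦ suc m ℤ.⊖ suc n ⟧                     ≡⟨ ≡.cong ⟦_⟧ (ℤ.[1+m]⊖[1+n]≡m⊖n m n) ⟩
    ⟦ m ℤ.⊖ n ⟧                             ≈⟨ ⟦⟧-⊖ m n ⟩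
    (m · 1#) + - (n · 1#)                   ≈⟨ +-congʳ (+-identityʳ _) ⟨
    ((m · 1#) + 0#) + - (n · 1#)            ≈⟨ +-congʳ (+-congˡ (-‿inverseʳ 1#)) ⟨
    ((m · 1#) + (1# + - 1#)) + - (n · 1#)   ≈⟨ +-congʳ (+-assoc _ _ _) ⟨
    (((m · 1#) + 1#) + - 1#) + - (n · 1#)   ≈⟨ +-assoc _ _ _ ⟩
    ((m · 1#) + 1#) + (- 1# + - (n · 1#))   ≈⟨ +-cong (+-comm _ _) (-‿+-comm _ _) ⟩
    (1# + (m · 1#)) + - (1# + (n · 1#))     ∎

  +-homo : ∀ i j → ⟦ i ℤ.+ j ⟧ ≈ ⟦ i ⟧ + ⟦ j ⟧
  +-homo (+ m) (+ n) = ×-homo-+ 1# m n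
  +-homo (+ m) -[1+ n ] = ⟦⟧-⊖ m (suc n)
  +-homo -[1+ m ] (+ n) = trans (⟦⟧-⊖ n (suc m)) (+-comm _ _)
  +-homo -[1+ m ] -[1+ n ] = begin
    - (suc (suc (m ℕ.+ n)) · 1#)           ≡⟨ ≡.cong (λ a → - (a · 1#)) (ℕ.+-suc (suc m) n) ⟨
    - ((suc m ℕ.+ suc n) · 1#)             ≈⟨ -‿cong (×-homo-+ 1# (suc m) (suc n)) ⟩
    - ((suc m · 1#) + (suc n · 1#))        ≈⟨ -‿+-comm _ _ ⟨
    - (suc m · 1#) + - (suc n · 1#)        ∎

  -‿homo : ∀ i → ⟦ ℤ.- i ⟧ ≈ - ⟦ i ⟧
  -‿homo (+ zero) = sym -0#≈0#
  -‿homo (+ suc n) = refl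
  -‿homo -[1+ n ] = sym (-‿involutive _)

  *-homo⁺ : ∀ m n → ⟦ + m ℤ.* + n ⟧ ≈ ⟦ + m ⟧ * ⟦ + n ⟧
  *-homo⁺ m n = trans (reflexive (≡.cong ⟦_⟧ (≡.sym (ℤ.pos-* m n)))) (×1-homo-* m n)

  *-homo : ∀ i j → ⟦ i ℤ.* j ⟧ ≈ ⟦ i ⟧ * ⟦ j ⟧
  *-homo (+ m) (+ n) = *-homo⁺ m n
  *-homo (+ m) -[1+ n ] = begin
    ⟦ + m ℤ.* -[1+ n ] ⟧           ≡⟨ ≡.cong ⟦_⟧ (≡.sym (ℤ.neg-distribʳ-* (+ m) (+ suc n))) ⟩
    ⟦ ℤ.- (+ m ℤ.* + suc n) ⟧      ≈⟨ -‿homo (+ m ℤ.* + suc n) ⟩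
    - ⟦ + m ℤ.* + suc n ⟧          ≈⟨ -‿cong (*-homo⁺ m (suc n)) ⟩
    - (⟦ + m ⟧ * ⟦ + suc n ⟧)      ≈⟨ -‿distribʳ-* _ _ ⟩
    ⟦ + m ⟧ * - ⟦ + suc n ⟧        ∎
  *-homo -[1+ m ] j = begin
    ⟦ -[1+ m ] ℤ.* j ⟧             ≡⟨ ≡.cong ⟦_⟧ (≡.sym (ℤ.neg-distribˡ-* (+ suc m) j)) ⟩
    ⟦ ℤ.- (+ suc m ℤ.* j) ⟧        ≈⟨ -‿homo (+ suc m ℤ.* j) ⟩
    - ⟦ + suc m ℤ.* j ⟧            ≈⟨ -‿cong (lemma j) ⟩
    - (⟦ + suc m ⟧ * ⟦ j ⟧)        ≈⟨ -‿distribˡ-* _ _ ⟩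
    - ⟦ + suc m ⟧ * ⟦ j ⟧          ∎
    where
    lemma : ∀ j → ⟦ + suc m ℤ.* j ⟧ ≈ ⟦ + suc m ⟧ * ⟦ j ⟧
    lemma (+ n) = *-homo⁺ (suc m) n
    lemma -[1+ n ] = begin
      ⟦ + suc m ℤ.* -[1+ n ] ⟧           ≡⟨ ≡.cong ⟦_⟧ (≡.sym (ℤ.neg-distribʳ-* (+ suc m) (+ suc n))) ⟩
      ⟦ ℤ.- (+ suc m ℤ.* + suc n) ⟧      ≈⟨ -‿homo (+ suc m ℤ.* + suc n) ⟩
      - ⟦ + suc m ℤ.* + suc n ⟧          ≈⟨ -‿cong (*-homo⁺ (suc m) (suc n)) ⟩
      - (⟦ + suc m ⟧ * ⟦ + suc n ⟧)      ≈⟨ -‿distribʳ-* _ _ ⟩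
      ⟦ + suc m ⟧ * - ⟦ + suc n ⟧        ∎

  morphism : ℤ.+-*-rawRing -Raw-AlmostCommutative⟶ fromCommutativeRing R
  morphism = record
    { ⟦_⟧ = ⟦_⟧ ; +-homo = +-homo ; *-homo = *-homo ; -‿homo = -‿homo
    ; 0-homo = refl ; 1-homo = +-identityʳ 1# }

  -- Comparing integers suffices for identities valid in every commutative ring. The literal one
  -- would evaluate to `1# + 0#`; for this reason `1#` enters the field identities below as a
  -- variable.
  weaklyDecidable : ∀ i j → Maybe (⟦ i ⟧ ≈ ⟦ j ⟧)
  weaklyDecidable i j with i ℤ.≟ j
  ... | yes i≡j = just (reflexive (≡.cong ⟦_⟧ i≡j))
  ... | no _    = nothing

  open RingSolver ℤ.+-*-rawRing (fromCommutativeRing R) morphism weaklyDecidable public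
    using (solve; _:=_; _:+_; _:*_; _:-_; :-_; con)

module Summation {A : Set} {_+_ _*_ : A → A → A} {0# 1# : A}
                 (isCommutativeSemiring : IsCommutativeSemiring _≡_ _+_ _*_ 0# 1#) where
  private
    R : CommutativeSemiring 0ℓ 0ℓ
    R = record { isCommutativeSemiring = isCommutativeSemiring }
    module R = CommutativeSemiring R
    module S = Algebra.Properties.Semiring.Sum R.semiring

  -- Sums are abstract so that unification treats them as neutral terms.
  abstract
    sum : ∀ {n} → (Fin n → A) → A
    sum f = S.sum f

    sum-empty : (f : Fin 0 → A) → sum f ≡ 0#
    sum-empty f = ≡.refl

    sum-suc : ∀ {n} (f : Fin (suc n) → A) → sum f ≡ f zero + sum (λ i → f (suc i))
    sum-suc f = ≡.refl

    sum-cong : ∀ {n} {f g : Fin n → A} → (∀ i → f i ≡ g i) → sum f ≡ sum g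
    sum-cong = S.sum-cong-≗

    sum-+ : ∀ {n} (f g : Fin n → A) → sum (λ i → f i + g i) ≡ sum f + sum g
    sum-+ = S.∑-distrib-+

    sum-swap : ∀ {m n} (f : Fin m → Fin n → A) → sum (λ i → sum (f i)) ≡ sum (λ j → sum (λ i → f i j))
    sum-swap = S.∑-comm

    sum-permute : ∀ {m n} (f : Fin n → A) (π : Permutation m n) → sum f ≡ sum (λ i → f (π ⟨$⟩ʳ i))
    sum-permute = S.sum-permute

    *-sum : ∀ {n} x (f : Fin n → A) → x * sum f ≡ sum (λ i → x * f i)
    *-sum = S.*-distribˡ-sum

    sum-* : ∀ {n} x (f : Fin n → A) → sum f * x ≡ sum (λ i → f i * x)
    sum-* = S.*-distribʳ-sum

  sum-zero : ∀ {n} {f : Fin n → A} → (∀ i → f i ≡ 0#) → sum f ≡ 0#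
  sum-zero {zero}  f≡0 = sum-empty _
  sum-zero {suc n} f≡0 = ≡.trans (sum-suc _) (≡.trans (≡.cong₂ _+_ (f≡0 zero) (sum-zero (λ i → f≡0 (suc i)))) (R.+-identityˡ 0#))

  sum-single : ∀ {n} (f : Fin n → A) j → (∀ i → i ≢ j → f i ≡ 0#) → sum f ≡ f j
  sum-single {suc n} f zero h    = ≡.trans (sum-suc f) (≡.trans (≡.cong (f zero +_) (sum-zero (λ i → h (suc i) λ ()))) (R.+-identityʳ _))
  sum-single {suc n} f (suc j) h = ≡.trans (sum-suc f) (≡.trans (≡.cong₂ _+_ (h zero λ ())
    (sum-single (λ i → f (suc i)) j (λ i i≢j → h (suc i) (λ e → i≢j (Fin.suc-injective e))))) (R.+-identityˡ _))

module ℕΣ = Summation ℕ.+-*-isCommutativeSemiring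

ι : ∀ {a} {A : Set a} → Dec A → ℕ
ι (yes _) = 1
ι (no _)  = 0

ι≤1 : ∀ {a} {A : Set a} (d : Dec A) → ι d ℕ.≤ 1
ι≤1 (yes _) = ℕ.≤-refl
ι≤1 (no _)  = ℕ.z≤n

ι-yes : ∀ {a} {A : Set a} (d : Dec A) → A → ι d ≡ 1
ι-yes (yes _) _ = ≡.refl
ι-yes (no ¬a) a = ⊥-elim (¬a a)

ι-no : ∀ {a} {A : Set a} (d : Dec A) → ¬ A → ι d ≡ 0
ι-no (yes a) ¬a = ⊥-elim (¬a a)
ι-no (no _) _   = ≡.refl

ι-mono : ∀ {a b} {A : Set a} {B : Set b} (d : Dec A) (d′ : Dec B) → (A → B) → ι d ℕ.≤ ι d′
ι-mono (yes a) d′ f = ℕ.≤-reflexive (≡.sym (ι-yes d′ (f a)))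
ι-mono (no _) d′ f  = ℕ.z≤n

ι-cong : ∀ {a b} {A : Set a} {B : Set b} (d : Dec A) (d′ : Dec B) → (A → B) → (B → A) → ι d ≡ ι d′
ι-cong d d′ f g = ℕ.≤-antisym (ι-mono d d′ f) (ι-mono d′ d g)

sum-mono : ∀ {n} {f g : Fin n → ℕ} → (∀ i → f i ℕ.≤ g i) → ℕΣ.sum f ℕ.≤ ℕΣ.sum g
sum-mono {zero}  f≤g = ℕ.≤-reflexive (≡.trans (ℕΣ.sum-empty _) (≡.sym (ℕΣ.sum-empty _)))
sum-mono {suc n} f≤g = ≡.subst₂ ℕ._≤_ (≡.sym (ℕΣ.sum-suc _)) (≡.sym (ℕΣ.sum-suc _)) (ℕ.+-mono-≤ (f≤g zero) (sum-mono (λ i → f≤g (suc i))))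

sum≥term : ∀ {n} (f : Fin n → ℕ) i → f i ℕ.≤ ℕΣ.sum f
sum≥term f zero    = ≡.subst (f zero ℕ.≤_) (≡.sym (ℕΣ.sum-suc f)) (ℕ.m≤m+n _ _)
sum≥term f (suc i) = ≡.subst (f (suc i) ℕ.≤_) (≡.sym (ℕΣ.sum-suc f)) (ℕ.≤-trans (sum≥term (λ j → f (suc j)) i) (ℕ.m≤n+m _ _))

sum-strict : ∀ {n} {f g : Fin n → ℕ} → (∀ i → f i ℕ.≤ g i) → ∀ i → f i ℕ.< g i → ℕΣ.sum f ℕ.< ℕΣ.sum g
sum-strict f≤g zero lt    = ≡.subst₂ ℕ._<_ (≡.sym (ℕΣ.sum-suc _)) (≡.sym (ℕΣ.sum-suc _)) (ℕ.+-mono-<-≤ lt (sum-mono (λ i → f≤g (suc i))))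
sum-strict f≤g (suc i) lt = ≡.subst₂ ℕ._<_ (≡.sym (ℕΣ.sum-suc _)) (≡.sym (ℕΣ.sum-suc _)) (ℕ.+-mono-≤-< (f≤g zero) (sum-strict (λ j → f≤g (suc j)) i lt))

sum-const : ∀ n x → ℕΣ.sum {n} (λ _ → x) ≡ n ℕ.* x
sum-const zero x    = ℕΣ.sum-empty _
sum-const (suc n) x = ≡.trans (ℕΣ.sum-suc _) (≡.cong (x ℕ.+_) (sum-const n x))

module _ {n : ℕ} where
  -- Subsets are decidable predicates and cardinalities are sums of indicators, so that interchange
  -- of sums gives double counting and `sum-permute` gives invariance under bijections.
  # : ∀ {p} {P : Fin n → Set p} → (∀ x → Dec (P x)) → ℕ
  # P? = ℕΣ.sum (λ x → ι (P? x))

  #-mono : ∀ {p r} {P : Fin n → Set p} {R : Fin n → Set r} (P? : ∀ x → Dec (P x)) (R? : ∀ x → Dec (R x)) →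
           (∀ x → P x → R x) → # P? ℕ.≤ # R?
  #-mono P? R? f = sum-mono (λ x → ι-mono (P? x) (R? x) (f x))

  #-cong : ∀ {p r} {P : Fin n → Set p} {R : Fin n → Set r} (P? : ∀ x → Dec (P x)) (R? : ∀ x → Dec (R x)) →
           (∀ x → P x → R x) → (∀ x → R x → P x) → # P? ≡ # R?
  #-cong P? R? f g = ℕ.≤-antisym (#-mono P? R? f) (#-mono R? P? g)

  #-full : ∀ {p} {P : Fin n → Set p} (P? : ∀ x → Dec (P x)) → (∀ x → P x) → # P? ≡ n
  #-full P? f = ≡.trans (ℕΣ.sum-cong (λ x → ι-yes (P? x) (f x))) (≡.trans (sum-const n 1) (ℕ.*-identityʳ n))

  #≤n : ∀ {p} {P : Fin n → Set p} (P? : ∀ x → Dec (P x)) → # P? ℕ.≤ n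
  #≤n P? = ℕ.≤-trans (sum-mono (λ x → ι≤1 (P? x))) (ℕ.≤-reflexive (≡.trans (sum-const n 1) (ℕ.*-identityʳ n)))

  #-point : ∀ j → # (λ x → x Fin.≟ j) ≡ 1
  #-point j = ≡.trans (ℕΣ.sum-single _ j (λ i i≢j → ι-no (i Fin.≟ j) i≢j)) (ι-yes (j Fin.≟ j) ≡.refl)

  #-≤⇒⊇ : ∀ {p r} {P : Fin n → Set p} {R : Fin n → Set r} (P? : ∀ x → Dec (P x)) (R? : ∀ x → Dec (R x)) →
          (∀ x → P x → R x) → # R? ℕ.≤ # P? → ∀ x → R x → P x
  #-≤⇒⊇ P? R? f le x rx with P? x in eq
  ... | yes px = px
  -- A point of R outside P would make the count of P strictly smaller. This pigeonhole step is
  -- behind the later conclusions that a set is everything.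
  ... | no ¬px = ⊥-elim (ℕ.<⇒≱ (sum-strict (λ y → ι-mono (P? y) (R? y) (f y)) x
                    (≡.subst₂ ℕ._<_ (≡.sym (≡.trans (≡.cong ι eq) ≡.refl)) (≡.sym (ι-yes (R? x) rx)) (ℕ.s≤s ℕ.z≤n))) le)

  #-⊎ : ∀ {p r s} {P : Fin n → Set p} {R : Fin n → Set r} {S : Fin n → Set s}
        (P? : ∀ x → Dec (P x)) (R? : ∀ x → Dec (R x)) (S? : ∀ x → Dec (S x)) →
        (∀ x → S x → P x ⊎ R x) → # S? ℕ.≤ # P? ℕ.+ # R?
  #-⊎ P? R? S? f = ℕ.≤-trans (sum-mono lemma) (ℕ.≤-reflexive (ℕΣ.sum-+ _ _))
    where
    lemma : ∀ x → ι (S? x) ℕ.≤ ι (P? x) ℕ.+ ι (R? x)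
    lemma x with S? x
    ... | no _ = ℕ.z≤n
    ... | yes s with f x s
    ... | inj₁ p = ℕ.≤-trans (ℕ.≤-reflexive (≡.sym (ι-yes (P? x) p))) (ℕ.m≤m+n _ _)
    ... | inj₂ r = ℕ.≤-trans (ℕ.≤-reflexive (≡.sym (ι-yes (R? x) r))) (ℕ.m≤n+m _ _)

  #-disjoint : ∀ {p r s} {P : Fin n → Set p} {R : Fin n → Set r} {S : Fin n → Set s}
        (P? : ∀ x → Dec (P x)) (R? : ∀ x → Dec (R x)) (S? : ∀ x → Dec (S x)) →
        (∀ x → P x → S x) → (∀ x → R x → S x) → (∀ x → P x → ¬ R x) → # P? ℕ.+ # R? ℕ.≤ # S?
  #-disjoint P? R? S? f g h = ℕ.≤-trans (ℕ.≤-reflexive (≡.sym (ℕΣ.sum-+ _ _))) (sum-mono lemma)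
    where
    lemma : ∀ x → ι (P? x) ℕ.+ ι (R? x) ℕ.≤ ι (S? x)
    lemma x with P? x | R? x
    ... | yes p | yes r = ⊥-elim (h x p r)
    ... | yes p | no _  = ℕ.≤-reflexive (≡.sym (ι-yes (S? x) (f x p)))
    ... | no _  | yes r = ℕ.≤-reflexive (≡.sym (ι-yes (S? x) (g x r)))
    ... | no _  | no _  = ℕ.z≤n

  #-permute : ∀ {p} {P : Fin n → Set p} (P? : ∀ x → Dec (P x)) (π : Permutation n n) → # P? ≡ # (λ x → P? (π ⟨$⟩ʳ x))
  #-permute P? π = ℕΣ.sum-permute (λ x → ι (P? x)) π

-- Propositional equality on `Fin q` is decidable, existence can be settled by exhaustive search,
-- and bijections of the field are permutations that reindex sums.
record FiniteField (q : ℕ) : Set where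
  infix  8 -_
  infixl 7 _*_
  infixl 6 _+_
  field
    _+_ _*_           : Fin q → Fin q → Fin q
    -_                : Fin q → Fin q
    0# 1#             : Fin q
    isCommutativeRing : IsCommutativeRing _≡_ _+_ _*_ -_ 0# 1#
    1≢0               : 1# ≢ 0#
    inverse           : ∀ x → x ≢ 0# → ∃ λ y → x * y ≡ 1#

  commutativeRing : CommutativeRing 0ℓ 0ℓ
  commutativeRing = record { isCommutativeRing = isCommutativeRing }

  asField : Field 0ℓ 0ℓ
  asField = record { commutativeRing = commutativeRing ; 1≉0 = 1≢0 ; inverse = inverse }

-- The operations are pulled back along the enumeration `e`, whose injectivity turns the laws of F,
-- valid up to its own equality, into propositional equations. The construction serves for the given
-- field and later for the extension field.
module Transport {c ℓ} (F : Field c ℓ) {q : ℕ} (size : FieldOps.HasSize F q) where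
  private module F = Field F
  open FieldOps F

  e : Fin q → F.Carrier
  e = proj₁ size

  e-injective : ∀ {i j} → e i F.≈ e j → i ≡ j
  e-injective = proj₁ (proj₂ size) _ _

  index : F.Carrier → Fin q
  index x = proj₁ (proj₂ (proj₂ size) x)

  e-index : ∀ x → e (index x) F.≈ x
  e-index x = proj₂ (proj₂ (proj₂ size) x)

  finiteField : FiniteField q
  finiteField = record
    { _+_ = _+ᶠ_ ; _*_ = _*ᶠ_ ; -_ = -ᶠ_ ; 0# = 0ᶠ ; 1# = 1ᶠ
    ; isCommutativeRing = Mono.isCommutativeRing F.isCommutativeRing
    ; 1≢0 = λ eq → F.1≉0 (F.trans (F.sym (e-index F.1#)) (F.trans (F.reflexive (≡.cong e eq)) (e-index F.0#)))
    ; inverse = inv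
    }
    where
    infixl 7 _*ᶠ_
    _+ᶠ_ _*ᶠ_ : Fin q → Fin q → Fin q
    i +ᶠ j = index (e i F.+ e j)
    i *ᶠ j = index (e i F.* e j)
    -ᶠ_ : Fin q → Fin q
    -ᶠ i = index (F.- e i)
    0ᶠ 1ᶠ : Fin q
    0ᶠ = index F.0#
    1ᶠ = index F.1#
    raw : RawRing 0ℓ 0ℓ
    raw = record { Carrier = Fin q ; _≈_ = _≡_ ; _+_ = _+ᶠ_ ; _*_ = _*ᶠ_ ; -_ = -ᶠ_ ; 0# = 0ᶠ ; 1# = 1ᶠ }
    mono : IsRingMonomorphism raw F.rawRing e
    mono = record
      { isRingHomomorphism = record
        { isSemiringHomomorphism = record
          { isNearSemiringHomomorphism = record
            { +-isMonoidHomomorphism = record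
              { isMagmaHomomorphism = record
                { isRelHomomorphism = record { cong = λ { ≡.refl → F.refl } }
                ; homo = λ _ _ → e-index _ }
              ; ε-homo = e-index _ }
            ; *-homo = λ _ _ → e-index _ }
          ; 1#-homo = e-index _ }
        ; -‿homo = λ _ → e-index _ }
      ; injective = e-injective }
    module Mono = RingMonomorphism mono
    inv : ∀ x → x ≢ 0ᶠ → ∃ λ y → x *ᶠ y ≡ 1ᶠ
    inv x x≢0 with F.inverse (e x) (λ ex≈0 → x≢0 (e-injective (F.trans ex≈0 (F.sym (e-index F.0#)))))
    ... | y , xy≈1 = index y , e-injective (F.trans (e-index _) (F.trans (F.*-congˡ (e-index y)) (F.trans xy≈1 (F.sym (e-index F.1#)))))

  module G = FiniteField finiteField
  module GO = FieldOps G.asField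

  e-+ : ∀ i j → e (i G.+ j) F.≈ e i F.+ e j
  e-+ i j = e-index _

  e-* : ∀ i j → e (i G.* j) F.≈ e i F.* e j
  e-* i j = e-index _

  e-pow : ∀ x k → e (GO.pow x k) F.≈ pow (e x) k
  e-pow x zero    = e-index _
  e-pow x (suc k) = F.trans (e-* _ _) (F.*-congˡ (e-pow x k))

  lift-sum : ∀ y z k v → GO.pow y k G.+ GO.pow z k ≡ index v → pow (e y) k F.+ pow (e z) k F.≈ v
  lift-sum y z k v eq = F.trans (F.+-cong (F.sym (e-pow y k)) (F.sym (e-pow z k)))
    (F.trans (F.sym (e-+ _ _)) (F.trans (F.reflexive (≡.cong e eq)) (e-index v)))

  e-∑ : ∀ {n} (f : Fin n → Fin q) → e (GO.∑ f) F.≈ ∑ (λ i → e (f i))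
  e-∑ {zero} f  = e-index _
  e-∑ {suc n} f = F.trans (e-+ _ _) (F.+-congˡ (e-∑ (λ i → f (suc i))))

  ∑-cong : ∀ {n} {f g : Fin n → F.Carrier} → (∀ i → f i F.≈ g i) → ∑ f F.≈ ∑ g
  ∑-cong {zero} f≈g  = F.refl
  ∑-cong {suc n} f≈g = F.+-cong (f≈g zero) (∑-cong (λ i → f≈g (suc i)))

  e-mpow : ∀ {n} (A : GO.Mat n) k i j → e (GO.mpow A k i j) F.≈ mpow (λ i j → e (A i j)) k i j
  e-mpow A zero i j with i Fin.≟ j
  ... | yes _ = e-index _
  ... | no _  = e-index _
  e-mpow A (suc k) i j = F.trans (e-∑ (λ m → A i m G.* GO.mpow A k m j)) (∑-cong (λ m → F.trans (e-* (A i m) (GO.mpow A k m j)) (F.*-congˡ (e-mpow A k m j))))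

  sumOfPowers : ∀ {k x} → SumOfPowers k x → GO.SumOfPowers k (index x)
  sumOfPowers (empty x≈0) = GO.empty (e-injective (F.trans (e-index _) (F.trans x≈0 (F.sym (e-index _)))))
  sumOfPowers {k} (step {x} {y} z s x≈) = GO.step (index z) (sumOfPowers s) (e-injective
    (F.trans (e-index x) (F.trans x≈ (F.sym (F.trans (e-+ _ _) (F.+-cong (e-index y)
      (F.trans (e-pow (index z) k) (pow-cong k (e-index z)))))))))
    where
    pow-cong : ∀ k {x y} → x F.≈ y → pow x k F.≈ pow y k
    pow-cong zero x≈y    = F.refl
    pow-cong (suc k) x≈y = F.*-cong x≈y (pow-cong k x≈y)

open ≡ using (refl; sym; trans; cong; cong₂; subst; subst₂; module ≡-Reasoning)

-- Arithmetic in a finite field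

module Arithmetic {q : ℕ} (G : FiniteField q) where
  open FiniteField G public
  open FieldOps asField public
  open CommutativeRing commutativeRing public
    using (+-assoc; +-comm; +-identityˡ; +-identityʳ; -‿inverseˡ; -‿inverseʳ; *-assoc; *-comm; *-identityˡ; *-identityʳ
          ; distribˡ; distribʳ; zeroˡ; zeroʳ; isCommutativeSemiring)
  open IntegerCoefficients commutativeRing public using (solve; _:=_; _:+_; _:*_; _:-_; :-_)
  module FΣ = Summation isCommutativeSemiring
  open ≡-Reasoning

  infixl 6 _-_
  _-_ : Fin q → Fin q → Fin q
  x - y = x + - y

  x-y≡0⇒x≡y : ∀ {x y} → x - y ≡ 0# → x ≡ y
  x-y≡0⇒x≡y {x} {y} e = trans (solve 2 (λ x y → x := (x :- y) :+ y) refl x y) (trans (cong (_+ y) e) (+-identityˡ y))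

  x≡y⇒x-y≡0 : ∀ {x y} → x ≡ y → x - y ≡ 0#
  x≡y⇒x-y≡0 {x} refl = -‿inverseʳ x

  -0#≡0# : - 0# ≡ 0#
  -0#≡0# = trans (sym (+-identityˡ _)) (-‿inverseʳ 0#)

  x-0≡x : ∀ x → x - 0# ≡ x
  x-0≡x x = trans (cong (x +_) -0#≡0#) (+-identityʳ x)

  -- The value 0 at 0 makes inversion total and an involution of the whole field, hence a
  -- permutation along which sums can be reindexed.
  inv : Fin q → Fin q
  inv x with x Fin.≟ 0#
  ... | yes _ = 0#
  ... | no x≢0 = proj₁ (inverse x x≢0)

  inv-r : ∀ {x} → x ≢ 0# → x * inv x ≡ 1#
  inv-r {x} x≢0 with x Fin.≟ 0#
  ... | yes x≡0 = ⊥-elim (x≢0 x≡0)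
  ... | no x≢0 = proj₂ (inverse x x≢0)

  inv-l : ∀ {x} → x ≢ 0# → inv x * x ≡ 1#
  inv-l x≢0 = trans (*-comm _ _) (inv-r x≢0)

  *-inv-cancelˡ : ∀ {x} y → x ≢ 0# → inv x * (x * y) ≡ y
  *-inv-cancelˡ {x} y x≢0 = trans (sym (*-assoc _ _ _)) (trans (cong (_* y) (inv-l x≢0)) (*-identityˡ y))

  *-cancel-inv : ∀ {x} y → x ≢ 0# → x * (inv x * y) ≡ y
  *-cancel-inv {x} y x≢0 = trans (sym (*-assoc _ _ _)) (trans (cong (_* y) (inv-r x≢0)) (*-identityˡ y))

  *-cancelˡ : ∀ {x y z} → x ≢ 0# → x * y ≡ x * z → y ≡ z
  *-cancelˡ {x} {y} {z} x≢0 e = trans (sym (*-inv-cancelˡ y x≢0)) (trans (cong (inv x *_) e) (*-inv-cancelˡ z x≢0))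

  *-≢0 : ∀ {x y} → x ≢ 0# → y ≢ 0# → x * y ≢ 0#
  *-≢0 x≢0 y≢0 e = y≢0 (*-cancelˡ x≢0 (trans e (sym (zeroʳ _))))

  inv≢0 : ∀ {x} → x ≢ 0# → inv x ≢ 0#
  inv≢0 {x} x≢0 e = 1≢0 (trans (sym (inv-r x≢0)) (trans (cong (x *_) e) (zeroʳ x)))

  inv-0 : inv 0# ≡ 0#
  inv-0 with 0# Fin.≟ 0#
  ... | yes _ = refl
  ... | no ne = ⊥-elim (ne refl)

  inv-involutive : ∀ x → inv (inv x) ≡ x
  inv-involutive x = go (x Fin.≟ 0#)
    where
    go : Dec (x ≡ 0#) → inv (inv x) ≡ x
    go (yes refl) = trans (cong inv inv-0) inv-0
    go (no x≢0) = *-cancelˡ (inv≢0 x≢0) (trans (inv-r (inv≢0 x≢0)) (sym (inv-l x≢0)))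

  -‿≢0 : ∀ {x} → x ≢ 0# → - x ≢ 0#
  -‿≢0 {x} x≢0 e = x≢0 (trans (solve 1 (λ x → x := :- (:- x)) refl x) (trans (cong -_ e) -0#≡0#))

  pow-+ : ∀ x m n → pow x (m ℕ.+ n) ≡ pow x m * pow x n
  pow-+ x zero n = sym (*-identityˡ _)
  pow-+ x (suc m) n = trans (cong (x *_) (pow-+ x m n)) (sym (*-assoc _ _ _))

  pow-1# : ∀ n → pow 1# n ≡ 1#
  pow-1# zero = refl
  pow-1# (suc n) = trans (*-identityˡ _) (pow-1# n)

  pow-* : ∀ x y n → pow (x * y) n ≡ pow x n * pow y n
  pow-* x y zero = sym (*-identityˡ 1#)
  pow-* x y (suc n) = trans (cong (x * y *_) (pow-* x y n))
    (solve 4 (λ x y a b → x :* y :* (a :* b) := x :* a :* (y :* b)) refl x y (pow x n) (pow y n))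

  pow-pow : ∀ x m n → pow (pow x m) n ≡ pow x (m ℕ.* n)
  pow-pow x m zero = cong (pow x) (sym (ℕ.*-zeroʳ m))
  pow-pow x m (suc n) = trans (cong (pow x m *_) (pow-pow x m n)) (trans (sym (pow-+ x m (m ℕ.* n))) (cong (pow x) (sym (ℕ.*-suc m n))))

  pow-≢0 : ∀ {x} n → x ≢ 0# → pow x n ≢ 0#
  pow-≢0 zero x≢0 = 1≢0
  pow-≢0 (suc n) x≢0 = *-≢0 x≢0 (pow-≢0 n x≢0)

  pow≡0⇒ : ∀ {x} n → pow x n ≡ 0# → x ≡ 0#
  pow≡0⇒ {x} n e with x Fin.≟ 0#
  ... | yes x≡0 = x≡0
  ... | no x≢0 = ⊥-elim (pow-≢0 n x≢0 e)

  pow-0# : ∀ {n} → 1 ℕ.≤ n → pow 0# n ≡ 0#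
  pow-0# (ℕ.s≤s _) = zeroˡ _

  inv-pow : ∀ {x} n → x ≢ 0# → pow (inv x) n * pow x n ≡ 1#
  inv-pow {x} n x≢0 = trans (sym (pow-* (inv x) x n)) (trans (cong (λ z → pow z n) (inv-l x≢0)) (pow-1# n))

  ∑≡sum : ∀ {n} (f : Fin n → Fin q) → ∑ f ≡ FΣ.sum f
  ∑≡sum {zero} f = sym (FΣ.sum-empty f)
  ∑≡sum {suc n} f = trans (cong (f zero +_) (∑≡sum (λ i → f (suc i)))) (sym (FΣ.sum-suc f))

  I-diag : ∀ {n} (j : Fin n) → I j j ≡ 1#
  I-diag j with j Fin.≟ j
  ... | yes _ = refl
  ... | no ne = ⊥-elim (ne refl)

  I-off : ∀ {n} {i j : Fin n} → i ≢ j → I i j ≡ 0#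
  I-off {i = i} {j} ne with i Fin.≟ j
  ... | yes e = ⊥-elim (ne e)
  ... | no _ = refl

  AtMostOneZero : ∀ {n} → (Fin n → Fin q) → Set
  AtMostOneZero x = ∀ i j → x i ≡ 0# → x j ≡ 0# → i ≡ j

  shift : Fin q → Permutation q q
  shift a = permutation (_+ a) (_- a)
    (λ y → solve 2 (λ y a → y :- a :+ a := y) refl y a)
    (λ y → solve 2 (λ y a → y :+ a :- a := y) refl y a)

  reflect : Fin q → Permutation q q
  reflect a = permutation (λ y → a - y) (λ y → a - y)
    (λ y → solve 2 (λ y a → a :- (a :- y) := y) refl y a)
    (λ y → solve 2 (λ y a → a :- (a :- y) := y) refl y a)

  scale : ∀ a → a ≢ 0# → Permutation q q
  scale a a≢0 = permutation (a *_) (inv a *_)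
    (λ y → *-cancel-inv y a≢0) (λ y → *-inv-cancelˡ y a≢0)

  nonzero? : (x : Fin q) → Dec (x ≢ 0#)
  nonzero? x = ¬? (x Fin.≟ 0#)

  #nonzero : suc (# nonzero?) ≡ q
  #nonzero = ℕ.≤-antisym
    (ℕ.≤-trans (ℕ.≤-reflexive (cong (ℕ._+ # nonzero?) (sym (#-point 0#))))
      (ℕ.≤-trans (#-disjoint (Fin._≟ 0#) nonzero? all? (λ _ _ → tt) (λ _ _ → tt) (λ _ e ne → ne e))
        (#≤n all?)))
    (ℕ.≤-trans (ℕ.≤-reflexive (sym (#-full all? (λ _ → tt))))
      (ℕ.≤-trans (#-⊎ (Fin._≟ 0#) nonzero? all? (λ x _ → lem x))
         (ℕ.≤-reflexive (cong (ℕ._+ # nonzero?) (#-point 0#)))))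
    where
    all? : (x : Fin q) → Dec ⊤
    all? _ = yes tt
    lem : ∀ x → x ≡ 0# ⊎ x ≢ 0#
    lem x with x Fin.≟ 0#
    ... | yes e = inj₁ e
    ... | no e = inj₂ e

  q∸1≡#nonzero : q ℕ.∸ 1 ≡ # nonzero?
  q∸1≡#nonzero = cong (ℕ._∸ 1) (sym #nonzero)

  -- Lagrange's argument: multiplication by x permutes the field and so preserves the product of all
  -- nonzero elements. Putting 1 at zero, in `g` and in `h`, makes `g (x * y) ≡ h y * g y` hold
  -- without exception, and the product of `g` cancels.
  module Fermat (x : Fin q) (x≢0 : x ≢ 0#) where
    private
      module Π = Algebra.Properties.CommutativeMonoid.Sum (CommutativeRing.*-commutativeMonoid commutativeRing)

      h g : Fin q → Fin q
      h y with y Fin.≟ 0#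
      ... | yes _ = 1#
      ... | no _ = x
      g y with y Fin.≟ 0#
      ... | yes _ = 1#
      ... | no _ = y

      g-* : ∀ y → g (x * y) ≡ h y * g y
      g-* y with y Fin.≟ 0# | x * y Fin.≟ 0#
      ... | yes _ | yes _ = sym (*-identityˡ 1#)
      ... | yes y≡0 | no xy≢0 = ⊥-elim (xy≢0 (trans (cong (x *_) y≡0) (zeroʳ x)))
      ... | no y≢0 | yes xy≡0 = ⊥-elim (*-≢0 x≢0 y≢0 xy≡0)
      ... | no _ | no _ = refl

      g≢0 : ∀ y → g y ≢ 0#
      g≢0 y with y Fin.≟ 0#
      ... | yes _ = 1≢0
      ... | no y≢0 = y≢0

      Π≢0 : ∀ {n} (f : Fin n → Fin q) → (∀ i → f i ≢ 0#) → Π.sum f ≢ 0#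
      Π≢0 {zero} f f≢0 = 1≢0
      Π≢0 {suc n} f f≢0 = *-≢0 (f≢0 zero) (Π≢0 (λ i → f (suc i)) (λ i → f≢0 (suc i)))

      Πh : ∀ {n} (s : Fin n → Fin q) → Π.sum (λ i → h (s i)) ≡ pow x (# (λ i → nonzero? (s i)))
      Πh {zero} s = cong (pow x) (sym (ℕΣ.sum-empty _))
      Πh {suc n} s = trans (cong₂ _*_ refl (Πh (λ i → s (suc i)))) (trans (lem (s zero)) (cong (pow x) (sym (ℕΣ.sum-suc _))))
        where
        lem : ∀ y {m} → h y * pow x m ≡ pow x (ι (nonzero? y) ℕ.+ m)
        lem y with y Fin.≟ 0#
        ... | yes _ = *-identityˡ _
        ... | no _ = refl

    fermat : pow x (q ℕ.∸ 1) ≡ 1#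
    fermat = trans (cong (pow x) q∸1≡#nonzero) (trans (sym (Πh (λ y → y))) (*-cancelˡ (Π≢0 g g≢0) (begin
      Π.sum g * Π.sum h ≡⟨ *-comm _ _ ⟩
      Π.sum h * Π.sum g ≡⟨ Π.∑-distrib-+ h g ⟨
      Π.sum (λ y → h y * g y) ≡⟨ Π.sum-cong-≗ g-* ⟨
      Π.sum (λ y → g (x * y)) ≡⟨ Π.sum-permute g (scale x x≢0) ⟨
      Π.sum g ≡⟨ *-identityʳ _ ⟨
      Π.sum g * 1# ∎)))

  open Fermat public using (fermat)

  pow-q : ∀ x → pow x q ≡ x
  pow-q x with x Fin.≟ 0#
  ... | yes refl = pow-0# (subst (1 ℕ.≤_) #nonzero (ℕ.s≤s ℕ.z≤n))
  ... | no x≢0 = trans (cong (pow x) q≡) (trans (cong (x *_) (fermat x x≢0)) (*-identityʳ x))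
    where
    q≡ : q ≡ suc (q ℕ.∸ 1)
    q≡ = trans (sym #nonzero) (cong suc (sym q∸1≡#nonzero))

  -- Bézout in ℕ, without negative exponents: d + a m = b n where m, n are k and q - 1 in one of the
  -- two orders, and both of these powers of x are 1.
  pow-gcd : ∀ x k → x ≢ 0# → pow x k ≡ 1# → pow x (gcd k (q ℕ.∸ 1)) ≡ 1#
  pow-gcd x k x≢0 xᵏ≡1 = go (Bézout.identity (gcd-GCD k (q ℕ.∸ 1)))
    where
    d = gcd k (q ℕ.∸ 1)
    pow-mult : ∀ {m} → pow x m ≡ 1# → ∀ a → pow x (a ℕ.* m) ≡ 1#
    pow-mult {m} e a = trans (cong (pow x) (ℕ.*-comm a m)) (trans (sym (pow-pow x m a)) (trans (cong (λ z → pow z a) e) (pow-1# a)))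
    fin : ∀ {m n} → pow x m ≡ 1# → pow x n ≡ 1# → ∀ a b → d ℕ.+ a ℕ.* m ≡ b ℕ.* n → pow x d ≡ 1#
    fin {m} {n} em en a b eq = begin
      pow x d                    ≡⟨ *-identityʳ _ ⟨
      pow x d * 1#               ≡⟨ cong (pow x d *_) (pow-mult {m} em a) ⟨
      pow x d * pow x (a ℕ.* m)  ≡⟨ pow-+ x d (a ℕ.* m) ⟨
      pow x (d ℕ.+ a ℕ.* m)      ≡⟨ cong (pow x) eq ⟩
      pow x (b ℕ.* n)            ≡⟨ pow-mult {n} en b ⟩
      1#                         ∎
    go : Bézout.Identity.Identity d k (q ℕ.∸ 1) → pow x d ≡ 1#
    go (Bézout.Identity.+- a b eq) = fin {q ℕ.∸ 1} {k} (fermat x x≢0) xᵏ≡1 b a eq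
    go (Bézout.Identity.-+ a b eq) = fin {k} {q ℕ.∸ 1} xᵏ≡1 (fermat x x≢0) a b eq

  nat : ℕ → Fin q
  nat zero = 0#
  nat (suc n) = 1# + nat n

  nat-+ : ∀ m n → nat (m ℕ.+ n) ≡ nat m + nat n
  nat-+ zero n = sym (+-identityˡ _)
  nat-+ (suc m) n = trans (cong (1# +_) (nat-+ m n)) (sym (+-assoc _ _ _))

  nat-* : ∀ m n → nat (m ℕ.* n) ≡ nat m * nat n
  nat-* zero n = sym (zeroˡ _)
  nat-* (suc m) n = trans (nat-+ n (m ℕ.* n)) (trans (cong (nat n +_) (nat-* m n))
    (trans (cong (_+ nat m * nat n) (sym (*-identityˡ (nat n)))) (sym (distribʳ (nat n) 1# (nat m)))))

  nat-1 : nat 1 ≡ 1#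
  nat-1 = +-identityʳ 1#

  nat-^ : ∀ m n → nat (m ℕ.^ n) ≡ pow (nat m) n
  nat-^ m zero = nat-1
  nat-^ m (suc n) = trans (nat-* m (m ℕ.^ n)) (cong (nat m *_) (nat-^ m n))

  sum-1# : ∀ n → FΣ.sum {n} (λ _ → 1#) ≡ nat n
  sum-1# zero = FΣ.sum-empty _
  sum-1# (suc n) = trans (FΣ.sum-suc _) (cong (1# +_) (sum-1# n))

  -- The sum of all elements does not change under translation by 1, which adds q times 1 to it.
  nat-q : nat q ≡ 0#
  nat-q = begin
    nat q                   ≡⟨ solve 2 (λ s n → n := s :+ n :- s) refl s (nat q) ⟩
    s + nat q - s           ≡⟨ cong (_- s) (cong (s +_) (sum-1# q)) ⟨
    s + FΣ.sum {q} (λ _ → 1#) - s  ≡⟨ cong (_- s) (FΣ.sum-+ (λ y → y) (λ _ → 1#)) ⟨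
    FΣ.sum {q} (λ y → y + 1#) - s  ≡⟨ cong (_- s) (FΣ.sum-permute (λ y → y) (shift 1#)) ⟨
    s - s                   ≡⟨ -‿inverseʳ s ⟩
    0#                      ∎
    where s = FΣ.sum {q} (λ y → y)

  module Characteristic {p l : ℕ} (p-prime : Prime p) (q≡p^l : q ≡ p ℕ.^ l) where
    -- The l-th power of p times 1 is q times 1, which is 0, and a field has no nonzero nilpotent
    -- elements.
    nat-p : nat p ≡ 0#
    nat-p = pow≡0⇒ l (trans (sym (nat-^ p l)) (trans (cong nat (sym q≡p^l)) nat-q))

    nat-multiple : ∀ a → nat (a ℕ.* p) ≡ 0#
    nat-multiple a = trans (nat-* a p) (trans (cong (nat a *_) nat-p) (zeroʳ _))

    nat≢0 : ∀ {k} → ¬ p ∣ k → nat k ≢ 0#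
    nat≢0 {k} p∤k nk≡0 = go (coprime-Bézout coprime)
      where
      coprime : Coprime p k
      coprime (d∣p , d∣k) with prime⇒irreducible p-prime d∣p
      ... | inj₁ d≡1 = d≡1
      ... | inj₂ refl = ⊥-elim (p∤k d∣k)
      nk : ∀ a → nat (a ℕ.* k) ≡ 0#
      nk a = trans (nat-* a k) (trans (cong (nat a *_) nk≡0) (zeroʳ _))
      fin : ∀ {a b} → nat a ≡ 0# → nat b ≡ 0# → 1 ℕ.+ a ≡ b → ⊥
      fin {a} ea eb eq = 1≢0 (trans (sym (+-identityʳ _)) (trans (cong (1# +_) (sym ea)) (trans (cong nat eq) eb)))
      go : Bézout.Identity.Identity 1 p k → ⊥
      go (Bézout.Identity.+- a b eq) = fin (nk b) (nat-multiple a) eq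
      go (Bézout.Identity.-+ a b eq) = fin (nat-multiple a) (nk b) eq

  -- Monic d f: the function f is given by a monic polynomial of degree d (in Horner form).
  data Monic : ℕ → (Fin q → Fin q) → Set where
    one  : ∀ {f} → (∀ x → f x ≡ 1#) → Monic 0 f
    step : ∀ {d f g} c → Monic d g → (∀ x → f x ≡ x * g x + c) → Monic (suc d) f

  -- Synthetic division: with f = x g + c, dividing g by x - r leaves the quotient h and the
  -- remainder g r, and the quotient of f is x h + g r.
  divide : ∀ {d f} → Monic (suc d) f → ∀ r → ∃ λ g → Monic d g × (∀ x → f x ≡ (x - r) * g x + f r)
  divide {zero} {f} (step {g = g} c (one g≡1) f≡) r = (λ _ → 1#) , one (λ _ → refl) , λ x → begin
    f x                             ≡⟨ f≡ x ⟩
    x * g x + c                     ≡⟨ cong (λ z → x * z + c) (trans (g≡1 x) (sym (g≡1 r))) ⟩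
    x * g r + c                     ≡⟨ solve 4 (λ x r g c → x :* g :+ c := (x :- r) :* g :+ (r :* g :+ c)) refl x r (g r) c ⟩
    (x - r) * g r + (r * g r + c)   ≡⟨ cong₂ _+_ (cong ((x - r) *_) (g≡1 r)) (sym (f≡ r)) ⟩
    (x - r) * 1# + f r              ∎
  divide {suc d} {f} (step {g = g} c mg f≡) r with divide mg r
  ... | h , mh , g≡ = (λ x → x * h x + g r) , step (g r) mh (λ _ → refl) , λ x → begin
    f x                                         ≡⟨ f≡ x ⟩
    x * g x + c                                 ≡⟨ cong (λ z → x * z + c) (g≡ x) ⟩
    x * ((x - r) * h x + g r) + c               ≡⟨ solve 5 (λ x r h g c → x :* ((x :- r) :* h :+ g) :+ c := (x :- r) :* (x :* h :+ g) :+ (r :* g :+ c)) refl x r (h x) (g r) c ⟩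
    (x - r) * (x * h x + g r) + (r * g r + c)   ≡⟨ cong ((x - r) * (x * h x + g r) +_) (f≡ r) ⟨
    (x - r) * (x * h x + g r) + f r             ∎

  #roots≤degree : ∀ {d f} → Monic d f → # (λ x → f x Fin.≟ 0#) ℕ.≤ d
  #roots≤degree {zero} {f} (one f≡1) = ℕ.≤-reflexive (ℕΣ.sum-zero (λ x → ι-no (f x Fin.≟ 0#) (λ e → 1≢0 (trans (sym (f≡1 x)) e))))
  #roots≤degree {suc d} {f} mf with Fin.any? (λ x → f x Fin.≟ 0#)
  ... | no none = ℕ.≤-trans (ℕ.≤-reflexive (ℕΣ.sum-zero (λ x → ι-no (f x Fin.≟ 0#) (λ e → none (x , e))))) ℕ.z≤n
  ... | yes (r , fr≡0) with divide mf r
  ... | g , mg , f≡ = ℕ.≤-trans (#-⊎ (Fin._≟ r) (λ x → g x Fin.≟ 0#) (λ x → f x Fin.≟ 0#) split)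
                        (ℕ.+-mono-≤ (ℕ.≤-reflexive (#-point r)) (#roots≤degree mg))
    where
    split : ∀ x → f x ≡ 0# → x ≡ r ⊎ g x ≡ 0#
    split x fx≡0 with x Fin.≟ r
    ... | yes x≡r = inj₁ x≡r
    ... | no x≢r = inj₂ (*-cancelˡ (λ e → x≢r (x-y≡0⇒x≡y e)) (begin
      (x - r) * g x        ≡⟨ +-identityʳ _ ⟨
      (x - r) * g x + 0#   ≡⟨ cong ((x - r) * g x +_) fr≡0 ⟨
      (x - r) * g x + f r  ≡⟨ f≡ x ⟨
      f x                  ≡⟨ fx≡0 ⟩
      0#                   ≡⟨ zeroʳ _ ⟨
      (x - r) * 0#         ∎))

  pow-monic : ∀ d → Monic d (λ x → pow x d)
  pow-monic zero = one (λ _ → refl)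
  pow-monic (suc d) = step 0# (pow-monic d) (λ x → sym (+-identityʳ _))

  pow-monic-c : ∀ d c → Monic (suc d) (λ x → pow x (suc d) + c)
  pow-monic-c d c = step c (pow-monic d) (λ _ → refl)

  #pow≡1≤ : ∀ {d} → 1 ℕ.≤ d → # (λ x → pow x d Fin.≟ 1#) ℕ.≤ d
  #pow≡1≤ {suc d} _ = ℕ.≤-trans (#-mono (λ x → pow x (suc d) Fin.≟ 1#) (λ x → pow x (suc d) - 1# Fin.≟ 0#) (λ x e → x≡y⇒x-y≡0 e))
    (#roots≤degree (pow-monic-c d (- 1#)))

  -- Written as x (x^(m-1) - 1), the polynomial x^m - x is monic of degree m because m ≥ 2, and
  -- every element of the field is a root. This bounds the degree of the residue field from above.
  fixed-by-pow⇒q≤ : ∀ {m} → 2 ℕ.≤ m → (∀ x → pow x m ≡ x) → q ℕ.≤ m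
  fixed-by-pow⇒q≤ {suc (suc m)} (ℕ.s≤s (ℕ.s≤s _)) fix = ℕ.≤-trans
    (ℕ.≤-reflexive (sym (#-full (λ x → pow x (2 ℕ.+ m) - x Fin.≟ 0#) (λ x → x≡y⇒x-y≡0 (fix x)))))
    (#roots≤degree (step 0# (pow-monic-c m (- 1#)) (λ x → lem x (pow x (suc m)))))
    where
    lem : ∀ x p → x * p - x ≡ x * (p - 1#) + 0#
    lem x p = begin
      x * p - x             ≡⟨ cong (λ z → x * p - z) (*-identityʳ x) ⟨
      x * p - x * 1#        ≡⟨ solve 3 (λ x p o → x :* p :- x :* o := x :* (p :- o)) refl x p 1# ⟩
      x * (p - 1#)          ≡⟨ +-identityʳ _ ⟨
      x * (p - 1#) + 0#     ∎

-- Sums of two powers in a large finite field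

module ℤΣ = Summation ℤ.+-*-isCommutativeSemiring

module ℤSums where
  open import Data.Integer using (+_; 0ℤ; 1ℤ; _+_; _*_; -_; _-_)
  open ℤΣ public
  open ≡-Reasoning

  sum-nonneg : ∀ {n} {f : Fin n → ℤ} → (∀ i → 0ℤ ℤ.≤ f i) → 0ℤ ℤ.≤ sum f
  sum-nonneg {zero} h = ℤ.≤-reflexive (sym (sum-empty _))
  sum-nonneg {suc n} h = subst (0ℤ ℤ.≤_) (sym (sum-suc _)) (ℤ.+-mono-≤ (h zero) (sum-nonneg (λ i → h (suc i))))

  sum-+const : ∀ n c → sum {n} (λ _ → c) ≡ + n * c
  sum-+const zero c = trans (sum-empty _) (sym (ℤ.*-zeroˡ c))
  sum-+const (suc n) c = trans (sum-suc _) (trans (cong (λ z → c + z) (sum-+const n c)) (sym (trans (ℤ.*-distribʳ-+ c 1ℤ (+ n)) (cong (λ z → z + + n * c) (ℤ.*-identityˡ c)))))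

  sum-neg : ∀ {n} (f : Fin n → ℤ) → sum (λ i → - f i) ≡ - sum f
  sum-neg f = trans (sum-cong (λ i → sym (ℤ.-1*i≡-i (f i)))) (trans (sym (*-sum (- 1ℤ) f)) (ℤ.-1*i≡-i _))

  sum-- : ∀ {n} (f g : Fin n → ℤ) → sum (λ i → f i - g i) ≡ sum f - sum g
  sum-- f g = trans (sum-+ f (λ i → - g i)) (cong (λ z → sum f + z) (sum-neg g))

  sum-pos : ∀ {n} (f : Fin n → ℕ) → sum (λ i → + f i) ≡ + ℕΣ.sum f
  sum-pos {zero} f = trans (sum-empty _) (cong +_ (sym (ℕΣ.sum-empty f)))
  sum-pos {suc n} f = trans (sum-suc _) (trans (cong (λ z → + f zero + z) (sum-pos (λ i → f (suc i)))) (cong +_ (sym (ℕΣ.sum-suc f))))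

  sum-almost-const : ∀ {n} (h : Fin n → ℤ) j v → (∀ i → i ≢ j → h i ≡ v) → sum h ≡ h j + (+ n - 1ℤ) * v
  sum-almost-const {n} h j v eq = begin
    sum h                                     ≡⟨ sum-cong (λ i → solve 2 (λ h v → h := (h :- v) :+ v) refl (h i) v) ⟩
    sum (λ i → (h i - v) + v)                 ≡⟨ sum-+ (λ i → h i - v) (λ _ → v) ⟩
    sum (λ i → h i - v) + sum {n} (λ _ → v)   ≡⟨ cong₂ _+_ (sum-single _ j (λ i i≢j → trans (cong (_- v) (eq i i≢j)) (ℤ.+-inverseʳ v))) (sum-+const n v) ⟩
    (h j - v) + + n * v                       ≡⟨ solve 3 (λ h v n → (h :- v) :+ n :* v := h :+ (n :- con 1ℤ) :* v) refl (h j) v (+ n) ⟩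
    h j + (+ n - 1ℤ) * v                      ∎
    where open ℤSolver.+-*-Solver

  square-nonneg : ∀ x → 0ℤ ℤ.≤ x * x
  square-nonneg (+ n) = subst (0ℤ ℤ.≤_) (ℤ.pos-* n n) (ℤ.+≤+ ℕ.z≤n)
  square-nonneg (ℤ.-[1+ n ]) = ℤ.+≤+ ℕ.z≤n

  sum≥term-ℤ : ∀ {n} (f : Fin n → ℤ) → (∀ i → 0ℤ ℤ.≤ f i) → ∀ j → f j ℤ.≤ sum f
  sum≥term-ℤ f h zero = subst₂ ℤ._≤_ (ℤ.+-identityʳ _) (sym (sum-suc f)) (ℤ.+-monoʳ-≤ (f zero) (sum-nonneg (λ i → h (suc i))))
  sum≥term-ℤ f h (suc j) = subst₂ ℤ._≤_ (ℤ.+-identityˡ _) (sym (sum-suc f)) (ℤ.+-mono-≤ (h zero) (sum≥term-ℤ (λ i → f (suc i)) (λ i → h (suc i)) j))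

-- The quadratic form evaluated at X = m² + 1 is negative when m⁴ < Q.
numeric-bound : ∀ m Q → m ℕ.* m ℕ.* m ℕ.* m ℕ.< Q → 3 ℕ.≤ Q →
  (m ℕ.* m ℕ.+ 1) ℕ.* (m ℕ.* m ℕ.+ 1) ℕ.* (m ℕ.* m) ℕ.+ 2 ℕ.* (m ℕ.* m ℕ.+ 1) ℕ.* m ℕ.+ m ℕ.< Q ℕ.* (m ℕ.* m ℕ.+ m ℕ.+ 2)
numeric-bound zero Q _ 3≤Q = ℕ.<-≤-trans (ℕ.s≤s ℕ.z≤n) (ℕ.*-monoˡ-≤ 2 3≤Q)
-- At m = 1 the inequality fails for Q = 2, which m⁴ < Q admits; 3 ≤ Q excludes it.
numeric-bound (suc zero) Q _ 3≤Q = ℕ.<-≤-trans (ℕ.m≤m+n 10 2) (ℕ.*-monoˡ-≤ 4 3≤Q)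
-- It suffices to take Q = m⁴ + 1. For m = 2 + j the slack is the polynomial `rest j`, whose
-- coefficients are all positive.
numeric-bound (suc (suc j)) Q m⁴<Q _ = ℕ.<-≤-trans (ℕ.≤-trans (ℕ.m≤m+n _ (rest j)) (ℕ.≤-reflexive (eq j))) (ℕ.*-monoˡ-≤ _ m⁴<Q)
  where
  open +-*-Solver
  rest : ℕ → ℕ
  rest j = j ℕ.* j ℕ.* j ℕ.* j ℕ.* j ℕ.+ 10 ℕ.* (j ℕ.* j ℕ.* j ℕ.* j) ℕ.+ 38 ℕ.* (j ℕ.* j ℕ.* j) ℕ.+ 68 ℕ.* (j ℕ.* j) ℕ.+ 54 ℕ.* j ℕ.+ 13
  eq : ∀ j → let m = 2 ℕ.+ j in
    suc ((m ℕ.* m ℕ.+ 1) ℕ.* (m ℕ.* m ℕ.+ 1) ℕ.* (m ℕ.* m) ℕ.+ 2 ℕ.* (m ℕ.* m ℕ.+ 1) ℕ.* m ℕ.+ m) ℕ.+ rest j ≡ suc (m ℕ.* m ℕ.* m ℕ.* m) ℕ.* (m ℕ.* m ℕ.+ m ℕ.+ 2)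
  eq = solve 1 (λ j → let m = con 2 :+ j in
    con 1 :+ ((m :* m :+ con 1) :* (m :* m :+ con 1) :* (m :* m) :+ con 2 :* (m :* m :+ con 1) :* m :+ m)
      :+ (j :* j :* j :* j :* j :+ con 10 :* (j :* j :* j :* j) :+ con 38 :* (j :* j :* j) :+ con 68 :* (j :* j) :+ con 54 :* j :+ con 13)
    := (con 1 :+ m :* m :* m :* m) :* (m :* m :+ m :+ con 2)) refl

-- With N u the number of k-th roots of u, the function f = N - 1 has mean zero, and T = f * f takes the value -Q at c if c is not
-- a sum of two k-th powers.  The operator φ sends the weight f to an almost orthogonal family, since two distinct lines v = c g h meet once;
-- Cauchy-Schwarz then bounds T c as the Weil bound would.
module TwoPowers {Q : ℕ} (G : FiniteField Q) (k : ℕ) (1≤k : 1 ℕ.≤ k) (c : Fin Q) where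
  open Arithmetic G renaming (_+_ to _⊞_; _*_ to _⊠_; _-_ to _⊟_; -_ to ⊟_) hiding (solve; _:=_; _:+_; _:*_; _:-_; :-_)
  open import Data.Integer using (+_; 0ℤ; 1ℤ; _+_; _*_; -_; _-_)
  private module A = Arithmetic G using (solve; _:=_; _:+_; _:*_; _:-_; :-_)
  open ℤSums
  open ≡-Reasoning
  open ℤSolver.+-*-Solver using (solve; _:=_; _:+_; _:*_; _:-_; :-_; con)

  N f : Fin Q → ℤ
  N u = sum (λ x → + ι (pow x k Fin.≟ u))
  f u = N u - 1ℤ

  sum-N : ∀ (g : Fin Q → ℤ) → sum (λ u → N u * g u) ≡ sum (λ x → g (pow x k))
  sum-N g = begin
    sum (λ u → N u * g u)                                   ≡⟨ sum-cong (λ u → sum-* (g u) _) ⟩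
    sum (λ u → sum (λ x → + ι (pow x k Fin.≟ u) * g u))     ≡⟨ sum-swap _ ⟩
    sum (λ x → sum (λ u → + ι (pow x k Fin.≟ u) * g u))     ≡⟨ sum-cong (λ x → trans (sum-single _ (pow x k)
        (λ u u≢ → trans (cong (λ z → + z * g u) (ι-no (pow x k Fin.≟ u) (λ e → u≢ (sym e)))) (ℤ.*-zeroˡ (g u))))
        (trans (cong (λ z → + z * g (pow x k)) (ι-yes (pow x k Fin.≟ pow x k) refl)) (ℤ.*-identityˡ _))) ⟩
    sum (λ x → g (pow x k))                                 ∎

  sum-f* : ∀ (g : Fin Q → ℤ) → sum (λ u → f u * g u) ≡ sum (λ x → g (pow x k)) - sum g
  sum-f* g = trans (sum-cong (λ u → solve 2 (λ n g → (n :- con 1ℤ) :* g := n :* g :- g) refl (N u) (g u)))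
    (trans (sum-- (λ u → N u * g u) g) (cong (_- sum g) (sum-N g)))

  sum-f : sum f ≡ 0ℤ
  sum-f = trans (sum-cong (λ u → sym (ℤ.*-identityʳ (f u)))) (trans (sum-f* (λ _ → 1ℤ)) (ℤ.+-inverseʳ (sum {Q} (λ _ → 1ℤ))))

  f-0 : f 0# ≡ 0ℤ
  f-0 = trans (cong (_- 1ℤ) (trans (sum-single _ 0# (λ x x≢0 → cong +_ (ι-no (pow x k Fin.≟ 0#) (pow-≢0 k x≢0))))
     (cong +_ (ι-yes (pow 0# k Fin.≟ 0#) (pow-0# 1≤k))))) refl

  f-0* : ∀ y → f 0# * y ≡ 0ℤ
  f-0* y = trans (cong (_* y) f-0) (ℤ.*-zeroˡ y)

  Invariant : (Fin Q → ℤ) → Set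
  Invariant g = ∀ u x → x ≢ 0# → g (u ⊠ pow x k) ≡ g u

  f-invariant : Invariant f
  f-invariant u x x≢0 = cong (_- 1ℤ) (trans (sum-permute _ (scale x x≢0)) (sum-cong (λ y → cong +_
    (ι-cong (pow (x ⊠ y) k Fin.≟ (u ⊠ pow x k)) (pow y k Fin.≟ u)
      (λ e → *-cancelˡ (pow-≢0 k x≢0) (trans (sym (pow-* x y k)) (trans e (*-comm u _))))
      (λ e → trans (pow-* x y k) (trans (cong (pow x k ⊠_) e) (*-comm _ u)))))))

  sum-scale : ∀ (g : Fin Q → ℤ) {a} → a ≢ 0# → sum (λ u → g (a ⊠ u)) ≡ sum g
  sum-scale g {a} a≢0 = sym (sum-permute g (scale a a≢0))

  Q-1 : ℤ
  Q-1 = + Q - 1ℤ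

  -- The weight N turns the sum into one over x of g (a xᵏ). By invariance this is g a for each of
  -- the Q - 1 nonzero x, so only x = 0 deviates.
  sum-f*scaled : ∀ {g : Fin Q → ℤ} → Invariant g → ∀ {a} → a ≢ 0# →
                 sum (λ u → f u * g (a ⊠ u)) ≡ g 0# + Q-1 * g a - sum g
  sum-f*scaled {g} inv {a} a≢0 = trans (sum-f* (λ u → g (a ⊠ u))) (cong₂ _-_
    (trans (sum-almost-const (λ x → g (a ⊠ pow x k)) 0# (g a) (λ x x≢0 → inv a x x≢0))
       (cong (λ z → z + Q-1 * g a) (cong g (trans (cong (a ⊠_) (pow-0# 1≤k)) (zeroʳ a)))))
    (sum-scale g a≢0))

  T : Fin Q → ℤ
  T z = sum (λ u → f u * f (z ⊟ u))

  T-invariant : Invariant T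
  T-invariant z x x≢0 = trans (sym (sum-scale (λ u → f u * f (z ⊠ pow x k ⊟ u)) (pow-≢0 k x≢0)))
    (sum-cong (λ u → cong₂ _*_
      (trans (cong f (*-comm (pow x k) u)) (f-invariant u x x≢0))
      (trans (cong f (A.solve 3 (λ z u p → z A.:* p A.:- p A.:* u A.:= (z A.:- u) A.:* p) refl z u (pow x k))) (f-invariant (z ⊟ u) x x≢0))))

  sum-f-reflect : ∀ a → sum (λ u → f (a ⊟ u)) ≡ 0ℤ
  sum-f-reflect a = trans (sym (sum-permute f (reflect a))) sum-f

  sum-f-shift : ∀ a → sum (λ u → f (u ⊞ a)) ≡ 0ℤ
  sum-f-shift a = trans (sym (sum-permute f (shift a))) sum-f

  sum-T : sum T ≡ 0ℤ
  sum-T = trans (sum-swap (λ z u → f u * f (z ⊟ u))) (sum-zero (λ u →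
    trans (sym (*-sum (f u) (λ z → f (z ⊟ u)))) (trans (cong (f u *_) (sum-f-shift (⊟ u))) (ℤ.*-zeroʳ (f u)))))

  M : ℤ
  M = sum (λ u → f u * f u)

  M≡ : M ≡ Q-1 * f 1#
  M≡ = begin
    M                                ≡⟨ sum-cong (λ u → cong (λ z → f u * f z) (*-identityˡ u)) ⟨
    sum (λ u → f u * f (1# ⊠ u))     ≡⟨ sum-f*scaled f-invariant 1≢0 ⟩
    f 0# + Q-1 * f 1# - sum f        ≡⟨ cong₂ (λ a b → a + Q-1 * f 1# - b) f-0 sum-f ⟩
    0ℤ + Q-1 * f 1# - 0ℤ             ≡⟨ solve 1 (λ x → con 0ℤ :+ x :- con 0ℤ := x) refl (Q-1 * f 1#) ⟩
    Q-1 * f 1#                       ∎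

  -- Half of the nonnegative sum of the squares of f u - f (-u) is `M - T 0#`.
  T0≤M : T 0# ℤ.≤ M
  T0≤M = ℤ.*-cancelˡ-≤-pos (T 0#) M (+ 2) (ℤ.0≤i-j⇒j≤i (subst (0ℤ ℤ.≤_) eq (sum-nonneg (λ u → square-nonneg (f u - f (0# ⊟ u))))))
    where
    eq : sum (λ u → (f u - f (0# ⊟ u)) * (f u - f (0# ⊟ u))) ≡ + 2 * M - + 2 * T 0#
    eq = begin
      sum (λ u → (f u - f (0# ⊟ u)) * (f u - f (0# ⊟ u)))
        ≡⟨ sum-cong (λ u → solve 2 (λ a b → (a :- b) :* (a :- b) := (a :* a :+ b :* b) :- con (+ 2) :* (a :* b)) refl (f u) (f (0# ⊟ u))) ⟩
      sum (λ u → (f u * f u + f (0# ⊟ u) * f (0# ⊟ u)) - + 2 * (f u * f (0# ⊟ u)))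
        ≡⟨ sum-- _ _ ⟩
      sum (λ u → f u * f u + f (0# ⊟ u) * f (0# ⊟ u)) - sum (λ u → + 2 * (f u * f (0# ⊟ u)))
        ≡⟨ cong₂ _-_ (trans (sum-+ _ _) (cong (λ z → M + z) (sym (sum-permute (λ u → f u * f u) (reflect 0#))))) (sym (*-sum (+ 2) _)) ⟩
      (M + M) - + 2 * T 0#
        ≡⟨ solve 2 (λ m t → (m :+ m) :- con (+ 2) :* t := con (+ 2) :* m :- con (+ 2) :* t) refl M (T 0#) ⟩
      + 2 * M - + 2 * T 0# ∎

  module Bound (c≢0 : c ≢ 0#) where
    φ : Fin Q → Fin Q → ℤ
    φ h v = sum (λ g → f g * f (c ⊠ h ⊠ g ⊟ v))

    C : ℤ
    C = Q-1 * (T 0# + Q-1 * T c)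

    inner : ∀ h → f h * sum (λ g → f g * T (c ⊠ h ⊠ g)) ≡ f h * (T 0# + Q-1 * T (c ⊠ h))
    inner h with h Fin.≟ 0#
    ... | yes refl = trans (f-0* (sum (λ g → f g * T (c ⊠ 0# ⊠ g)))) (sym (f-0* (T 0# + Q-1 * T (c ⊠ 0#))))
    ... | no h≢0 = cong (f h *_) (trans (sum-f*scaled T-invariant (*-≢0 c≢0 h≢0)) (trans (cong (λ z → T 0# + Q-1 * T (c ⊠ h) - z) sum-T) (ℤ.+-identityʳ _)))

    -- Summing over v first produces T (c h g). Since T is constant on cosets of the powers and has
    -- mean zero, `sum-f*scaled` evaluates the sum over g and then the one over h. The dilation h =
    -- 0, to which it does not apply, carries the weight f 0 = 0.
    sum-ffφ : sum (λ h → sum (λ v → f h * f v * φ h v)) ≡ C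
    sum-ffφ = begin
      sum (λ h → sum (λ v → f h * f v * φ h v))          ≡⟨ sum-cong (λ h → trans (per-h h) (inner h)) ⟩
      sum (λ h → f h * (T 0# + Q-1 * T (c ⊠ h)))         ≡⟨ sum-cong (λ h → solve 4 (λ f t r s → f :* (t :+ r :* s) := f :* t :+ r :* (f :* s)) refl (f h) (T 0#) Q-1 (T (c ⊠ h))) ⟩
      sum (λ h → f h * T 0# + Q-1 * (f h * T (c ⊠ h)))   ≡⟨ sum-+ _ _ ⟩
      sum (λ h → f h * T 0#) + sum (λ h → Q-1 * (f h * T (c ⊠ h)))
        ≡⟨ cong₂ _+_ (trans (sym (sum-* (T 0#) f)) (trans (cong (_* T 0#) sum-f) (ℤ.*-zeroˡ (T 0#)))) (trans (sym (*-sum Q-1 _)) (cong (Q-1 *_) (trans (sum-f*scaled T-invariant c≢0) (cong (λ z → T 0# + Q-1 * T c - z) sum-T)))) ⟩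
      0ℤ + Q-1 * (T 0# + Q-1 * T c - 0ℤ)                 ≡⟨ solve 2 (λ r s → con 0ℤ :+ r :* (s :- con 0ℤ) := r :* s) refl Q-1 (T 0# + Q-1 * T c) ⟩
      C                                                  ∎
      where
      per-h : ∀ h → sum (λ v → f h * f v * φ h v) ≡ f h * sum (λ g → f g * T (c ⊠ h ⊠ g))
      per-h h = begin
        sum (λ v → f h * f v * φ h v)
          ≡⟨ sum-cong (λ v → trans (ℤ.*-assoc (f h) (f v) _) (cong (f h *_) (*-sum (f v) _))) ⟩
        sum (λ v → f h * sum (λ g → f v * (f g * f (c ⊠ h ⊠ g ⊟ v))))
          ≡⟨ *-sum (f h) _ ⟨
        f h * sum (λ v → sum (λ g → f v * (f g * f (c ⊠ h ⊠ g ⊟ v))))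
          ≡⟨ cong (f h *_) (sum-swap _) ⟩
        f h * sum (λ g → sum (λ v → f v * (f g * f (c ⊠ h ⊠ g ⊟ v))))
          ≡⟨ cong (f h *_) (sum-cong (λ g → trans (sum-cong (λ v → solve 3 (λ a b c → a :* (b :* c) := b :* (a :* c)) refl (f v) (f g) (f (c ⊠ h ⊠ g ⊟ v)))) (sym (*-sum (f g) _)))) ⟩
        f h * sum (λ g → f g * T (c ⊠ h ⊠ g)) ∎

    J : Fin Q → Fin Q → ℤ
    J g g′ = sum (λ h → sum (λ v → f (c ⊠ h ⊠ g ⊟ v) * f (c ⊠ h ⊠ g′ ⊟ v)))

    J-reflect : ∀ g g′ → J g g′ ≡ sum (λ h → sum (λ v → f v * f (c ⊠ (g′ ⊟ g) ⊠ h ⊞ v)))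
    J-reflect g g′ = sum-cong (λ h → trans (sum-permute _ (reflect (c ⊠ h ⊠ g))) (sum-cong (λ v → cong₂ _*_
      (cong f (A.solve 2 (λ a v → a A.:- (a A.:- v) A.:= v) refl (c ⊠ h ⊠ g) v))
      (cong f (A.solve 5 (λ c h g g′ v → c A.:* h A.:* g′ A.:- (c A.:* h A.:* g A.:- v) A.:= c A.:* (g′ A.:- g) A.:* h A.:+ v) refl c h g g′ v)))))

    J-diagonal : ∀ g → J g g ≡ + Q * M
    J-diagonal g = trans (J-reflect g g) (trans (sum-cong (λ h → sum-cong (λ v → cong (λ z → f v * f z)
      (trans (cong (λ z → c ⊠ z ⊠ h ⊞ v) (-‿inverseʳ g)) (trans (cong (_⊞ v) (trans (cong (_⊠ h) (zeroʳ c)) (zeroˡ h))) (+-identityˡ v))))))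
      (sum-+const Q M))

    -- For g′ ≠ g and fixed v the argument c (g′ - g) h + v runs over the whole field with h, so the
    -- mean zero of f annihilates the inner sum. This is the almost orthogonality.
    J-off : ∀ g g′ → g′ ≢ g → J g g′ ≡ 0ℤ
    J-off g g′ ne = trans (J-reflect g g′) (trans (sum-swap _) (sum-zero (λ v → trans (sym (*-sum (f v) _))
      (trans (cong (f v *_) (trans (sum-scale (λ z → f (z ⊞ v)) (*-≢0 c≢0 (λ e → ne (x-y≡0⇒x≡y e)))) (sum-f-shift v))) (ℤ.*-zeroʳ (f v))))))

    sum-φφ : sum (λ h → sum (λ v → φ h v * φ h v)) ≡ + Q * M * M
    sum-φφ = begin
      sum (λ h → sum (λ v → φ h v * φ h v))
        ≡⟨ sum-cong (λ h → sum-cong (λ v → expand h v)) ⟩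
      sum (λ h → sum (λ v → sum (λ g → sum (λ g′ → term g g′ h v))))
        ≡⟨ sum-cong (λ h → trans (sum-swap _) (sum-cong (λ g → sum-swap _))) ⟩
      sum (λ h → sum (λ g → sum (λ g′ → sum (λ v → term g g′ h v))))
        ≡⟨ trans (sum-swap _) (sum-cong (λ g → sum-swap _)) ⟩
      sum (λ g → sum (λ g′ → sum (λ h → sum (λ v → term g g′ h v))))
        ≡⟨ sum-cong (λ g → sum-cong (λ g′ → trans (sum-cong (λ h → sym (*-sum (f g * f g′) _))) (sym (*-sum (f g * f g′) _)))) ⟩
      sum (λ g → sum (λ g′ → f g * f g′ * J g g′))
        ≡⟨ sum-cong (λ g → trans (sum-single _ g (λ g′ ne → trans (cong (f g * f g′ *_) (J-off g g′ ne)) (ℤ.*-zeroʳ (f g * f g′)))) (cong (f g * f g *_) (J-diagonal g))) ⟩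
      sum (λ g → f g * f g * (+ Q * M))
        ≡⟨ sum-* (+ Q * M) _ ⟨
      M * (+ Q * M)
        ≡⟨ ℤ.*-comm M (+ Q * M) ⟩
      + Q * M * M ∎
      where
      term : Fin Q → Fin Q → Fin Q → Fin Q → ℤ
      term g g′ h v = f g * f g′ * (f (c ⊠ h ⊠ g ⊟ v) * f (c ⊠ h ⊠ g′ ⊟ v))
      expand : ∀ h v → φ h v * φ h v ≡ sum (λ g → sum (λ g′ → term g g′ h v))
      expand h v = trans (sum-* (φ h v) _) (sum-cong (λ g → trans (*-sum (f g * f (c ⊠ h ⊠ g ⊟ v)) _) (sum-cong (λ g′ →
        solve 4 (λ a b c d → a :* b :* (c :* d) := a :* c :* (b :* d)) refl (f g) (f (c ⊠ h ⊠ g ⊟ v)) (f g′) (f (c ⊠ h ⊠ g′ ⊟ v))))))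

    φ-0 : ∀ h → φ h 0# ≡ Q-1 * f (c ⊠ h)
    φ-0 h = trans (sum-cong (λ g → cong (λ z → f g * f z) (x-0≡x _))) (go (h Fin.≟ 0#))
      where
      go : Dec (h ≡ 0#) → sum (λ g → f g * f (c ⊠ h ⊠ g)) ≡ Q-1 * f (c ⊠ h)
      go (no h≢0) = trans (sum-f*scaled f-invariant (*-≢0 c≢0 h≢0)) (trans (cong₂ (λ a b → a + Q-1 * f (c ⊠ h) - b) f-0 sum-f) (solve 1 (λ x → con 0ℤ :+ x :- con 0ℤ := x) refl _))
      go (yes refl) = trans (sum-zero (λ g → trans (cong (f g *_) (trans (cong f (trans (cong (_⊠ g) (zeroʳ c)) (zeroˡ g))) f-0)) (ℤ.*-zeroʳ (f g))))
        (sym (trans (cong (Q-1 *_) (trans (cong f (zeroʳ c)) f-0)) (ℤ.*-zeroʳ Q-1)))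

    sum-φ0 : sum (λ h → φ h 0# * φ h 0#) ≡ Q-1 * Q-1 * M
    sum-φ0 = begin
      sum (λ h → φ h 0# * φ h 0#)
        ≡⟨ sum-cong (λ h → trans (cong₂ _*_ (φ-0 h) (φ-0 h)) (solve 2 (λ r x → r :* x :* (r :* x) := r :* r :* (x :* x)) refl Q-1 (f (c ⊠ h)))) ⟩
      sum (λ h → Q-1 * Q-1 * (f (c ⊠ h) * f (c ⊠ h)))
        ≡⟨ *-sum (Q-1 * Q-1) _ ⟨
      Q-1 * Q-1 * sum (λ h → f (c ⊠ h) * f (c ⊠ h))
        ≡⟨ cong (Q-1 * Q-1 *_) (sum-scale (λ u → f u * f u) c≢0) ⟩
      Q-1 * Q-1 * M ∎

    -- Cauchy-Schwarz in quadratic form; f 0 = 0 lets us drop the column v = 0 of φ.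
    quadratic : ∀ X → 0ℤ ℤ.≤ X * X * (M * M) + + 2 * X * C + (+ Q * M * M - Q-1 * Q-1 * M)
    -- The dropped column matters. With m = f 1 ≥ 1, keeping it and inserting M = (Q - 1) m, T c =
    -- -Q and the bound on `T 0#` would leave a form that is positive for every X at Q = m⁴ + 1.
    quadratic X = subst (0ℤ ℤ.≤_) eq (subst (0ℤ ℤ.≤_) (sum-- _ _) (sum-nonneg (λ h →
        ℤ.i≤j⇒0≤j-i (subst (ℤ._≤ sum (λ v → sq h v)) (at0 h) (sum≥term-ℤ (sq h) (λ v → square-nonneg (X * (f h * f v) + φ h v)) 0#)))))
      where
      sq : Fin Q → Fin Q → ℤ
      sq h v = (X * (f h * f v) + φ h v) * (X * (f h * f v) + φ h v)
      at0 : ∀ h → sq h 0# ≡ φ h 0# * φ h 0#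
      at0 h = cong₂ _*_ e e
        where
        e : X * (f h * f 0#) + φ h 0# ≡ φ h 0#
        e = trans (cong (λ z → X * (f h * z) + φ h 0#) f-0) (solve 3 (λ x a p → x :* (a :* con 0ℤ) :+ p := p) refl X (f h) (φ h 0#))
      sum-ff : sum (λ h → sum (λ v → f h * f v * (f h * f v))) ≡ M * M
      sum-ff = trans (sum-cong (λ h → trans (sum-cong (λ v → solve 2 (λ a b → a :* b :* (a :* b) := a :* a :* (b :* b)) refl (f h) (f v))) (sym (*-sum (f h * f h) _)))) (sym (sum-* M _))
      eq : sum (λ h → sum (λ v → sq h v)) - sum (λ h → φ h 0# * φ h 0#) ≡ X * X * (M * M) + + 2 * X * C + (+ Q * M * M - Q-1 * Q-1 * M)
      eq = begin
        sum (λ h → sum (λ v → sq h v)) - sum (λ h → φ h 0# * φ h 0#)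
          ≡⟨ cong₂ _-_ (trans (sum-cong (λ h → row h)) (trans (sum-+ _ _) (cong₂ _+_ (trans (sum-+ _ _) (cong₂ _+_ (trans (sym (*-sum (X * X) _)) (cong (X * X *_) sum-ff)) (trans (sym (*-sum (+ 2 * X) _)) (cong (+ 2 * X *_) sum-ffφ)))) sum-φφ))) sum-φ0 ⟩
        X * X * (M * M) + + 2 * X * C + + Q * M * M - Q-1 * Q-1 * M
          ≡⟨ solve 3 (λ a b c → a :+ b :- c := a :+ (b :- c)) refl (X * X * (M * M) + + 2 * X * C) (+ Q * M * M) (Q-1 * Q-1 * M) ⟩
        X * X * (M * M) + + 2 * X * C + (+ Q * M * M - Q-1 * Q-1 * M) ∎
        where
        row : ∀ h → sum (λ v → sq h v) ≡ X * X * sum (λ v → f h * f v * (f h * f v)) + + 2 * X * sum (λ v → f h * f v * φ h v) + sum (λ v → φ h v * φ h v)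
        row h = trans (sum-cong (λ v → solve 3 (λ x a p → (x :* a :+ p) :* (x :* a :+ p) := x :* x :* (a :* a) :+ con (+ 2) :* x :* (a :* p) :+ p :* p) refl X (f h * f v) (φ h v)))
          (trans (sum-+ _ _) (cong₂ _+_ (trans (sum-+ _ _) (cong₂ _+_ (sym (*-sum (X * X) _)) (sym (*-sum (+ 2 * X) _)))) refl))

    unsolvable⇒T : (∀ x y → pow x k ⊞ pow y k ≢ c) → T c ≡ - + Q
    unsolvable⇒T none = begin
      T c                                                              ≡⟨ sum-f* (λ u → f (c ⊟ u)) ⟩
      sum (λ x → f (c ⊟ pow x k)) - sum (λ u → f (c ⊟ u))              ≡⟨ cong₂ _-_ (sum-cong (λ x → cong (_- 1ℤ) (sum-zero (λ y →
         cong +_ (ι-no (pow y k Fin.≟ c ⊟ pow x k) (λ e → none x y (trans (cong (pow x k ⊞_) e) (A.solve 2 (λ p c → p A.:+ (c A.:- p) A.:= c) refl (pow x k) c)))))))) (sum-f-reflect c) ⟩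
      sum {Q} (λ _ → - 1ℤ) - 0ℤ                                        ≡⟨ cong (_- 0ℤ) (sum-+const Q (- 1ℤ)) ⟩
      + Q * - 1ℤ - 0ℤ                                                  ≡⟨ solve 1 (λ q → q :* con (- 1ℤ) :- con 0ℤ := :- q) refl (+ Q) ⟩
      - + Q                                                            ∎

    unsolvable-absurd : (k ℕ.∸ 1) ℕ.^ 4 ℕ.< Q → 3 ℕ.≤ Q → (∀ x y → pow x k ⊞ pow y k ≢ c) → ⊥
    unsolvable-absurd k⁴<Q 3≤Q none = ℕ.<⇒≱ (numeric-bound m Q m⁴<Q 3≤Q) (ℤ.drop‿+≤+ (subst₂ ℤ._≤_ lhs rhs (ℤ.0≤i-j⇒j≤i 0≤B)))
      where
      roots? : ∀ x → Dec (pow x k ≡ 1#)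
      roots? x = pow x k Fin.≟ 1#
      1≤D : 1 ℕ.≤ # roots?
      1≤D = subst (ℕ._≤ # roots?) (ι-yes (roots? 1#) (pow-1# k)) (sum≥term _ 1#)
      m r : ℕ
      m = # roots? ℕ.∸ 1
      r = Q ℕ.∸ 1
      m⁴<Q : m ℕ.* m ℕ.* m ℕ.* m ℕ.< Q
      m⁴<Q = ℕ.≤-<-trans (ℕ.≤-trans (ℕ.≤-reflexive (+-*-Solver.solve 1 (λ m → m Sℕ.:* m Sℕ.:* m Sℕ.:* m Sℕ.:= m Sℕ.:^ 4) refl m)) (ℕ.^-monoˡ-≤ 4 (ℕ.∸-monoˡ-≤ 1 (#pow≡1≤ 1≤k)))) k⁴<Q
        where module Sℕ = +-*-Solver
      f1 : f 1# ≡ + m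
      f1 = trans (cong (_- 1ℤ) (sum-pos (λ x → ι (roots? x)))) (ℤ.⊖-≥ 1≤D)
      Q-1≡ : Q-1 ≡ + r
      Q-1≡ = ℤ.⊖-≥ (ℕ.≤-trans (ℕ.s≤s ℕ.z≤n) 3≤Q)
      M≡rm : M ≡ + r * + m
      M≡rm = trans M≡ (cong₂ _*_ Q-1≡ f1)
      X B : ℤ
      -- `B` is the quadratic form divided by r², after M = r m, `T 0#` ≤ M and T c = -Q. For m ≥ 1
      -- its minimum in X is at (Q - m)/m², close to m² at the critical size Q = m⁴; an X free of Q
      -- keeps `B` linear in Q.
      X = + (m ℕ.* m ℕ.+ 1)
      B = X * X * (+ m * + m) + + 2 * X * (+ m - + Q) + (+ Q * (+ m * + m) - (+ Q - 1ℤ) * + m)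
      instance
        r-pos : ℤ.Positive (+ r * + r)
        r-pos = subst ℤ.Positive (ℤ.pos-* r r) (ℤ.positive (ℤ.+<+ (ℕ.*-mono-≤ {1} {r} {1} {r} 1≤r 1≤r)))
          where
          1≤r : 1 ℕ.≤ r
          1≤r = ℕ.≤-trans (ℕ.s≤s ℕ.z≤n) (ℕ.∸-monoˡ-≤ 1 3≤Q)
      0≤r²B : 0ℤ ℤ.≤ + r * + r * B
      0≤r²B = ℤ.≤-trans (quadratic X) (ℤ.≤-trans (ℤ.+-monoˡ-≤ (+ Q * M * M - Q-1 * Q-1 * M) (ℤ.+-monoʳ-≤ (X * X * (M * M)) C≤)) (ℤ.≤-reflexive eq))
        where
        C≤ : + 2 * X * C ℤ.≤ + 2 * X * (+ r * (M + + r * - + Q))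
        C≤ = ℤ.*-monoˡ-≤-nonNeg (+ 2 * X) {{subst ℤ.NonNegative (ℤ.pos-* 2 (m ℕ.* m ℕ.+ 1)) _}} (subst (ℤ._≤ + r * (M + + r * - + Q)) (sym (cong₂ (λ a b → a * (T 0# + a * b)) Q-1≡ (unsolvable⇒T none)))
          (ℤ.*-monoˡ-≤-nonNeg (+ r) (ℤ.+-monoˡ-≤ (+ r * - + Q) T0≤M)))
        eq : X * X * (M * M) + + 2 * X * (+ r * (M + + r * - + Q)) + (+ Q * M * M - Q-1 * Q-1 * M) ≡ + r * + r * B
        eq = trans (cong₂ (λ a b → X * X * (a * a) + + 2 * X * (+ r * (a + + r * - + Q)) + (+ Q * a * a - b * b * a)) M≡rm Q-1≡)
          (trans (solve 4 (λ X r m q → X :* X :* (r :* m :* (r :* m)) :+ con (+ 2) :* X :* (r :* (r :* m :+ r :* (:- q))) :+ (q :* (r :* m) :* (r :* m) :- r :* r :* (r :* m))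
             := r :* r :* (X :* X :* (m :* m) :+ con (+ 2) :* X :* (m :- q) :+ (q :* (m :* m) :- r :* m))) refl X (+ r) (+ m) (+ Q))
             (cong (λ a → + r * + r * (X * X * (+ m * + m) + + 2 * X * (+ m - + Q) + (+ Q * (+ m * + m) - a * + m))) (sym Q-1≡)))
      low high : ℤ
      low = + Q * (+ m * + m + + m + + 2)
      high = (+ m * + m + 1ℤ) * (+ m * + m + 1ℤ) * (+ m * + m) + + 2 * (+ m * + m + 1ℤ) * + m + + m
      X≡ : X ≡ + m * + m + 1ℤ
      X≡ = cong (λ z → z + 1ℤ) (ℤ.pos-* m m)
      0≤B : 0ℤ ℤ.≤ high - low
      0≤B = subst (0ℤ ℤ.≤_) (trans (cong (λ X → X * X * (+ m * + m) + + 2 * X * (+ m - + Q) + (+ Q * (+ m * + m) - (+ Q - 1ℤ) * + m)) X≡)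
         (solve 2 (λ m q → let X = m :* m :+ con 1ℤ in X :* X :* (m :* m) :+ con (+ 2) :* X :* (m :- q) :+ (q :* (m :* m) :- (q :- con 1ℤ) :* m)
            := X :* X :* (m :* m) :+ con (+ 2) :* X :* m :+ m :- q :* (m :* m :+ m :+ con (+ 2))) refl (+ m) (+ Q)))
         (ℤ.*-cancelˡ-≤-pos 0ℤ B (+ r * + r) (subst (ℤ._≤ + r * + r * B) (sym (ℤ.*-zeroʳ (+ r * + r))) 0≤r²B))
      lhs : low ≡ + (Q ℕ.* (m ℕ.* m ℕ.+ m ℕ.+ 2))
      lhs = trans (cong (λ z → + Q * (z + + m + + 2)) (sym (ℤ.pos-* m m))) (sym (ℤ.pos-* Q _))
      rhs : high ≡ + ((m ℕ.* m ℕ.+ 1) ℕ.* (m ℕ.* m ℕ.+ 1) ℕ.* (m ℕ.* m) ℕ.+ 2 ℕ.* (m ℕ.* m ℕ.+ 1) ℕ.* m ℕ.+ m)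
      rhs = trans (cong (λ z → (z + 1ℤ) * (z + 1ℤ) * z + + 2 * (z + 1ℤ) * + m + + m) (sym (ℤ.pos-* m m)))
        (cong (λ z → z + + m) (cong₂ _+_ (trans (cong (_* + (m ℕ.* m)) (sym (ℤ.pos-* x x))) (sym (ℤ.pos-* (x ℕ.* x) (m ℕ.* m)))) (trans (cong (_* + m) (sym (ℤ.pos-* 2 x))) (sym (ℤ.pos-* (2 ℕ.* x) m)))))
        where x = m ℕ.* m ℕ.+ 1

  sum-of-two-powers : (k ℕ.∸ 1) ℕ.^ 4 ℕ.< Q → 3 ℕ.≤ Q → ∃₂ λ x y → pow x k ⊞ pow y k ≡ c
  sum-of-two-powers k⁴<Q 3≤Q with c Fin.≟ 0#
  ... | yes c≡0 = 0# , 0# , trans (cong₂ _⊞_ (pow-0# 1≤k) (pow-0# 1≤k)) (trans (+-identityˡ 0#) (sym c≡0))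
  ... | no c≢0 with Fin.any? (λ x → Fin.any? (λ y → pow x k ⊞ pow y k Fin.≟ c))
  ... | yes (x , y , e) = x , y , e
  ... | no none = ⊥-elim (Bound.unsolvable-absurd c≢0 k⁴<Q 3≤Q (λ x y e → none (x , y , e)))

-- Extension fields and scalar matrices

prime∤! : ∀ {p} → Prime p → ∀ m → m ℕ.< p → ¬ p ∣ m !
prime∤! {p} pp zero m<p p∣1 = ¬prime[1] (subst Prime (ℕ.≤-antisym (∣⇒≤ p∣1) m<p) pp)
prime∤! {p} pp (suc m) m<p p∣ with euclidsLemma (suc m) (m !) pp p∣
... | inj₁ p∣sm = ℕ.<⇒≱ m<p (∣⇒≤ p∣sm)
... | inj₂ p∣m! = prime∤! pp m (ℕ.<-trans (ℕ.n<1+n m) m<p) p∣m!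

prime∣binomial : ∀ {p j} → Prime p → 1 ℕ.≤ j → j ℕ.< p → p ∣ p Comb.C j
prime∣binomial {p} {j} pp 1≤j j<p with euclidsLemma (p Comb.C j) (j ! ℕ.* (p ℕ.∸ j) !) pp p∣
  where
  instance _ = j ℕ.!* (p ℕ.∸ j) !≢0
  p∣p! : ∀ p → 1 ℕ.≤ p → p ∣ p !
  p∣p! (suc p) _ = m∣m*n (p !)
  p∣ : p ∣ (p Comb.C j) ℕ.* (j ! ℕ.* (p ℕ.∸ j) !)
  p∣ = subst (p ∣_) (sym (trans (cong (ℕ._* (j ! ℕ.* (p ℕ.∸ j) !)) (nCk≡n!/k![n-k]! (ℕ.<⇒≤ j<p))) (m/n*n≡m (Comb.k![n∸k]!∣n! (ℕ.<⇒≤ j<p)))))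
         (p∣p! p (ℕ.≤-trans 1≤j (ℕ.<⇒≤ j<p)))
... | inj₁ p∣C = p∣C
... | inj₂ p∣!! with euclidsLemma (j !) ((p ℕ.∸ j) !) pp p∣!!
... | inj₁ p∣j! = ⊥-elim (prime∤! pp j j<p p∣j!)
... | inj₂ p∣! = ⊥-elim (prime∤! pp (p ℕ.∸ j) (ℕ.∸-monoʳ-< {p} {j} {0} 1≤j (ℕ.<⇒≤ j<p)) p∣!)

module Frobenius {c ℓ} (R : CommutativeRing c ℓ) {p : ℕ} (pp : Prime p) where
  open CommutativeRing R hiding (refl; sym; trans; zero)
  private module R = CommutativeRing R
  open Exp semiring using (_^_; ^-congˡ; ^-assocʳ)
  open Mult semiring using (×-assocˡ; ×-congʳ; ×-assoc-*; ×-homo-1) renaming (_×_ to _·_)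
  module RS = Algebra.Properties.Semiring.Sum semiring
  open SetoidReasoning setoid

  module _ (p1≈0 : p · 1# ≈ 0#) where
    p·≈0 : ∀ x → p · x ≈ 0#
    p·≈0 x = begin
      p · x          ≈⟨ ×-congʳ p (*-identityˡ x) ⟨
      p · (1# * x)   ≈⟨ ×-assoc-* p 1# x ⟨
      (p · 1#) * x   ≈⟨ *-congʳ p1≈0 ⟩
      0# * x         ≈⟨ zeroˡ x ⟩
      0#             ∎

    m·0≈0 : ∀ m → m · 0# ≈ 0#
    m·0≈0 zero = R.refl
    m·0≈0 (suc m) = R.trans (+-identityˡ _) (m·0≈0 m)

    multiple·≈0 : ∀ {m} x → p ∣ m → m · x ≈ 0#
    multiple·≈0 x (divides a refl) = R.trans (R.sym (×-assocˡ x a p)) (R.trans (×-congʳ a (p·≈0 x)) (m·0≈0 a))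

    frobenius : ∀ x y → (x + y) ^ p ≈ x ^ p + y ^ p
    frobenius x y = go p pp refl
      where
      zero-sum : ∀ {n} (f : Fin n → Carrier) → (∀ i → f i ≈ 0#) → RS.sum f ≈ 0#
      zero-sum {n} f f≈0 = R.trans (RS.sum-cong-≋ f≈0) (RS.sum-replicate-zero n)
      go : ∀ p₁ → Prime p₁ → p₁ ≡ p → (x + y) ^ p₁ ≈ x ^ p₁ + y ^ p₁
      go zero pp₁ _ = ⊥-elim (¬prime[0] pp₁)
      go (suc p′) pp₁ eq = begin
        (x + y) ^ suc p′                 ≈⟨ Binomial.theorem commutativeSemiring (suc p′) x y ⟩
        t zero + RS.sum (tail t)         ≈⟨ +-cong first (R.trans (RS.sum-init-last (tail t)) (+-cong (zero-sum (init (tail t)) middle) final)) ⟩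
        y ^ suc p′ + (0# + x ^ suc p′)   ≈⟨ +-congˡ (+-identityˡ _) ⟩
        y ^ suc p′ + x ^ suc p′          ≈⟨ +-comm _ _ ⟩
        x ^ suc p′ + y ^ suc p′          ∎
        where
        t : Fin (suc (suc p′)) → Carrier
        t = Binomial.binomialTerm commutativeSemiring x y (suc p′)
        C0 : suc p′ Comb.C 0 ≡ 1
        C0 = trans (Comb.nCk≡nC[n∸k] {0} {suc p′} ℕ.z≤n) (Comb.nCn≡1 (suc p′))
        first : t zero ≈ y ^ suc p′
        first = R.trans (R.reflexive (cong (_· (1# * y ^ suc p′)) C0)) (R.trans (×-homo-1 _) (*-identityˡ _))
        middle : ∀ i → t (suc (inject₁ i)) ≈ 0#
        middle i = multiple·≈0 _ (subst (_∣ suc p′ Comb.C suc (toℕ (inject₁ i))) eq (prime∣binomial pp₁ (ℕ.s≤s ℕ.z≤n)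
          (ℕ.s≤s (subst (ℕ._< p′) (sym (Fin.toℕ-inject₁ i)) (Fin.toℕ<n i)))))
        final : t (suc (fromℕ p′)) ≈ x ^ suc p′
        final = R.trans (R.reflexive (cong (λ j → (suc p′ Comb.C suc j) · (x ^ suc j * y ^ (p′ ℕ.∸ j))) (Fin.toℕ-fromℕ p′)))
          (R.trans (R.reflexive (cong₂ (λ a b → a · (x ^ suc p′ * y ^ b)) (Comb.nCn≡1 (suc p′)) (ℕ.n∸n≡0 p′)))
            (R.trans (×-homo-1 _) (*-identityʳ _)))

    frobenius^ : ∀ j x y → (x + y) ^ (p ℕ.^ j) ≈ x ^ (p ℕ.^ j) + y ^ (p ℕ.^ j)
    frobenius^ zero x y = R.trans (*-identityʳ _) (R.sym (+-cong (*-identityʳ _) (*-identityʳ _)))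
    frobenius^ (suc j) x y = begin
      (x + y) ^ (p ℕ.* p ℕ.^ j)                     ≈⟨ ^-assocʳ (x + y) p (p ℕ.^ j) ⟨
      ((x + y) ^ p) ^ (p ℕ.^ j)                     ≈⟨ ^-congˡ (p ℕ.^ j) (frobenius x y) ⟩
      (x ^ p + y ^ p) ^ (p ℕ.^ j)                   ≈⟨ frobenius^ j (x ^ p) (y ^ p) ⟩
      (x ^ p) ^ (p ℕ.^ j) + (y ^ p) ^ (p ℕ.^ j)     ≈⟨ +-cong (^-assocʳ x p (p ℕ.^ j)) (^-assocʳ y p (p ℕ.^ j)) ⟩
      x ^ (p ℕ.* p ℕ.^ j) + y ^ (p ℕ.* p ℕ.^ j)     ∎

-- The algebra F[x]/(xᴺ - 1) with N = suc N′; a k is the coefficient of xᵏ.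
module GroupAlgebra {q : ℕ} (G : FiniteField q) (N′ : ℕ) where
  open Arithmetic G
  open ≡-Reasoning
  private
    N = suc N′

  V : Set
  V = Fin N → Fin q

  -- k ↦ k - 1 modulo N
  rot : Fin N → Fin N
  rot zero = fromℕ N′
  rot (suc i) = inject₁ i

  ρ : ℕ → Fin N → Fin N
  ρ zero k = k
  ρ (suc m) k = ρ m (rot k)

  ρ-nowrap : ∀ m i j → m ℕ.+ toℕ i ≡ toℕ j → ρ m j ≡ i
  ρ-nowrap zero i j e = Fin.toℕ-injective (sym e)
  ρ-nowrap (suc m) i (suc j) e = ρ-nowrap m i (inject₁ j) (trans (ℕ.suc-injective e) (sym (Fin.toℕ-inject₁ j)))

  ρ-wrap : ∀ m i j → m ℕ.+ toℕ i ≡ N ℕ.+ toℕ j → ρ m j ≡ i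
  ρ-wrap zero i j e = ⊥-elim (ℕ.<⇒≱ (Fin.toℕ<n i) (ℕ.≤-trans (ℕ.m≤m+n N (toℕ j)) (ℕ.≤-reflexive (sym e))))
  ρ-wrap (suc m) i zero e = ρ-nowrap m i (fromℕ N′) (trans (ℕ.suc-injective e) (trans (ℕ.+-identityʳ N′) (sym (Fin.toℕ-fromℕ N′))))
  ρ-wrap (suc m) i (suc j) e = ρ-wrap m i (inject₁ j) (trans (ℕ.suc-injective e) (trans (ℕ.+-suc N′ (toℕ j)) (cong (λ z → suc (N′ ℕ.+ z)) (sym (Fin.toℕ-inject₁ j)))))

  ρ-N : ∀ k → ρ N k ≡ k
  ρ-N k = ρ-wrap N k k refl

  -- `ρ (toℕ i) k` is k - i modulo N, and k - (k - i) = i; the subtraction wraps around exactly if i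
  -- > k. Commutativity of the product rests on this reindexing.
  ρ-involutive : ∀ k i → ρ (toℕ (ρ (toℕ i) k)) k ≡ i
  ρ-involutive k i with toℕ i ℕ.≤? toℕ k
  ... | yes i≤k = back (ρ-nowrap (toℕ i) i′ k eq) (inj₁ (trans (ℕ.+-comm (toℕ i′) (toℕ i)) eq))
    where
    i′ : Fin N
    i′ = Fin.fromℕ< {toℕ k ℕ.∸ toℕ i} (ℕ.≤-<-trans (ℕ.m∸n≤m (toℕ k) (toℕ i)) (Fin.toℕ<n k))
    eq : toℕ i ℕ.+ toℕ i′ ≡ toℕ k
    eq = trans (cong (toℕ i ℕ.+_) (Fin.toℕ-fromℕ< _)) (ℕ.m+[n∸m]≡n i≤k)
    back : ∀ {j} → j ≡ i′ → (toℕ i′ ℕ.+ toℕ i ≡ toℕ k) ⊎ (toℕ i′ ℕ.+ toℕ i ≡ N ℕ.+ toℕ k) → ρ (toℕ j) k ≡ i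
    back refl (inj₁ e) = ρ-nowrap (toℕ i′) i k e
    back refl (inj₂ e) = ρ-wrap (toℕ i′) i k e
  ... | no i≰k = back (ρ-wrap (toℕ i) i′ k eq) (trans (ℕ.+-comm (toℕ i′) (toℕ i)) eq)
    where
    i≤ : toℕ i ℕ.≤ N ℕ.+ toℕ k
    i≤ = ℕ.≤-trans (ℕ.<⇒≤ (Fin.toℕ<n i)) (ℕ.m≤m+n N (toℕ k))
    lt : N ℕ.+ toℕ k ℕ.∸ toℕ i ℕ.< N
    lt = ℕ.+-cancelʳ-< (toℕ i) _ _ (subst (ℕ._< N ℕ.+ toℕ i) (sym (ℕ.m∸n+n≡m i≤)) (ℕ.+-monoʳ-< N (ℕ.≰⇒> i≰k)))
    i′ : Fin N
    i′ = Fin.fromℕ< lt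
    eq : toℕ i ℕ.+ toℕ i′ ≡ N ℕ.+ toℕ k
    eq = trans (cong (toℕ i ℕ.+_) (Fin.toℕ-fromℕ< lt)) (ℕ.m+[n∸m]≡n i≤)
    back : ∀ {j} → j ≡ i′ → toℕ i′ ℕ.+ toℕ i ≡ N ℕ.+ toℕ k → ρ (toℕ j) k ≡ i
    back refl e = ρ-wrap (toℕ i′) i k e

  sum-last : ∀ {n} (f : Fin (suc n) → Fin q) → FΣ.sum f ≡ FΣ.sum (λ i → f (inject₁ i)) + f (fromℕ n)
  sum-last {zero} f = trans (FΣ.sum-suc f) (trans (cong (f zero +_) (FΣ.sum-empty _)) (trans (+-comm _ _) (cong (_+ f zero) (sym (FΣ.sum-empty _)))))
  sum-last {suc n} f = trans (FΣ.sum-suc f) (trans (cong (f zero +_) (sum-last (λ i → f (suc i)))) (trans (sym (+-assoc _ _ _)) (cong (_+ f (fromℕ (suc n))) (sym (FΣ.sum-suc (λ i → f (inject₁ i)))))))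

  infixl 7 _⊛_
  _⊛_ : V → V → V
  (a ⊛ b) k = FΣ.sum (λ i → a i * b (ρ (toℕ i) k))

  1ᵛ : V
  1ᵛ zero = 1#
  1ᵛ (suc _) = 0#

  -- Both sides are the coefficient of x^(k-1) in the product of b and c, with the index i shifted
  -- by one. The term i = 0 wraps around to the last position, where `ρ N k ≡ k` is needed.
  rot-⊛ : ∀ (b c : V) k → FΣ.sum (λ i → b (rot i) * c (ρ (toℕ i) k)) ≡ FΣ.sum (λ i → b i * c (ρ (toℕ i) (rot k)))
  rot-⊛ b c k = begin
    FΣ.sum (λ i → b (rot i) * c (ρ (toℕ i) k))
      ≡⟨ FΣ.sum-suc _ ⟩
    b (fromℕ N′) * c k + FΣ.sum (λ i → b (inject₁ i) * c (ρ (suc (toℕ i)) k))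
      ≡⟨ +-comm _ _ ⟩
    FΣ.sum (λ i → b (inject₁ i) * c (ρ (suc (toℕ i)) k)) + b (fromℕ N′) * c k
      ≡⟨ cong₂ _+_ (FΣ.sum-cong (λ i → cong (λ z → b (inject₁ i) * c (ρ z (rot k))) (sym (Fin.toℕ-inject₁ i))))
                   (cong (λ z → b (fromℕ N′) * c z) (sym (trans (cong (λ z → ρ z (rot k)) (Fin.toℕ-fromℕ N′)) (ρ-N k)))) ⟩
    FΣ.sum (λ i → b (inject₁ i) * c (ρ (toℕ (inject₁ i)) (rot k))) + b (fromℕ N′) * c (ρ (toℕ (fromℕ N′)) (rot k))
      ≡⟨ sum-last (λ i → b i * c (ρ (toℕ i) (rot k))) ⟨
    FΣ.sum (λ i → b i * c (ρ (toℕ i) (rot k))) ∎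

  ρ-⊛ : ∀ m (b c : V) k → ((λ i → b (ρ m i)) ⊛ c) k ≡ (b ⊛ c) (ρ m k)
  ρ-⊛ zero b c k = refl
  ρ-⊛ (suc m) b c k = trans (rot-⊛ (λ i → b (ρ m i)) c k) (ρ-⊛ m b c (rot k))

  ⊛-cong : ∀ {a a′ b b′ : V} → (∀ i → a i ≡ a′ i) → (∀ i → b i ≡ b′ i) → ∀ k → (a ⊛ b) k ≡ (a′ ⊛ b′) k
  ⊛-cong a≡ b≡ k = FΣ.sum-cong (λ i → cong₂ _*_ (a≡ i) (b≡ _))

  ⊛-assoc : ∀ a b c k → ((a ⊛ b) ⊛ c) k ≡ (a ⊛ (b ⊛ c)) k
  ⊛-assoc a b c k = begin
    FΣ.sum (λ i → FΣ.sum (λ j → a j * b (ρ (toℕ j) i)) * c (ρ (toℕ i) k))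
      ≡⟨ FΣ.sum-cong (λ i → FΣ.sum-* _ _) ⟩
    FΣ.sum (λ i → FΣ.sum (λ j → a j * b (ρ (toℕ j) i) * c (ρ (toℕ i) k)))
      ≡⟨ FΣ.sum-swap _ ⟩
    FΣ.sum (λ j → FΣ.sum (λ i → a j * b (ρ (toℕ j) i) * c (ρ (toℕ i) k)))
      ≡⟨ FΣ.sum-cong (λ j → trans (FΣ.sum-cong (λ i → *-assoc _ _ _)) (sym (FΣ.*-sum (a j) _))) ⟩
    FΣ.sum (λ j → a j * ((λ i → b (ρ (toℕ j) i)) ⊛ c) k)
      ≡⟨ FΣ.sum-cong (λ j → cong (a j *_) (ρ-⊛ (toℕ j) b c k)) ⟩
    FΣ.sum (λ j → a j * (b ⊛ c) (ρ (toℕ j) k)) ∎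

  ⊛-comm : ∀ a b k → (a ⊛ b) k ≡ (b ⊛ a) k
  ⊛-comm a b k = trans (FΣ.sum-permute _ (permutation π π (ρ-involutive k) (ρ-involutive k)))
    (FΣ.sum-cong (λ i → trans (*-comm _ _) (cong (λ z → b z * a (π i)) (ρ-involutive k i))))
    where
    π : Fin N → Fin N
    π i = ρ (toℕ i) k

  ⊛-identityˡ : ∀ a k → (1ᵛ ⊛ a) k ≡ a k
  ⊛-identityˡ a k = trans (FΣ.sum-single _ zero (λ { zero ne → ⊥-elim (ne refl) ; (suc i) _ → zeroˡ _ })) (*-identityˡ _)

  ⊛-distribˡ : ∀ a b c k → (a ⊛ (λ i → b i + c i)) k ≡ (a ⊛ b) k + (a ⊛ c) k
  ⊛-distribˡ a b c k = trans (FΣ.sum-cong (λ i → distribˡ _ _ _)) (FΣ.sum-+ _ _)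

  algebra : CommutativeRing 0ℓ 0ℓ
  algebra = record
    { Carrier = V ; _≈_ = λ a b → ∀ k → a k ≡ b k
    ; _+_ = λ a b k → a k + b k ; _*_ = _⊛_ ; -_ = λ a k → - a k ; 0# = λ _ → 0# ; 1# = 1ᵛ
    ; isCommutativeRing = record
      { isRing = record
        { +-isAbelianGroup = Pointwise.isAbelianGroup (Fin N) (CommutativeRing.+-isAbelianGroup commutativeRing)
        ; *-cong = ⊛-cong
        ; *-assoc = ⊛-assoc
        ; *-identity = ⊛-identityˡ , (λ a k → trans (⊛-comm a 1ᵛ k) (⊛-identityˡ a k))
        ; distrib = ⊛-distribˡ , (λ a b c k → trans (⊛-comm (λ i → b i + c i) a k) (trans (⊛-distribˡ a b c k) (cong₂ _+_ (⊛-comm a b k) (⊛-comm a c k))))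
        }
      ; *-comm = ⊛-comm
      }
    }

  module A = CommutativeRing algebra
  open Exp A.semiring using (_^_; ^-congˡ)
  open Mult A.semiring using () renaming (_×_ to _·_)

  ⟨_⟩ : Fin q → V
  ⟨ c ⟩ k = c * 1ᵛ k

  ⟨⟩-* : ∀ c b k → (⟨ c ⟩ ⊛ b) k ≡ c * b k
  ⟨⟩-* c b k = trans (FΣ.sum-cong (λ i → *-assoc _ _ _)) (trans (sym (FΣ.*-sum c _)) (cong (c *_) (⊛-identityˡ b k)))

  ⟨⟩-+ : ∀ c d → ⟨ c + d ⟩ A.≈ ⟨ c ⟩ A.+ ⟨ d ⟩
  ⟨⟩-+ c d k = distribʳ _ _ _

  ⟨⟩-homo-* : ∀ c d → ⟨ c * d ⟩ A.≈ ⟨ c ⟩ ⊛ ⟨ d ⟩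
  ⟨⟩-homo-* c d k = trans (*-assoc _ _ _) (sym (⟨⟩-* c ⟨ d ⟩ k))

  ⟨1⟩ : ⟨ 1# ⟩ A.≈ 1ᵛ
  ⟨1⟩ k = *-identityˡ _

  ⟨⟩-pow : ∀ c m → ⟨ pow c m ⟩ A.≈ ⟨ c ⟩ ^ m
  ⟨⟩-pow c zero = ⟨1⟩
  ⟨⟩-pow c (suc m) = A.trans (⟨⟩-homo-* c (pow c m)) (⊛-cong {⟨ c ⟩} {⟨ c ⟩} (λ _ → refl) (⟨⟩-pow c m))

  ⟨nat⟩ : ∀ m → ⟨ nat m ⟩ A.≈ m · A.1#
  ⟨nat⟩ zero k = zeroˡ _
  ⟨nat⟩ (suc m) k = trans (⟨⟩-+ 1# (nat m) k) (cong₂ _+_ (⟨1⟩ k) (⟨nat⟩ m k))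

  x : V
  x k = 1ᵛ (rot k)

  x-* : ∀ b k → (x ⊛ b) k ≡ b (rot k)
  x-* b k = trans (rot-⊛ 1ᵛ b k) (⊛-identityˡ b (rot k))

  x^-* : ∀ m b k → ((x ^ m) ⊛ b) k ≡ b (ρ m k)
  x^-* zero b k = ⊛-identityˡ b k
  x^-* (suc m) b k = trans (⊛-assoc x (x ^ m) b k) (trans (x-* ((x ^ m) ⊛ b) k) (x^-* m b (rot k)))

  x^N : x ^ N A.≈ A.1#
  x^N k = trans (sym (A.*-identityʳ (x ^ N) k)) (trans (x^-* N 1ᵛ k) (cong 1ᵛ (ρ-N k)))

  -- Leads d a: the coefficient of xᵈ in a is 1 and those of higher powers (below xᴺ) vanish.
  Leads : ℕ → V → Set
  Leads d a = ∀ k → (d ℕ.< toℕ k → a k ≡ 0#) × (toℕ k ≡ d → a k ≡ 1#)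

  -- The coefficient that wraps around lands at position 0, about which `Leads (suc d)` claims
  -- nothing; the bound d < N enters only in `leads⇒≉0`.
  leads-rot : ∀ {d a} → Leads d a → Leads (suc d) (λ k → a (rot k))
  leads-rot h zero = (λ ()) , (λ ())
  leads-rot {d} h (suc k) = (λ { (ℕ.s≤s lt) → proj₁ (h (inject₁ k)) (subst (d ℕ.<_) (sym (Fin.toℕ-inject₁ k)) lt) })
                          , (λ e → proj₂ (h (inject₁ k)) (trans (Fin.toℕ-inject₁ k) (ℕ.suc-injective e)))

  leads-ρ : ∀ m {d a} → Leads d a → Leads (m ℕ.+ d) (λ k → a (ρ m k))
  leads-ρ zero h = h
  leads-ρ (suc m) {d} {a} h = leads-rot {m ℕ.+ d} {λ k → a (ρ m k)} (leads-ρ m h)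

  leads-* : ∀ {m d a} → 2 ℕ.≤ m → Leads d a → Leads (m ℕ.+ d) ((x ^ m A.- x) ⊛ a)
  leads-* {m} {d} {a} 2≤m h k =
    (λ lt → trans (value k) (trans (cong₂ (λ u v → u + - v) (proj₁ (leads-ρ m h k) lt) (proj₁ (leads-rot {d} {a} h k) (ℕ.<-trans sd<md lt))) (-‿inverseʳ 0#))) ,
    (λ e → trans (value k) (trans (cong₂ (λ u v → u + - v) (proj₂ (leads-ρ m h k) e) (proj₁ (leads-rot {d} {a} h k) (subst (suc d ℕ.<_) (sym e) sd<md)))
       (trans (cong (1# +_) -0#≡0#) (+-identityʳ 1#))))
    where
    sd<md : suc d ℕ.< m ℕ.+ d
    sd<md = ℕ.+-monoˡ-< d 2≤m
    value : ∀ k → ((x ^ m A.- x) ⊛ a) k ≡ a (ρ m k) - a (rot k)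
    value k = trans (A.distribʳ a (x ^ m) (A.- x) k) (cong₂ _+_ (x^-* m a k) (trans (neg k) (cong -_ (x-* a k))))
      where
      open import Algebra.Properties.Ring A.ring using (-‿distribˡ-*)
      neg : ∀ k → ((A.- x) ⊛ a) k ≡ - ((x ⊛ a) k)
      neg k = sym (-‿distribˡ-* x a k)

  leads⇒≉0 : ∀ {d a} → Leads d a → d ℕ.< N → ¬ a A.≈ A.0#
  leads⇒≉0 {d} {a} h d<N a≈0 = 1≢0 (trans (sym (proj₂ (h (Fin.fromℕ< d<N)) (Fin.toℕ-fromℕ< d<N))) (a≈0 _))

  module FrobeniusFixed {p l n : ℕ} (pp : Prime p) (q≡ : q ≡ p ℕ.^ l) (N≡ : suc N ≡ q ℕ.^ n) where
    open Frobenius algebra pp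
    private
      Q = q ℕ.^ n
      Q≡ : Q ≡ p ℕ.^ (l ℕ.* n)
      Q≡ = trans (cong (ℕ._^ n) q≡) (ℕ.^-*-assoc p l n)

    Fixed : V → Set
    Fixed a = a ^ Q A.≈ a

    fixed-cong : ∀ {a b} → a A.≈ b → Fixed a → Fixed b
    fixed-cong a≈b fa = A.trans (^-congˡ Q (A.sym a≈b)) (A.trans fa a≈b)

    fixed-+ : ∀ {a b} → Fixed a → Fixed b → Fixed (a A.+ b)
    fixed-+ {a} {b} fa fb = A.trans (A.reflexive (cong ((a A.+ b) ^_) Q≡)) (A.trans (frobenius^ char (l ℕ.* n) a b)
       (A.trans (A.reflexive (cong₂ A._+_ (cong (a ^_) (sym Q≡)) (cong (b ^_) (sym Q≡)))) (A.+-cong fa fb)))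
      where
      char : p · A.1# A.≈ A.0#
      char = A.trans (A.sym (⟨nat⟩ p)) (λ k → trans (cong (_* 1ᵛ k) (Characteristic.nat-p {p} {l} pp q≡)) (zeroˡ _))

    fixed-* : ∀ {a b} → Fixed a → Fixed b → Fixed (a ⊛ b)
    fixed-* {a} {b} fa fb = A.trans (CommExp.^-distrib-* A.commutativeSemiring a b Q) (A.*-cong {a ^ Q} {a} {b ^ Q} {b} fa fb)

    fixed-0 : Fixed A.0#
    fixed-0 = subst (λ m → A.0# ^ m A.≈ A.0#) N≡ (A.zeroˡ (A.0# ^ N))

    fixed-scalar : ∀ c → Fixed ⟨ c ⟩
    fixed-scalar c = A.trans (A.sym (⟨⟩-pow c Q)) (λ k → cong (_* 1ᵛ k) (pow-qⁿ n))
      where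
      pow-qⁿ : ∀ n → pow c (q ℕ.^ n) ≡ c
      pow-qⁿ zero = *-identityʳ c
      pow-qⁿ (suc n) = trans (sym (pow-pow c q (q ℕ.^ n))) (trans (cong (λ z → pow z (q ℕ.^ n)) (pow-q c)) (pow-qⁿ n))

    fixed-x : Fixed x
    fixed-x = subst (λ m → x ^ m A.≈ x) N≡ (A.trans (A.*-cong {x} {x} {x ^ N} {A.1#} A.refl x^N) (A.*-identityʳ x))

    fixed-1 : Fixed A.1#
    fixed-1 = fixed-cong ⟨1⟩ (fixed-scalar 1#)

    fixed-x^ : ∀ m → Fixed (x ^ m)
    fixed-x^ zero = fixed-1
    fixed-x^ (suc m) = fixed-* fixed-x (fixed-x^ m)

    fixed-sum : ∀ {m} (v : Fin m → V) → (∀ i → Fixed (v i)) → Fixed (λ k → FΣ.sum (λ i → v i k))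
    fixed-sum {zero} v h = fixed-cong (λ k → sym (FΣ.sum-empty _)) fixed-0
    fixed-sum {suc m} v h = fixed-cong (λ k → sym (FΣ.sum-suc _)) (fixed-+ (h zero) (fixed-sum (λ i → v (suc i)) (λ i → h (suc i))))

    -- Raising to the power Q is additive in characteristic p and multiplicative, and it fixes the
    -- constants and x, because x^Q = x x^N = x. The choice N = Q - 1 is made for this.
    fixed : ∀ a → Fixed a
    fixed a = fixed-cong (A.*-identityʳ a) (fixed-sum (λ i k → a i * 1ᵛ (ρ (toℕ i) k)) (λ i →
      fixed-cong (λ k → trans (⟨⟩-* (a i) (x ^ toℕ i) k) (cong (a i *_) (trans (sym (A.*-identityʳ (x ^ toℕ i) k)) (x^-* (toℕ i) 1ᵛ k))))
        (fixed-* (fixed-scalar (a i)) (fixed-x^ (toℕ i)))))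

-- A finite commutative ring in which aᵠ = a always holds: each u a = aᵠ⁻¹ is idempotent and generates the same ideal
-- as a, so multiplying ε by u a whenever the product is nonzero, for all a in turn, makes ε primitive.
module PrimitiveIdempotent (R : CommutativeRing 0ℓ 0ℓ) (_≈?_ : ∀ a b → Dec (CommutativeRing._≈_ R a b)) (Q″ : ℕ)
         (fixed : ∀ a → CommutativeRing._≈_ R (Exp._^_ (CommutativeRing.semiring R) a (suc (suc Q″))) a) where
  open CommutativeRing R hiding (zero) renaming (refl to ≈-refl; sym to ≈-sym; trans to ≈-trans)
  open Exp semiring using (_^_; ^-congˡ)
  open IntegerCoefficients R using (solve; _:=_; _:*_)
  open SetoidReasoning setoid

  u : Carrier → Carrier
  u a = a ^ suc Q″

  u-idem : ∀ a → u a * u a ≈ u a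
  u-idem a = begin
    (a * a ^ Q″) * (a * a ^ Q″)   ≈⟨ solve 2 (λ a b → (a :* b) :* (a :* b) := b :* (a :* (a :* b))) ≈-refl a (a ^ Q″) ⟩
    a ^ Q″ * (a * (a * a ^ Q″))   ≈⟨ *-congˡ (fixed a) ⟩
    a ^ Q″ * a                    ≈⟨ *-comm _ _ ⟩
    a * a ^ Q″                    ∎

  -- `decide` expresses primitivity through a list of elements: modulo ε each is zero or invertible,
  -- with inverse a^(Q-2). Both alternatives pass to smaller idempotents, so `below` keeps earlier
  -- decisions valid.
  record Idem (ε₀ : Carrier) {m} (en : Fin m → Carrier) : Set where
    field
      ε      : Carrier
      idem   : ε * ε ≈ ε
      ε≉0    : ¬ ε ≈ 0#
      below  : ε * ε₀ ≈ ε
      decide : ∀ i → (ε * en i ≈ 0#) ⊎ (ε * u (en i) ≈ ε)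

  refine : ∀ {m} (en : Fin m → Carrier) ε₀ → ε₀ * ε₀ ≈ ε₀ → ¬ ε₀ ≈ 0# → Idem ε₀ en
  refine {zero} en ε₀ id₀ ne₀ = record { ε = ε₀ ; idem = id₀ ; ε≉0 = ne₀ ; below = id₀ ; decide = λ () }
  refine {suc m} en ε₀ id₀ ne₀ with (ε₀ * u (en zero)) ≈? 0#
  ... | yes ε₀u≈0 = record { ε = ε ; idem = idem ; ε≉0 = ε≉0 ; below = below
                           ; decide = λ { zero → inj₁ vanish ; (suc i) → decide i } }
    where
    open Idem (refine (λ i → en (suc i)) ε₀ id₀ ne₀)
    a = en zero
    vanish : ε * a ≈ 0#
    vanish = begin
      ε * a                  ≈⟨ *-cong below (fixed a) ⟨
      (ε * ε₀) * (a * u a)   ≈⟨ solve 4 (λ e f a u → (e :* f) :* (a :* u) := e :* a :* (f :* u)) ≈-refl ε ε₀ a (u a) ⟩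
      (ε * a) * (ε₀ * u a)   ≈⟨ *-congˡ ε₀u≈0 ⟩
      (ε * a) * 0#           ≈⟨ zeroʳ _ ⟩
      0#                     ∎
  ... | no ε₀u≉0 = record { ε = ε ; idem = idem ; ε≉0 = ε≉0 ; below = below₀
                          ; decide = λ { zero → inj₂ absorb ; (suc i) → decide i } }
    where
    a = en zero
    open Idem (refine (λ i → en (suc i)) (ε₀ * u a)
      (≈-trans (solve 2 (λ e u → (e :* u) :* (e :* u) := (e :* e) :* (u :* u)) ≈-refl ε₀ (u a)) (*-cong id₀ (u-idem a))) ε₀u≉0)
    absorb : ε * u a ≈ ε
    absorb = begin
      ε * u a                  ≈⟨ *-congʳ below ⟨
      ε * (ε₀ * u a) * u a     ≈⟨ solve 3 (λ e f u → e :* (f :* u) :* u := e :* (f :* (u :* u))) ≈-refl ε ε₀ (u a) ⟩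
      ε * (ε₀ * (u a * u a))   ≈⟨ *-congˡ (*-congˡ (u-idem a)) ⟩
      ε * (ε₀ * u a)           ≈⟨ below ⟩
      ε                        ∎
    below₀ : ε * ε₀ ≈ ε
    below₀ = begin
      ε * ε₀                   ≈⟨ *-congʳ below ⟨
      ε * (ε₀ * u a) * ε₀      ≈⟨ solve 3 (λ e f u → e :* (f :* u) :* f := e :* ((f :* f) :* u)) ≈-refl ε ε₀ (u a) ⟩
      ε * ((ε₀ * ε₀) * u a)    ≈⟨ *-congˡ (*-congʳ id₀) ⟩
      ε * (ε₀ * u a)           ≈⟨ below ⟩
      ε                        ∎

  -- Starting from `u w` keeps w nonzero modulo the final ε, since w divides `u w` and ε lies below
  -- it. Here `u w` is nonzero because w is w times `u w`.
  idempotentFor : ∀ {m} (en : Fin m → Carrier) w → ¬ w ≈ 0# → Idem (u w) en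
  idempotentFor en w w≉0 = refine en (u w) (u-idem w) (λ e → w≉0 (≈-trans (≈-sym (fixed w)) (≈-trans (*-congˡ e) (zeroʳ w))))

  module Residue (w : Carrier) {m : ℕ} (en : Fin m → Carrier) (surj : ∀ a → ∃ λ i → en i ≈ a) (idempotent : Idem (u w) en) where
    open Idem idempotent public

    εw≉0 : ¬ ε * w ≈ 0#
    εw≉0 e = ε≉0 (begin
      ε                  ≈⟨ below ⟨
      ε * (w * w ^ Q″)   ≈⟨ *-assoc _ _ _ ⟨
      (ε * w) * w ^ Q″   ≈⟨ *-congʳ e ⟩
      0# * w ^ Q″        ≈⟨ zeroˡ _ ⟩
      0#                 ∎)

    infix 4 _~_
    -- The residue ring R/(1 - ε), isomorphic to ε R, is kept on the same carrier with a coarser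
    -- equality.
    _~_ : Carrier → Carrier → Set
    a ~ b = ε * a ≈ ε * b

    ≈⇒~ : ∀ {a b} → a ≈ b → a ~ b
    ≈⇒~ = *-congˡ

    inverse : ∀ a → ¬ a ~ 0# → ∃ λ y → a * y ~ 1#
    inverse a a≁0 with surj a
    ... | i , ei≈a with decide i
    ... | inj₁ z = ⊥-elim (a≁0 (≈-trans (*-congˡ (≈-sym ei≈a)) (≈-trans z (≈-sym (zeroʳ ε)))))
    ... | inj₂ z = a ^ Q″ , ≈-trans (*-congˡ (^-congˡ (suc Q″) (≈-sym ei≈a))) (≈-trans z (≈-sym (*-identityʳ ε)))

    residueRing : CommutativeRing 0ℓ 0ℓ
    residueRing = record
      { Carrier = Carrier ; _≈_ = _~_ ; _+_ = _+_ ; _*_ = _*_ ; -_ = -_ ; 0# = 0# ; 1# = 1#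
      ; isCommutativeRing = record
        { isRing = record
          { +-isAbelianGroup = record
            { isGroup = record
              { isMonoid = record
                { isSemigroup = record
                  { isMagma = record
                    { isEquivalence = record { refl = ≈-refl ; sym = ≈-sym ; trans = ≈-trans }
                    ; ∙-cong = λ {a} {b} {c} {d} a~b c~d → ≈-trans (distribˡ ε a c) (≈-trans (+-cong a~b c~d) (≈-sym (distribˡ ε b d))) }
                  ; assoc = λ a b c → ≈⇒~ (+-assoc a b c) }
                ; identity = (λ a → ≈⇒~ (+-identityˡ a)) , (λ a → ≈⇒~ (+-identityʳ a)) }
              ; inverse = (λ a → ≈⇒~ (-‿inverseˡ a)) , (λ a → ≈⇒~ (-‿inverseʳ a))
              ; ⁻¹-cong = λ {a} {b} a~b → ≈-trans (≈-sym (-‿distribʳ-* ε a)) (≈-trans (-‿cong a~b) (-‿distribʳ-* ε b)) }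
            ; comm = λ a b → ≈⇒~ (+-comm a b) }
          ; *-cong = λ {a} {b} {c} {d} a~b c~d → ≈-trans (spread a c) (≈-trans (*-cong a~b c~d) (≈-sym (spread b d)))
          ; *-assoc = λ a b c → ≈⇒~ (*-assoc a b c)
          ; *-identity = (λ a → ≈⇒~ (*-identityˡ a)) , (λ a → ≈⇒~ (*-identityʳ a))
          ; distrib = (λ a b c → ≈⇒~ (distribˡ a b c)) , (λ a b c → ≈⇒~ (distribʳ a b c)) }
        ; *-comm = λ a b → ≈⇒~ (*-comm a b) } }
      where
      open RingProperties ring using (-‿distribʳ-*)
      spread : ∀ a b → ε * (a * b) ≈ (ε * a) * (ε * b)
      spread a b = ≈-trans (*-congʳ (≈-sym idem)) (solve 3 (λ e a b → e :* e :* (a :* b) := (e :* a) :* (e :* b)) ≈-refl ε a b)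

    residueField : Field 0ℓ 0ℓ
    residueField = record
      { commutativeRing = residueRing
      ; 1≉0 = λ e → ε≉0 (≈-trans (≈-sym (*-identityʳ ε)) (≈-trans e (zeroʳ ε)))
      ; inverse = inverse }

-- Bases over the ground field and the regular representation

module VectorSpace {q : ℕ} (G : FiniteField q) (K : Field 0ℓ 0ℓ) (_≈?_ : ∀ a b → Dec (Field._≈_ K a b))
  (s : Fin q → Field.Carrier K)
  (s-+ : ∀ a b → Field._≈_ K (s (FiniteField._+_ G a b)) (Field._+_ K (s a) (s b)))
  (s-* : ∀ a b → Field._≈_ K (s (FiniteField._*_ G a b)) (Field._*_ K (s a) (s b)))
  (s-1 : Field._≈_ K (s (FiniteField.1# G)) (Field.1# K)) where
  private
    module F = Arithmetic G
    module KO = FieldOps K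
  open Field K hiding (zero) renaming (refl to ≈-refl; sym to ≈-sym; trans to ≈-trans)
  open IntegerCoefficients commutativeRing using (solve; _:=_; _:+_; _:*_; _:-_; :-_)
  open RingProperties ring using (+-cancelʳ)
  open SetoidReasoning setoid

  s-0 : s F.0# ≈ 0#
  s-0 = +-cancelʳ (s F.0#) (s F.0#) 0# (≈-trans (≈-sym (s-+ F.0# F.0#)) (≈-trans (reflexive (cong s (F.+-identityˡ F.0#))) (≈-sym (+-identityˡ _))))

  s-neg : ∀ a → s (F.- a) ≈ - s a
  s-neg a = +-cancelʳ (s a) _ _ (≈-trans (≈-sym (s-+ (F.- a) a)) (≈-trans (reflexive (cong s (F.-‿inverseˡ a))) (≈-trans s-0 (≈-sym (-‿inverseˡ _)))))

  lin : ∀ {e} → (Fin e → Carrier) → (Fin e → Fin q) → Carrier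
  lin {zero} b c = 0#
  lin {suc e} b c = s (c zero) * b zero + lin (λ i → b (suc i)) (λ i → c (suc i))

  lin-cong : ∀ {e} {b b′ : Fin e → Carrier} {c c′} → (∀ i → b i ≈ b′ i) → (∀ i → c i ≡ c′ i) → lin b c ≈ lin b′ c′
  lin-cong {zero} b≈ c≡ = ≈-refl
  lin-cong {suc e} b≈ c≡ = +-cong (*-cong (reflexive (cong s (c≡ zero))) (b≈ zero)) (lin-cong (λ i → b≈ (suc i)) (λ i → c≡ (suc i)))

  lin-+ : ∀ {e} (b : Fin e → Carrier) c d → lin b (λ i → c i F.+ d i) ≈ lin b c + lin b d
  lin-+ {zero} b c d = ≈-sym (+-identityˡ 0#)
  lin-+ {suc e} b c d = ≈-trans (+-cong (*-congʳ (s-+ _ _)) (lin-+ (λ i → b (suc i)) (λ i → c (suc i)) (λ i → d (suc i))))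
    (solve 5 (λ x y b l m → (x :+ y) :* b :+ (l :+ m) := (x :* b :+ l) :+ (y :* b :+ m)) ≈-refl (s (c zero)) (s (d zero)) (b zero) (lin (λ i → b (suc i)) (λ i → c (suc i))) (lin (λ i → b (suc i)) (λ i → d (suc i))))

  lin-* : ∀ {e} (b : Fin e → Carrier) a c → lin b (λ i → a F.* c i) ≈ s a * lin b c
  lin-* {zero} b a c = ≈-sym (zeroʳ _)
  lin-* {suc e} b a c = ≈-trans (+-cong (*-congʳ (s-* _ _)) (lin-* (λ i → b (suc i)) a (λ i → c (suc i))))
    (solve 4 (λ a x b l → (a :* x) :* b :+ a :* l := a :* (x :* b :+ l)) ≈-refl (s a) (s (c zero)) (b zero) (lin (λ i → b (suc i)) (λ i → c (suc i))))

  lin-scaled : ∀ {e} (b : Fin e → Carrier) a c → lin (λ i → a * b i) c ≈ a * lin b c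
  lin-scaled {zero} b a c = ≈-sym (zeroʳ _)
  lin-scaled {suc e} b a c = ≈-trans (+-congˡ (lin-scaled (λ i → b (suc i)) a (λ i → c (suc i))))
    (solve 4 (λ a x b l → x :* (a :* b) :+ a :* l := a :* (x :* b :+ l)) ≈-refl a (s (c zero)) (b zero) (lin (λ i → b (suc i)) (λ i → c (suc i))))

  lin-zero : ∀ {e} (b : Fin e → Carrier) → lin b (λ _ → F.0#) ≈ 0#
  lin-zero {zero} b = ≈-refl
  lin-zero {suc e} b = ≈-trans (+-cong (≈-trans (*-congʳ s-0) (zeroˡ _)) (lin-zero (λ i → b (suc i)))) (+-identityˡ 0#)

  lin-neg : ∀ {e} (b : Fin e → Carrier) c → lin b (λ i → F.- c i) ≈ - lin b c
  lin-neg b c = +-cancelʳ (lin b c) _ _ (≈-trans (≈-sym (lin-+ b (λ i → F.- c i) c))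
    (≈-trans (lin-cong (λ _ → ≈-refl) (λ i → F.-‿inverseˡ (c i))) (≈-trans (lin-zero b) (≈-sym (-‿inverseˡ _)))))

  lin-∑ : ∀ {e m} (b : Fin e → Carrier) (A : Fin e → Fin m → Fin q) (c : Fin m → Fin q) →
          lin b (λ i → F.∑ (λ j → A i j F.* c j)) ≈ lin (λ j → lin b (λ i → A i j)) c
  lin-∑ {m = zero} b A c = lin-zero b
  lin-∑ {m = suc m} b A c = ≈-trans (lin-+ b _ _) (+-cong
    (≈-trans (lin-cong (λ _ → ≈-refl) (λ i → F.*-comm (A i zero) (c zero))) (lin-* b (c zero) (λ i → A i zero)))
    (lin-∑ b (λ i j → A i (suc j)) (λ j → c (suc j))))

  lin-I : ∀ {e} (b : Fin e → Carrier) j → lin b (λ i → F.I i j) ≈ b j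
  lin-I b j = lin-δ b j (λ i → F.I i j) (F.I-diag j) (λ i → F.I-off)
    where
    lin-δ : ∀ {e} (b : Fin e → Carrier) j c → c j ≡ F.1# → (∀ i → i ≢ j → c i ≡ F.0#) → lin b c ≈ b j
    lin-δ b zero c cj off = ≈-trans (+-cong (≈-trans (*-congʳ (≈-trans (reflexive (cong s cj)) s-1)) (*-identityˡ _))
      (≈-trans (lin-cong (λ _ → ≈-refl) (λ i → off (suc i) (λ ()))) (lin-zero (λ i → b (suc i))))) (+-identityʳ _)
    lin-δ b (suc j) c cj off = ≈-trans (+-cong (≈-trans (*-congʳ (≈-trans (reflexive (cong s (off zero (λ ())))) s-0)) (zeroˡ _))
      (lin-δ (λ i → b (suc i)) j (λ i → c (suc i)) cj (λ i ne → off (suc i) (λ e → ne (Fin.suc-injective e))))) (+-identityˡ _)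

  -- Uniqueness of coordinates is the form of independence that yields directly the size q^e and the
  -- equality of matrices.
  Independent : ∀ {e} → (Fin e → Carrier) → Set
  Independent b = ∀ c d → lin b c ≈ lin b d → ∀ i → c i ≡ d i

  Spans : ∀ {e} → (Fin e → Carrier) → Carrier → Set
  Spans b v = ∃ λ c → lin b c ≈ v

  -- The coefficient vectors are finitely many, encoded by `Fin (q ^ e)`, so membership in the span
  -- is decided by search.
  spans? : ∀ {e} (b : Fin e → Carrier) v → Dec (Spans b v)
  spans? b v = map′ (λ { (c , eq) → finToFun c , eq })
    (λ { (c , eq) → funToFin c , ≈-trans (lin-cong (λ _ → ≈-refl) (Fin.finToFun-funToFin c)) eq })
    (Fin.any? (λ c → lin b (finToFun c) ≈? v))

  cons : ∀ {e} → Carrier → (Fin e → Carrier) → Fin (suc e) → Carrier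
  cons v b zero = v
  cons v b (suc i) = b i

  independent-cons : ∀ {e} {b : Fin e → Carrier} {v} → Independent b → ¬ Spans b v → Independent (cons v b)
  independent-cons {e} {b} {v} ind ¬sp c d eq = λ { zero → c₀≡d₀ ; (suc i) → ind c₊ d₊ rest i }
    where
    c₀ = c zero
    d₀ = d zero
    c₊ d₊ : Fin e → Fin q
    c₊ i = c (suc i)
    d₊ i = d (suc i)
    c₀≡d₀ : c₀ ≡ d₀
    c₀≡d₀ with c₀ Fin.≟ d₀
    ... | yes e = e
    ... | no ne = ⊥-elim (¬sp ((λ i → a F.* (d₊ i F.+ F.- c₊ i)) , (begin
        lin b (λ i → a F.* (d₊ i F.+ F.- c₊ i))       ≈⟨ lin-* b a _ ⟩
        s a * lin b (λ i → d₊ i F.+ F.- c₊ i)          ≈⟨ *-congˡ (≈-trans (lin-+ b _ _) (+-congˡ (lin-neg b c₊))) ⟩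
        s a * (lin b d₊ - lin b c₊)                    ≈⟨ *-congˡ (solve 5 (λ l m x y v → l :- m := (y :* v :+ l) :- (x :* v :+ m) :+ (x :- y) :* v) ≈-refl (lin b d₊) (lin b c₊) (s c₀) (s d₀) v) ⟩
        s a * ((s d₀ * v + lin b d₊) - (s c₀ * v + lin b c₊) + (s c₀ - s d₀) * v)
                                                       ≈⟨ *-congˡ (+-congʳ (≈-trans (+-congʳ (≈-sym eq)) (-‿inverseʳ _))) ⟩
        s a * (0# + (s c₀ - s d₀) * v)                 ≈⟨ *-congˡ (+-identityˡ _) ⟩
        s a * ((s c₀ - s d₀) * v)                      ≈⟨ *-assoc _ _ _ ⟨
        s a * (s c₀ - s d₀) * v                        ≈⟨ *-congʳ (*-congˡ (≈-trans (s-+ _ _) (+-congˡ (s-neg d₀)))) ⟨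
        s a * s (c₀ F.- d₀) * v                        ≈⟨ *-congʳ (≈-trans (≈-sym (s-* _ _)) (≈-trans (reflexive (cong s (F.inv-l c₀-d₀≢0))) s-1)) ⟩
        1# * v                                         ≈⟨ *-identityˡ v ⟩
        v                                              ∎)))
      where
      c₀-d₀≢0 : c₀ F.- d₀ ≢ F.0#
      c₀-d₀≢0 e = ne (F.x-y≡0⇒x≡y e)
      a = F.inv (c₀ F.- d₀)
    rest : lin b c₊ ≈ lin b d₊
    rest = begin
      lin b c₊                                   ≈⟨ solve 2 (λ x l → l := (x :+ l) :- x) ≈-refl (s c₀ * v) (lin b c₊) ⟩
      (s c₀ * v + lin b c₊) - s c₀ * v           ≈⟨ +-cong eq (-‿cong (*-congʳ (reflexive (cong s c₀≡d₀)))) ⟩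
      (s d₀ * v + lin b d₊) - s d₀ * v           ≈⟨ solve 2 (λ x l → (x :+ l) :- x := l) ≈-refl (s d₀ * v) (lin b d₊) ⟩
      lin b d₊                                   ∎

  basis-of : ∀ {m} (en : Fin m → Carrier) → ∃ λ e → Σ (Fin e → Carrier) λ b → Independent b × (∀ i → Spans b (en i))
  basis-of {zero} en = 0 , (λ ()) , (λ _ _ _ ()) , (λ ())
  basis-of {suc m} en with basis-of (λ i → en (suc i))
  ... | e , b , ind , sp with spans? b (en zero)
  ... | yes sp₀ = e , b , ind , (λ { zero → sp₀ ; (suc i) → sp i })
  ... | no ¬sp₀ = suc e , cons (en zero) b , independent-cons ind ¬sp₀ , (λ { zero → first ; (suc i) → later i })
    where
    pad : Fin q → (Fin e → Fin q) → Fin (suc e) → Fin q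
    pad a c zero = a
    pad a c (suc i) = c i
    first : Spans (cons (en zero) b) (en zero)
    first = pad F.1# (λ _ → F.0#) , ≈-trans (+-cong (≈-trans (*-congʳ s-1) (*-identityˡ _)) (lin-zero b)) (+-identityʳ _)
    later : ∀ i → Spans (cons (en zero) b) (en (suc i))
    later i with sp i
    ... | c , eq = pad F.0# c , ≈-trans (+-congʳ (≈-trans (*-congʳ s-0) (zeroˡ _))) (≈-trans (+-identityˡ _) eq)

  module Basis {e : ℕ} (b : Fin e → Carrier) (ind : Independent b) (span : ∀ v → Spans b v) where
    size : KO.HasSize (q ℕ.^ e)
    size = (λ i → lin b (finToFun i)) ,
      (λ i j eq → trans (sym (Fin.funToFin-finToFin {e} i)) (trans (funToFin-cong (ind _ _ eq)) (Fin.funToFin-finToFin {e} j))) ,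
      (λ v → funToFin (proj₁ (span v)) , ≈-trans (lin-cong (λ _ → ≈-refl) (Fin.finToFun-funToFin (proj₁ (span v)))) (proj₂ (span v)))
      where
      funToFin-cong : ∀ {m} {f g : Fin m → Fin q} → (∀ i → f i ≡ g i) → funToFin f ≡ funToFin g
      funToFin-cong {zero} h = refl
      funToFin-cong {suc m} h = cong₂ Fin.combine (h zero) (funToFin-cong (λ i → h (suc i)))

    -- The regular representation: column j holds the coordinates of a times the j-th basis vector,
    -- so the powers of this matrix act as the powers of a.
    rep : Carrier → F.Mat e
    rep a i j = proj₁ (span (a * b j)) i

    rep-pow : ∀ a k j → lin b (λ i → F.mpow (rep a) k i j) ≈ KO.pow a k * b j
    rep-pow a zero j = ≈-trans (lin-I b j) (≈-sym (*-identityˡ _))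
    rep-pow a (suc k) j = begin
      lin b (λ i → F.∑ (λ m → rep a i m F.* F.mpow (rep a) k m j))  ≈⟨ lin-∑ b (rep a) (λ m → F.mpow (rep a) k m j) ⟩
      lin (λ m → lin b (λ i → rep a i m)) (λ m → F.mpow (rep a) k m j)  ≈⟨ lin-cong (λ m → proj₂ (span (a * b m))) (λ _ → refl) ⟩
      lin (λ m → a * b m) (λ m → F.mpow (rep a) k m j)              ≈⟨ lin-scaled b a _ ⟩
      a * lin b (λ m → F.mpow (rep a) k m j)                        ≈⟨ *-congˡ (rep-pow a k j) ⟩
      a * (KO.pow a k * b j)                                        ≈⟨ *-assoc _ _ _ ⟨
      KO.pow a (suc k) * b j                                        ∎

    rep-sum : ∀ x y k c → KO.pow x k + KO.pow y k ≈ s c →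
              ∀ i j → F.mpow (rep x) k i j F.+ F.mpow (rep y) k i j ≡ c F.* F.I i j
    rep-sum x y k c eq i j = ind _ _ (begin
      lin b (λ i → F.mpow (rep x) k i j F.+ F.mpow (rep y) k i j)  ≈⟨ lin-+ b _ _ ⟩
      lin b (λ i → F.mpow (rep x) k i j) + lin b (λ i → F.mpow (rep y) k i j)  ≈⟨ +-cong (rep-pow x k j) (rep-pow y k j) ⟩
      KO.pow x k * b j + KO.pow y k * b j                          ≈⟨ distribʳ _ _ _ ⟨
      (KO.pow x k + KO.pow y k) * b j                              ≈⟨ *-congʳ eq ⟩
      s c * b j                                                    ≈⟨ *-congˡ (lin-I b j) ⟨
      s c * lin b (λ i → F.I i j)                                  ≈⟨ lin-* b c _ ⟨
      lin b (λ i → c F.* F.I i j)                                  ∎) i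

2≤size : ∀ {r} → FiniteField r → 2 ℕ.≤ r
2≤size {zero} H with FiniteField.0# H
... | ()
2≤size {suc zero} H = ⊥-elim (FiniteField.1≢0 H (fin1 _ _))
  where
  fin1 : ∀ (i j : Fin 1) → i ≡ j
  fin1 zero zero = refl
2≤size {suc (suc r)} H = ℕ.s≤s (ℕ.s≤s ℕ.z≤n)

-- If x^(q^e) - x is invertible modulo a primitive idempotent for all 1 ≤ e < n, the residue field has degree n.
module ResidueDegree {q : ℕ} (G : FiniteField q) (n′ : ℕ) (R : CommutativeRing 0ℓ 0ℓ)
  (_≈?_ : ∀ a b → Dec (CommutativeRing._≈_ R a b)) (Q″ : ℕ) (Q≡ : suc (suc Q″) ≡ q ℕ.^ suc n′)
  (fixed : ∀ a → CommutativeRing._≈_ R (Exp._^_ (CommutativeRing.semiring R) a (suc (suc Q″))) a)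
  {M : ℕ} (en : Fin M → CommutativeRing.Carrier R) (en-surj : ∀ a → ∃ λ i → CommutativeRing._≈_ R (en i) a)
  (⟨_⟩ : Fin q → CommutativeRing.Carrier R)
  (⟨⟩-+ : ∀ a b → CommutativeRing._≈_ R ⟨ FiniteField._+_ G a b ⟩ (CommutativeRing._+_ R ⟨ a ⟩ ⟨ b ⟩))
  (⟨⟩-* : ∀ a b → CommutativeRing._≈_ R ⟨ FiniteField._*_ G a b ⟩ (CommutativeRing._*_ R ⟨ a ⟩ ⟨ b ⟩))
  (⟨1⟩ : CommutativeRing._≈_ R ⟨ FiniteField.1# G ⟩ (CommutativeRing.1# R))
  (x : CommutativeRing.Carrier R) where
  private
    n = suc n′
    module F = Arithmetic G
    module A = CommutativeRing R
  open Exp A.semiring using (_^_)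
  open PrimitiveIdempotent R _≈?_ Q″ fixed using (Idem; u; idempotentFor; module Residue)

  -- W m is the product of x^(q^e) - x over 1 ≤ e ≤ m.
  W : ℕ → A.Carrier
  W zero = A.1#
  W (suc m) = (x ^ (q ℕ.^ suc m) A.- x) A.* W m

  module OverIdempotent (idempotent : Idem (u (W n′)) en) where
    open Residue (W n′) en en-surj idempotent using (ε; _~_; ≈⇒~; residueField; εw≉0)
    private
      module K = Field residueField
      module KO = FieldOps residueField

    fixedQ : ∀ a → a ^ (q ℕ.^ n) A.≈ a
    fixedQ a = subst (λ m → a ^ m A.≈ a) Q≡ (fixed a)

    pow≡^ : ∀ a m → KO.pow a m ≡ a ^ m
    pow≡^ a zero = refl
    pow≡^ a (suc m) = cong (a A.*_) (pow≡^ a m)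

    open VectorSpace G residueField (λ a b → (ε A.* a) ≈? (ε A.* b)) ⟨_⟩
      (λ a b → ≈⇒~ (⟨⟩-+ a b)) (λ a b → ≈⇒~ (⟨⟩-* a b)) (≈⇒~ ⟨1⟩)

    W~0 : ∀ {e} m → 1 ℕ.≤ e → e ℕ.≤ m → x ^ (q ℕ.^ e) ~ x → W m ~ A.0#
    W~0 zero (ℕ.s≤s _) () _
    W~0 {e} (suc m) 1≤e e≤m fix with e ℕ.≟ suc m
    ... | yes refl = K.trans (K.*-congʳ {W m} (K.trans (K.+-congʳ {A.- x} fix) (K.-‿inverseʳ x))) (K.zeroˡ (W m))
    ... | no ne = K.trans (K.*-congˡ {x ^ (q ℕ.^ suc m) A.- x} (W~0 m 1≤e (ℕ.≤-pred (ℕ.≤∧≢⇒< e≤m ne)) fix)) (K.zeroʳ (x ^ (q ℕ.^ suc m) A.- x))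

    module OverBasis {e : ℕ} (b : Fin e → A.Carrier) (ind : Independent b) (span : ∀ v → Spans b v) where
      open Basis b ind span using (size; rep; rep-sum)
      private
        module T = Transport residueField size
        module H = Arithmetic T.finiteField

      pow-cong : ∀ m {a b} → a ~ b → KO.pow a m ~ KO.pow b m
      pow-cong zero e = A.refl
      pow-cong (suc m) {a} {b} e = K.*-cong {a} {b} e (pow-cong m e)

      fixed-up : ∀ m → (∀ z → H.pow z m ≡ z) → ∀ v → KO.pow v m ~ v
      fixed-up m fix v = K.trans (pow-cong m (K.sym (T.e-index v))) (K.trans (K.sym (T.e-pow (T.index v) m)) (K.trans (K.reflexive (cong T.e (fix (T.index v)))) (T.e-index v)))

      fixed-down : ∀ m → (∀ v → KO.pow v m ~ v) → ∀ z → H.pow z m ≡ z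
      fixed-down m fix z = T.e-injective (K.trans (T.e-pow z m) (fix (T.e z)))

      -- All q^e elements of the residue field are roots of z^(qⁿ) - z.
      e≤n : e ℕ.≤ n
      e≤n = ℕ.≮⇒≥ (λ n<e → ℕ.<⇒≱ (ℕ.^-monoʳ-< q (2≤size G) n<e)
        (H.fixed-by-pow⇒q≤ (ℕ.≤-trans (ℕ.s≤s (ℕ.s≤s ℕ.z≤n)) (ℕ.≤-reflexive Q≡))
          (fixed-down (q ℕ.^ n) (λ v → K.trans (K.reflexive (pow≡^ v (q ℕ.^ n))) (≈⇒~ (fixedQ v))))))

      -- In a field of q^e elements x^(q^e) = x. For e < n this would annihilate a factor of `W n′`,
      -- which is nonzero modulo ε.
      n≤e : n ℕ.≤ e
      n≤e = ℕ.≮⇒≥ (λ e<n → εw≉0 (A.trans (W~0 n′ (1≤e e T.finiteField) (ℕ.≤-pred e<n)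
          (K.trans (K.reflexive (sym (pow≡^ x (q ℕ.^ e)))) (fixed-up (q ℕ.^ e) H.pow-q x))) (A.zeroʳ ε)))
        where
        1≤e : ∀ e → FiniteField (q ℕ.^ e) → 1 ℕ.≤ e
        1≤e zero H = ⊥-elim (ℕ.<⇒≱ (2≤size H) ℕ.≤-refl)
        1≤e (suc e) H = ℕ.s≤s ℕ.z≤n

      two-powers : ∀ {k} → 1 ℕ.≤ k → (k ℕ.∸ 1) ℕ.^ 4 ℕ.< q ℕ.^ e → 3 ℕ.≤ q ℕ.^ e → ∀ c →
        ∃₂ λ (A B : F.Mat e) → ∀ i j → F.mpow A k i j F.+ F.mpow B k i j ≡ c F.* F.I i j
      two-powers {k} 1≤k k⁴<Q 3≤Q c = conclude (TwoPowers.sum-of-two-powers T.finiteField k 1≤k (T.index ⟨ c ⟩) k⁴<Q 3≤Q)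
        where
        conclude : (∃₂ λ y z → H.pow y k H.+ H.pow z k ≡ T.index ⟨ c ⟩) →
          ∃₂ λ (A B : F.Mat e) → ∀ i j → F.mpow A k i j F.+ F.mpow B k i j ≡ c F.* F.I i j
        conclude (y , z , eq) = rep (T.e y) , rep (T.e z) , rep-sum (T.e y) (T.e z) k c (T.lift-sum y z k ⟨ c ⟩ eq)

    scalar : ∀ {k} → 1 ℕ.≤ k → (k ℕ.∸ 1) ℕ.^ 4 ℕ.< q ℕ.^ n → 3 ℕ.≤ q ℕ.^ n → ∀ c →
      ∃₂ λ (A B : F.Mat n) → ∀ i j → F.mpow A k i j F.+ F.mpow B k i j ≡ c F.* F.I i j
    scalar with basis-of en
    ... | e , b , ind , sp = go (ℕ.≤-antisym B.e≤n B.n≤e)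
      where
      span : ∀ v → Spans b v
      span v = let i , eq = en-surj v ; c , eq′ = sp i in c , K.trans eq′ (≈⇒~ eq)
      module B = OverBasis b ind span
      go : e ≡ n → ∀ {k} → 1 ℕ.≤ k → (k ℕ.∸ 1) ℕ.^ 4 ℕ.< q ℕ.^ n → 3 ℕ.≤ q ℕ.^ n → ∀ c →
        ∃₂ λ (A B : F.Mat n) → ∀ i j → F.mpow A k i j F.+ F.mpow B k i j ≡ c F.* F.I i j
      go refl = B.two-powers

  scalar-is-sum : ¬ W n′ A.≈ A.0# → ∀ {k} → 1 ℕ.≤ k → (k ℕ.∸ 1) ℕ.^ 4 ℕ.< q ℕ.^ n → 3 ℕ.≤ q ℕ.^ n → ∀ c →
    ∃₂ λ (A B : F.Mat n) → ∀ i j → F.mpow A k i j F.+ F.mpow B k i j ≡ c F.* F.I i j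
  scalar-is-sum W≉0 = OverIdempotent.scalar (idempotentFor en (W n′) W≉0)

module Extension {q : ℕ} (G : FiniteField q) {p l : ℕ} (pp : Prime p) (q≡ : q ≡ p ℕ.^ l) (n′ : ℕ) where
  private
    n = suc n′
    module F = Arithmetic G

    2≤q : 2 ℕ.≤ q
    2≤q = 2≤size G

  module Construction (Q″ : ℕ) (Q≡ : suc (suc Q″) ≡ q ℕ.^ n) where
    open GroupAlgebra G Q″ using (V; algebra; x; ⟨_⟩; ⟨⟩-+; ⟨⟩-homo-*; ⟨1⟩; Leads; leads-*; leads⇒≉0; module FrobeniusFixed)
    open FrobeniusFixed {p} {l} {n} pp q≡ Q≡ using (fixed)
    private module A = CommutativeRing algebra
    open Exp A.semiring using (_^_)

    deg : ℕ → ℕ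
    deg zero = 0
    deg (suc m) = q ℕ.^ suc m ℕ.+ deg m

    -- The geometric sum q + ... + q^m is at most q^(m+1) - q, by induction with q ≥ 2. Hence the
    -- degree of `W n′` stays below N = qⁿ - 1, and its leading term survives modulo x^N - 1.
    deg-bound : ∀ m → deg m ℕ.+ q ℕ.≤ q ℕ.^ suc m
    deg-bound zero = ℕ.≤-reflexive (sym (ℕ.*-identityʳ q))
    deg-bound (suc m) = ℕ.≤-trans (ℕ.≤-reflexive (ℕ.+-assoc (q ℕ.^ suc m) (deg m) q))
      (ℕ.≤-trans (ℕ.+-monoʳ-≤ (q ℕ.^ suc m) (ℕ.≤-trans (deg-bound m) (ℕ.≤-reflexive (sym (ℕ.+-identityʳ _)))))
         (ℕ.*-monoˡ-≤ (q ℕ.^ suc m) 2≤q))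

    _≈?_ : ∀ a b → Dec (a A.≈ b)
    a ≈? b = Fin.all? (λ k → a k Fin.≟ b k)

    fixed′ : ∀ a → a ^ suc (suc Q″) A.≈ a
    fixed′ a = subst (λ m → a ^ m A.≈ a) (sym Q≡) (fixed a)

    en : Fin (q ℕ.^ suc Q″) → V
    en = finToFun

    en-surj : ∀ a → ∃ λ i → en i A.≈ a
    en-surj a = funToFin a , Fin.finToFun-funToFin a

    open ResidueDegree G n′ algebra _≈?_ Q″ Q≡ fixed′ en en-surj ⟨_⟩ ⟨⟩-+ ⟨⟩-homo-* ⟨1⟩ x using (W; scalar-is-sum)

    W-leads : ∀ m → Leads (deg m) (W m)
    W-leads zero zero = (λ ()) , (λ _ → refl)
    W-leads zero (suc k) = (λ _ → refl) , (λ ())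
    W-leads (suc m) = leads-* {q ℕ.^ suc m} {deg m} {W m} (ℕ.≤-trans 2≤q (ℕ.≤-trans (ℕ.≤-reflexive (sym (ℕ.*-identityʳ q)))
      (ℕ.*-monoʳ-≤ q (ℕ.≤-trans (ℕ.≤-reflexive (sym (ℕ.^-zeroˡ m))) (ℕ.^-monoˡ-≤ m (ℕ.≤-trans (ℕ.s≤s ℕ.z≤n) 2≤q)))))) (W-leads m)

    W≉0 : ¬ W n′ A.≈ A.0#
    W≉0 = leads⇒≉0 (W-leads n′) (ℕ.≤-pred (ℕ.≤-trans (ℕ.≤-reflexive (ℕ.+-comm 2 (deg n′)))
      (ℕ.≤-trans (ℕ.+-monoʳ-≤ (deg n′) 2≤q) (ℕ.≤-trans (deg-bound n′) (ℕ.≤-reflexive (sym Q≡))))))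

    scalar : ∀ {k} → 1 ℕ.≤ k → (k ℕ.∸ 1) ℕ.^ 4 ℕ.< q ℕ.^ n → 3 ℕ.≤ q ℕ.^ n → ∀ c →
      ∃₂ λ (A B : F.Mat n) → ∀ i j → F.mpow A k i j F.+ F.mpow B k i j ≡ c F.* F.I i j
    scalar = scalar-is-sum W≉0

  scalar-is-sum-of-powers : ∀ {k} → 1 ℕ.≤ k → (k ℕ.∸ 1) ℕ.^ 4 ℕ.< q ℕ.^ n → 3 ℕ.≤ q ℕ.^ n → ∀ c →
    ∃₂ λ (A B : F.Mat n) → ∀ i j → F.mpow A k i j F.+ F.mpow B k i j ≡ c F.* F.I i j
  scalar-is-sum-of-powers 1≤k k⁴<Q 3≤Q = Construction.scalar (q ℕ.^ n ℕ.∸ 2)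
    (ℕ.m+[n∸m]≡n (ℕ.≤-trans (ℕ.s≤s (ℕ.s≤s ℕ.z≤n)) 3≤Q)) 1≤k k⁴<Q 3≤Q

-- Sums of nonzero k-th powers

-- Cancelling t² and eliminating t and β leaves γ² + 2γ + 4αγ ≤ 0.
energy-numeric : ∀ t α β B γ → 1 ℕ.≤ t → t ≡ 1 ℕ.+ α ℕ.+ α ℕ.+ γ → β ≡ 1 ℕ.+ α ℕ.+ γ → B ≡ γ ℕ.* t →
  2 ℕ.* t ℕ.* ((α ℕ.* α ℕ.+ β ℕ.* β) ℕ.* t) ℕ.≤ 2 ℕ.* t ℕ.* (t ℕ.* t ℕ.+ α ℕ.* α ℕ.* t ℕ.+ α ℕ.* α ℕ.* t) ℕ.+ B ℕ.* B → γ ≡ 0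
energy-numeric t α β B zero _ _ _ _ _ = refl
energy-numeric t α β B (suc g) 1≤t t≡ refl refl le = ⊥-elim (ℕ.<⇒≱ lt (ℕ.*-cancelʳ-≤ _ _ (t ℕ.* t) {{ℕ.>-nonZero (ℕ.*-mono-≤ 1≤t 1≤t)}}
    (subst₂ ℕ._≤_ (lhs t α b) (rhs t α (suc g)) le)))
  where
  open +-*-Solver
  b : ℕ
  b = 1 ℕ.+ α ℕ.+ suc g
  lhs : ∀ t α b → 2 ℕ.* t ℕ.* ((α ℕ.* α ℕ.+ b ℕ.* b) ℕ.* t) ≡ 2 ℕ.* (α ℕ.* α ℕ.+ b ℕ.* b) ℕ.* (t ℕ.* t)
  lhs = solve 3 (λ t a b → con 2 :* t :* ((a :* a :+ b :* b) :* t) := con 2 :* (a :* a :+ b :* b) :* (t :* t)) refl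
  rhs : ∀ t α c → 2 ℕ.* t ℕ.* (t ℕ.* t ℕ.+ α ℕ.* α ℕ.* t ℕ.+ α ℕ.* α ℕ.* t) ℕ.+ c ℕ.* t ℕ.* (c ℕ.* t) ≡ (2 ℕ.* t ℕ.+ 4 ℕ.* (α ℕ.* α) ℕ.+ c ℕ.* c) ℕ.* (t ℕ.* t)
  rhs = solve 3 (λ t a c → con 2 :* t :* (t :* t :+ a :* a :* t :+ a :* a :* t) :+ c :* t :* (c :* t) := (con 2 :* t :+ con 4 :* (a :* a) :+ c :* c) :* (t :* t)) refl
  lt : 2 ℕ.* t ℕ.+ 4 ℕ.* (α ℕ.* α) ℕ.+ suc g ℕ.* suc g ℕ.< 2 ℕ.* (α ℕ.* α ℕ.+ b ℕ.* b)
  lt = subst (λ t → 2 ℕ.* t ℕ.+ 4 ℕ.* (α ℕ.* α) ℕ.+ suc g ℕ.* suc g ℕ.< 2 ℕ.* (α ℕ.* α ℕ.+ b ℕ.* b)) (sym t≡)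
    (ℕ.≤-trans (ℕ.m≤m+n _ (2 ℕ.+ 4 ℕ.* g ℕ.+ g ℕ.* g ℕ.+ 4 ℕ.* α ℕ.+ 4 ℕ.* α ℕ.* g)) (ℕ.≤-reflexive (solve 2 (λ a g →
      con 1 :+ (con 2 :* (con 1 :+ a :+ a :+ (con 1 :+ g)) :+ con 4 :* (a :* a) :+ (con 1 :+ g) :* (con 1 :+ g)) :+ (con 2 :+ con 4 :* g :+ g :* g :+ con 4 :* a :+ con 4 :* a :* g)
      := con 2 :* (a :* a :+ (con 1 :+ a :+ (con 1 :+ g)) :* (con 1 :+ a :+ (con 1 :+ g)))) refl α g)))

-- A multiplicative subgroup P (not containing -1) of a finite field whose sumset P + P is contained in P ∪ wP has order at most 2:
-- comparing the additive energies of P + P and of P - P forces P - P ⊆ P ∪ -P ∪ {0}, and two representations of w as a sum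
-- then put w into P ∪ -P.
module SharpSumset {q : ℕ} (G : FiniteField q) (P : Fin q → Set) (P? : ∀ z → Dec (P z))
  (P-1 : P (FiniteField.1# G)) (P-* : ∀ {y z} → P y → P z → P (FiniteField._*_ G y z))
  (P-≢0 : ∀ {z} → P z → z ≢ FiniteField.0# G) (P-inv : ∀ {z} → P z → P (Arithmetic.inv G z))
  (¬P-1 : ¬ P (FiniteField.-_ G (FiniteField.1# G)))
  (w : Fin q) (w≢0 : w ≢ FiniteField.0# G) (¬Pw : ¬ P w) (¬P-w : ¬ P (FiniteField.-_ G w))
  (sumset : ∀ {y z} → P y → P z → P (FiniteField._+_ G y z) ⊎ P (FiniteField._*_ G (Arithmetic.inv G w) (FiniteField._+_ G y z))) where
  open Arithmetic G
  open ≡-Reasoning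

  t : ℕ
  t = # P?

  1≤t : 1 ℕ.≤ t
  1≤t = subst (ℕ._≤ t) (ι-yes (P? 1#) P-1) (sum≥term _ 1#)

  #-coset : ∀ {z} → z ≢ 0# → # (λ y → P? (inv z * y)) ≡ t
  #-coset {z} z≢0 = sym (#-permute P? (scale (inv z) (inv≢0 z≢0)))

  ¬P± : ∀ {z} → P z → ¬ P (- z)
  ¬P± {z} pz p-z = ¬P-1 (subst P (begin
    - z * inv z     ≡⟨ solve 2 (λ z i → :- z :* i := :- (z :* i)) refl z (inv z) ⟩
    - (z * inv z)   ≡⟨ cong -_ (inv-r (P-≢0 pz)) ⟩
    - 1#            ∎) (P-* p-z (P-inv pz)))

  wP : Fin q → Set
  wP z = P (inv w * z)

  wP? : ∀ z → Dec (wP z)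
  wP? z = P? (inv w * z)

  P⇒¬wP : ∀ {z} → P z → ¬ wP z
  P⇒¬wP {z} pz c = ¬Pw (subst P (begin
    z * inv (inv w * z)               ≡⟨ *-cancelˡ (P-≢0 c) (trans (solve 3 (λ c z i → c :* (z :* i) := z :* (c :* i)) refl (inv w * z) z (inv (inv w * z)))
                                          (trans (cong (z *_) (inv-r (P-≢0 c))) (trans (*-identityʳ z) (sym (trans (solve 3 (λ i z w → i :* z :* w := i :* w :* z) refl (inv w) z w) (trans (cong (_* z) (inv-l w≢0)) (*-identityˡ z))))))) ⟩
    w                                 ∎) (P-* pz (P-inv c)))

  χ : Fin q → ℕ
  χ z = ι (P? z)

  χ-P : ∀ {a} → P a → ∀ z → χ (a * z) ≡ χ z
  χ-P {a} pa z = ι-cong (P? (a * z)) (P? z) (λ p → subst P (*-inv-cancelˡ z (P-≢0 pa)) (P-* (P-inv pa) p)) (P-* pa)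

  -- Numbers of representations of z as a sum, respectively as a difference, of two elements of P;
  -- both are constant on cosets of P.
  r s : Fin q → ℕ
  r z = ℕΣ.sum (λ x → χ x ℕ.* χ (z - x))
  s z = ℕΣ.sum (λ x → χ x ℕ.* χ (x - z))

  r-P : ∀ {a} → P a → ∀ z → r (a * z) ≡ r z
  r-P {a} pa z = trans (ℕΣ.sum-permute _ (scale a (P-≢0 pa))) (ℕΣ.sum-cong (λ x → cong₂ ℕ._*_ (χ-P pa x)
    (trans (cong χ (solve 3 (λ a z x → a :* z :- a :* x := a :* (z :- x)) refl a z x)) (χ-P pa (z - x)))))

  s-P : ∀ {a} → P a → ∀ z → s (a * z) ≡ s z
  s-P {a} pa z = trans (ℕΣ.sum-permute _ (scale a (P-≢0 pa))) (ℕΣ.sum-cong (λ x → cong₂ ℕ._*_ (χ-P pa x)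
    (trans (cong χ (solve 3 (λ a z x → a :* x :- a :* z := a :* (x :- z)) refl a z x)) (χ-P pa (x - z)))))

  s-neg : ∀ z → s (- z) ≡ s z
  s-neg z = trans (ℕΣ.sum-permute _ (shift (- z))) (ℕΣ.sum-cong (λ x → trans (cong (λ y → χ (x - z) ℕ.* χ y) (solve 2 (λ x z → x :- z :- (:- z) := x) refl x z)) (ℕ.*-comm (χ (x - z)) (χ x))))

  α β : ℕ
  α = r 1#
  β = r w

  r-on-P : ∀ {z} → P z → r z ≡ α
  r-on-P {z} pz = trans (cong r (sym (*-identityʳ z))) (r-P pz 1#)

  r-on-wP : ∀ {z} → wP z → r z ≡ β
  r-on-wP {z} c = trans (cong r (sym (trans (*-comm _ w) (*-cancel-inv z w≢0)))) (r-P c w)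

  r-outside : ∀ {z} → ¬ P z → ¬ wP z → r z ≡ 0
  r-outside {z} ¬p ¬c = ℕΣ.sum-zero (λ x → lem x)
    where
    lem : ∀ x → χ x ℕ.* χ (z - x) ≡ 0
    lem x with P? x | P? (z - x)
    ... | no _ | _ = refl
    ... | yes _ | no _ = refl
    ... | yes p | yes p′ with sumset p p′ | solve 2 (λ x z → x :+ (z :- x) := z) refl x z
    ... | inj₁ h | eq = ⊥-elim (¬p (subst P eq h))
    ... | inj₂ h | eq = ⊥-elim (¬c (subst wP eq h))

  r-values : ∀ (g : ℕ → ℕ) → g 0 ≡ 0 → ∀ z → g (r z) ≡ g α ℕ.* χ z ℕ.+ g β ℕ.* ι (wP? z)
  r-values g g0 z with P? z | wP? z
  ... | yes p | yes c = ⊥-elim (P⇒¬wP p c)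
  ... | yes p | no _ = trans (cong g (r-on-P p)) (sym (trans (cong₂ ℕ._+_ (ℕ.*-identityʳ (g α)) (ℕ.*-zeroʳ (g β))) (ℕ.+-identityʳ _)))
  ... | no _ | yes c = trans (cong g (r-on-wP c)) (sym (cong₂ ℕ._+_ (ℕ.*-zeroʳ (g α)) (ℕ.*-identityʳ (g β))))
  ... | no ¬p | no ¬c = trans (cong g (r-outside ¬p ¬c)) (trans g0 (sym (cong₂ ℕ._+_ (ℕ.*-zeroʳ (g α)) (ℕ.*-zeroʳ (g β)))))

  Σg[r] : ∀ (g : ℕ → ℕ) → g 0 ≡ 0 → ℕΣ.sum (λ z → g (r z)) ≡ (g α ℕ.+ g β) ℕ.* t
  Σg[r] g g0 = trans (ℕΣ.sum-cong (r-values g g0)) (trans (ℕΣ.sum-+ _ _) (trans (cong₂ ℕ._+_ (sym (ℕΣ.*-sum (g α) _)) (trans (sym (ℕΣ.*-sum (g β) _)) (cong (g β ℕ.*_) (#-coset w≢0))))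
    (sym (ℕ.*-distribʳ-+ t (g α) (g β)))))

  Σr : ℕΣ.sum r ≡ t ℕ.* t
  Σr = trans (ℕΣ.sum-swap _) (trans (ℕΣ.sum-cong (λ x → trans (sym (ℕΣ.*-sum (χ x) _)) (cong (χ x ℕ.*_) (sym (ℕΣ.sum-permute χ (shift (- x))))))) (sym (ℕΣ.sum-* t χ)))

  α+β≡t : α ℕ.+ β ≡ t
  α+β≡t = ℕ.*-cancelʳ-≡ (α ℕ.+ β) t t {{ℕ.>-nonZero 1≤t}} (trans (sym (Σg[r] (λ x → x) refl)) Σr)

  Σs : ℕΣ.sum s ≡ t ℕ.* t
  Σs = trans (ℕΣ.sum-swap _) (trans (ℕΣ.sum-cong (λ x → trans (sym (ℕΣ.*-sum (χ x) _)) (cong (χ x ℕ.*_) (sym (ℕΣ.sum-permute χ (reflect x)))))) (sym (ℕΣ.sum-* t χ)))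

  -- x + (z - x) = y + (z - y) is x - y = (z - y) - (z - x).
  energy : ℕΣ.sum (λ z → r z ℕ.* r z) ≡ ℕΣ.sum (λ z → s z ℕ.* s z)
  energy = begin
    ℕΣ.sum (λ z → r z ℕ.* r z)
      ≡⟨ ℕΣ.sum-cong (λ z → trans (ℕΣ.sum-* (r z) _) (ℕΣ.sum-cong (λ x → ℕΣ.*-sum (χ x ℕ.* χ (z - x)) _))) ⟩
    ℕΣ.sum (λ z → ℕΣ.sum (λ x → ℕΣ.sum (λ y → χ x ℕ.* χ (z - x) ℕ.* (χ y ℕ.* χ (z - y)))))
      ≡⟨ trans (ℕΣ.sum-swap _) (ℕΣ.sum-cong (λ x → ℕΣ.sum-swap _)) ⟩
    ℕΣ.sum (λ x → ℕΣ.sum (λ y → ℕΣ.sum (λ z → χ x ℕ.* χ (z - x) ℕ.* (χ y ℕ.* χ (z - y)))))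
      ≡⟨ ℕΣ.sum-cong (λ x → trans (ℕΣ.sum-cong (λ y → ℕΣ.sum-permute _ (shift y))) (ℕΣ.sum-permute _ (reflect x))) ⟩
    ℕΣ.sum (λ x → ℕΣ.sum (λ z → ℕΣ.sum (λ y → χ x ℕ.* χ (y + (x - z) - x) ℕ.* (χ (x - z) ℕ.* χ (y + (x - z) - (x - z))))))
      ≡⟨ ℕΣ.sum-cong (λ x → ℕΣ.sum-cong (λ z → ℕΣ.sum-cong (λ y → trans (cong₂ (λ a b → χ x ℕ.* χ a ℕ.* (χ (x - z) ℕ.* χ b))
           (solve 3 (λ x y z → y :+ (x :- z) :- x := y :- z) refl x y z) (solve 3 (λ x y z → y :+ (x :- z) :- (x :- z) := y) refl x y z))
           (Sℕ.solve 4 (λ a b c d → a Sℕ.:* b Sℕ.:* (c Sℕ.:* d) Sℕ.:= a Sℕ.:* c Sℕ.:* (d Sℕ.:* b)) refl (χ x) (χ (y - z)) (χ (x - z)) (χ y))))) ⟩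
    ℕΣ.sum (λ x → ℕΣ.sum (λ z → ℕΣ.sum (λ y → χ x ℕ.* χ (x - z) ℕ.* (χ y ℕ.* χ (y - z)))))
      ≡⟨ ℕΣ.sum-swap _ ⟩
    ℕΣ.sum (λ z → ℕΣ.sum (λ x → ℕΣ.sum (λ y → χ x ℕ.* χ (x - z) ℕ.* (χ y ℕ.* χ (y - z)))))
      ≡⟨ ℕΣ.sum-cong (λ z → trans (ℕΣ.sum-* (s z) _) (ℕΣ.sum-cong (λ x → ℕΣ.*-sum (χ x ℕ.* χ (x - z)) _))) ⟨
    ℕΣ.sum (λ z → s z ℕ.* s z) ∎
    where module Sℕ = +-*-Solver

  s-0 : s 0# ≡ t
  s-0 = ℕΣ.sum-cong (λ x → trans (cong (λ y → χ x ℕ.* χ y) (x-0≡x x)) (idem x))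
    where
    idem : ∀ x → χ x ℕ.* χ x ≡ χ x
    idem x with P? x
    ... | yes _ = refl
    ... | no _ = refl

  -- Dividing x + y = 1 by x gives 1/x - y/x = 1, which matches representations of 1 as a sum and as
  -- a difference of elements of P.
  s-1 : s 1# ≡ α
  s-1 = sym (trans (ℕΣ.sum-permute _ (permutation inv inv inv-involutive inv-involutive)) (ℕΣ.sum-cong lem))
    where
    lem : ∀ x → χ (inv x) ℕ.* χ (1# - inv x) ≡ χ x ℕ.* χ (x - 1#)
    lem x with P? x | P? (inv x)
    ... | no _ | no _ = refl
    ... | no ¬p | yes p = ⊥-elim (¬p (subst P (inv-involutive x) (P-inv p)))
    ... | yes p | no ¬p = ⊥-elim (¬p (P-inv p))
    ... | yes p | yes p′ = cong (ℕ._+ 0) (trans (sym (χ-P p (1# - inv x))) (cong χ (begin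
        x * (1# - inv x)          ≡⟨ solve 3 (λ x o i → x :* (o :- i) := x :* o :- x :* i) refl x 1# (inv x) ⟩
        x * 1# - x * inv x        ≡⟨ cong₂ (λ a b → a - b) (*-identityʳ x) (inv-r (P-≢0 p)) ⟩
        x - 1#                    ∎)))

  s-on-P : ∀ {z} → P z → s z ≡ α
  s-on-P {z} pz = trans (cong s (sym (*-identityʳ z))) (trans (s-P pz 1#) s-1)

  s-on--P : ∀ {z} → P (- z) → s z ≡ α
  s-on--P {z} p = trans (sym (s-neg z)) (s-on-P p)

  Other : Fin q → Set
  Other z = z ≢ 0# × ¬ P z × ¬ P (- z)

  Other? : ∀ z → Dec (Other z)
  Other? z = nonzero? z ×-dec (¬? (P? z) ×-dec ¬? (P? (- z)))

  o : Fin q → ℕ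
  o z = ι (Other? z)

  s-values : ∀ (g : ℕ → ℕ) z → g (s z) ≡ g t ℕ.* ι (z Fin.≟ 0#) ℕ.+ g α ℕ.* χ z ℕ.+ g α ℕ.* χ (- z) ℕ.+ o z ℕ.* g (s z)
  s-values g z with z Fin.≟ 0# | P? z | P? (- z)
  ... | yes refl | yes p | _ = ⊥-elim (P-≢0 p refl)
  ... | yes refl | no _ | yes p = ⊥-elim (P-≢0 p -0#≡0#)
  ... | yes refl | no _ | no _ = trans (cong g s-0) (Sℕ.solve 2 (λ a b → a Sℕ.:= a Sℕ.:* Sℕ.con 1 Sℕ.:+ b Sℕ.:* Sℕ.con 0 Sℕ.:+ b Sℕ.:* Sℕ.con 0 Sℕ.:+ Sℕ.con 0) refl (g t) (g α))
    where module Sℕ = +-*-Solver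
  ... | no _ | yes p | yes p′ = ⊥-elim (¬P± p p′)
  ... | no _ | yes p | no _ = trans (cong g (s-on-P p)) (Sℕ.solve 2 (λ a b → b Sℕ.:= a Sℕ.:* Sℕ.con 0 Sℕ.:+ b Sℕ.:* Sℕ.con 1 Sℕ.:+ b Sℕ.:* Sℕ.con 0 Sℕ.:+ Sℕ.con 0) refl (g t) (g α))
    where module Sℕ = +-*-Solver
  ... | no _ | no _ | yes p = trans (cong g (s-on--P p)) (Sℕ.solve 2 (λ a b → b Sℕ.:= a Sℕ.:* Sℕ.con 0 Sℕ.:+ b Sℕ.:* Sℕ.con 0 Sℕ.:+ b Sℕ.:* Sℕ.con 1 Sℕ.:+ Sℕ.con 0) refl (g t) (g α))
    where module Sℕ = +-*-Solver
  ... | no _ | no _ | no _ = Sℕ.solve 3 (λ a b c → c Sℕ.:= a Sℕ.:* Sℕ.con 0 Sℕ.:+ b Sℕ.:* Sℕ.con 0 Sℕ.:+ b Sℕ.:* Sℕ.con 0 Sℕ.:+ (c Sℕ.:+ Sℕ.con 0)) refl (g t) (g α) (g (s z))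
    where module Sℕ = +-*-Solver

  #-P : # (λ z → P? (- z)) ≡ t
  #-P = sym (trans (#-permute P? (reflect 0#)) (#-cong (λ z → P? (0# - z)) (λ z → P? (- z)) (λ z → subst P (+-identityˡ (- z))) (λ z → subst P (sym (+-identityˡ (- z))))))

  Σg[s] : ∀ (g : ℕ → ℕ) → ℕΣ.sum (λ z → g (s z)) ≡ g t ℕ.+ g α ℕ.* t ℕ.+ g α ℕ.* t ℕ.+ ℕΣ.sum (λ z → o z ℕ.* g (s z))
  Σg[s] g = trans (ℕΣ.sum-cong (s-values g)) (trans (ℕΣ.sum-+ _ _) (cong (ℕ._+ ℕΣ.sum (λ z → o z ℕ.* g (s z))) (trans (ℕΣ.sum-+ _ _) (cong₂ ℕ._+_ (trans (ℕΣ.sum-+ _ _) (cong₂ ℕ._+_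
      (trans (sym (ℕΣ.*-sum (g t) _)) (trans (cong (g t ℕ.*_) (#-point 0#)) (ℕ.*-identityʳ (g t)))) (sym (ℕΣ.*-sum (g α) _))))
      (trans (sym (ℕΣ.*-sum (g α) _)) (cong (g α ℕ.*_) #-P))))))

  B : ℕ
  B = ℕΣ.sum (λ z → o z ℕ.* s z)

  t²≡ : t ℕ.* t ≡ t ℕ.+ α ℕ.* t ℕ.+ α ℕ.* t ℕ.+ B
  t²≡ = trans (sym Σs) (Σg[s] (λ x → x))

  -- The count s is constant on zP ∪ -zP. These cosets are disjoint because -1 is not in P, and like
  -- z they avoid 0, P and -P, so they contribute 2 t s(z) to `B`.
  2ts≤B : ∀ {z} → Other z → 2 ℕ.* t ℕ.* s z ℕ.≤ B
  2ts≤B {z} (z≢0 , ¬p , ¬p-) = ℕ.≤-trans (ℕ.≤-reflexive sum≡) (sum-mono bound)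
    where
    c c⁻ : Fin q → ℕ
    c y = ι (P? (inv z * y))
    c⁻ y = ι (P? (inv (- z) * y))
    sum≡ : 2 ℕ.* t ℕ.* s z ≡ ℕΣ.sum (λ y → (c y ℕ.+ c⁻ y) ℕ.* s z)
    sum≡ = trans (cong (ℕ._* s z) (trans (cong₂ ℕ._+_ (sym (#-coset z≢0)) (trans (ℕ.+-identityʳ t) (sym (#-coset (-‿≢0 z≢0))))) (sym (ℕΣ.sum-+ c c⁻)))) (ℕΣ.sum-* (s z) _)
    move : ∀ {y z} → z ≢ 0# → P (inv z * y) → P y → P z
    move {y} {z} z≢0 pc py = subst P (*-cancelˡ (P-≢0 pc) (begin
      inv z * y * (y * inv (inv z * y))   ≡⟨ solve 3 (λ c y i → c :* (y :* i) := y :* (c :* i)) refl (inv z * y) y (inv (inv z * y)) ⟩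
      y * (inv z * y * inv (inv z * y))   ≡⟨ cong (y *_) (inv-r (P-≢0 pc)) ⟩
      y * 1#                              ≡⟨ *-identityʳ y ⟩
      y                                   ≡⟨ *-cancel-inv y z≢0 ⟨
      z * (inv z * y)                     ≡⟨ *-comm _ _ ⟩
      inv z * y * z                       ∎)) (P-* py (P-inv pc))
    inv- : inv (- z) ≡ - inv z
    inv- = *-cancelˡ (-‿≢0 z≢0) (trans (inv-r (-‿≢0 z≢0)) (sym (trans (solve 2 (λ z i → (:- z) :* (:- i) := z :* i) refl z (inv z)) (inv-r z≢0))))
    neg-swap : ∀ y → inv (- z) * - y ≡ inv z * y
    neg-swap y = trans (cong (_* - y) inv-) (solve 2 (λ i y → (:- i) :* (:- y) := i :* y) refl (inv z) y)
    other : ∀ {y} → P (inv z * y) ⊎ P (inv (- z) * y) → Other y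
    other {y} pc = (λ y≡0 → nz pc (trans (cong (_ *_) y≡0) (zeroʳ _)) (trans (cong (_ *_) y≡0) (zeroʳ _))) ,
      (λ py → case₁ pc py) , (λ p-y → case₂ pc p-y)
      where
      nz : P (inv z * y) ⊎ P (inv (- z) * y) → inv z * y ≡ 0# → inv (- z) * y ≡ 0# → ⊥
      nz (inj₁ p) e _ = P-≢0 p e
      nz (inj₂ p) _ e = P-≢0 p e
      case₁ : P (inv z * y) ⊎ P (inv (- z) * y) → P y → ⊥
      case₁ (inj₁ p) py = ¬p (move z≢0 p py)
      case₁ (inj₂ p) py = ¬p- (move (-‿≢0 z≢0) p py)
      case₂ : P (inv z * y) ⊎ P (inv (- z) * y) → P (- y) → ⊥
      case₂ (inj₁ p) p-y = ¬p- (move (-‿≢0 z≢0) (subst P (sym (neg-swap y)) p) p-y)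
      case₂ (inj₂ p) p-y = ¬p (move z≢0 (subst P (trans (cong (_* y) inv-) (solve 2 (λ i y → (:- i) :* y := i :* (:- y)) refl (inv z) y)) p) p-y)
    s-on : ∀ {y} → P (inv z * y) ⊎ P (inv (- z) * y) → s y ≡ s z
    s-on {y} (inj₁ p) = trans (cong s (sym (trans (*-comm _ z) (*-cancel-inv y z≢0)))) (s-P p z)
    s-on {y} (inj₂ p) = trans (cong s (sym (trans (*-comm _ (- z)) (*-cancel-inv y (-‿≢0 z≢0))))) (trans (s-P p (- z)) (s-neg z))
    exclusive : ∀ {y} → P (inv z * y) → P (inv (- z) * y) → ⊥
    exclusive {y} p p′ = ¬P± p (subst P (trans (cong (_* y) inv-) (solve 2 (λ i y → (:- i) :* y := :- (i :* y)) refl (inv z) y)) p′)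
    bound : ∀ y → (c y ℕ.+ c⁻ y) ℕ.* s z ℕ.≤ o y ℕ.* s y
    bound y with P? (inv z * y) | P? (inv (- z) * y)
    ... | yes p | yes p′ = ⊥-elim (exclusive p p′)
    ... | yes p | no _ = ℕ.≤-reflexive (cong₂ ℕ._*_ (sym (ι-yes (Other? y) (other (inj₁ p)))) (sym (s-on (inj₁ p))))
    ... | no _ | yes p = ℕ.≤-reflexive (cong₂ ℕ._*_ (sym (ι-yes (Other? y) (other (inj₂ p)))) (sym (s-on (inj₂ p))))
    ... | no _ | no _ = ℕ.z≤n

  2tΣ≤B² : 2 ℕ.* t ℕ.* ℕΣ.sum (λ z → o z ℕ.* (s z ℕ.* s z)) ℕ.≤ B ℕ.* B
  2tΣ≤B² = ℕ.≤-trans (ℕ.≤-reflexive (ℕΣ.*-sum (2 ℕ.* t) _)) (ℕ.≤-trans (sum-mono lem) (ℕ.≤-reflexive (sym (ℕΣ.sum-* B _))))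
    where
    lem : ∀ z → 2 ℕ.* t ℕ.* (o z ℕ.* (s z ℕ.* s z)) ℕ.≤ o z ℕ.* s z ℕ.* B
    lem z with Other? z
    ... | no _ = ℕ.≤-reflexive (ℕ.*-zeroʳ (2 ℕ.* t))
    ... | yes oz = ℕ.≤-trans (ℕ.≤-reflexive (Sℕ.solve 2 (λ t s → t Sℕ.:* (s Sℕ.:* s Sℕ.:+ Sℕ.con 0) Sℕ.:= (s Sℕ.:+ Sℕ.con 0) Sℕ.:* (t Sℕ.:* s)) refl (2 ℕ.* t) (s z))) (ℕ.*-monoʳ-≤ (s z ℕ.+ 0) (2ts≤B oz))
      where module Sℕ = +-*-Solver

  energy-inequality : 2 ℕ.* t ℕ.* ((α ℕ.* α ℕ.+ β ℕ.* β) ℕ.* t) ℕ.≤ 2 ℕ.* t ℕ.* (t ℕ.* t ℕ.+ α ℕ.* α ℕ.* t ℕ.+ α ℕ.* α ℕ.* t) ℕ.+ B ℕ.* B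
  energy-inequality = ℕ.≤-trans (ℕ.≤-reflexive (trans (cong (2 ℕ.* t ℕ.*_) (trans (sym (Σg[r] (λ x → x ℕ.* x) refl)) (trans energy (Σg[s] (λ x → x ℕ.* x))))) (ℕ.*-distribˡ-+ (2 ℕ.* t) _ _)))
    (ℕ.+-monoʳ-≤ (2 ℕ.* t ℕ.* (t ℕ.* t ℕ.+ α ℕ.* α ℕ.* t ℕ.+ α ℕ.* α ℕ.* t)) 2tΣ≤B²)

  -- Sorting the t² pairs of elements of P by their difference gives t² = t + 2αt + B, so γ is B /
  -- t.
  γ : ℕ
  γ = t ℕ.∸ (1 ℕ.+ α ℕ.+ α)

  1+2α≤t : 1 ℕ.+ α ℕ.+ α ℕ.≤ t
  1+2α≤t = ℕ.*-cancelʳ-≤ (1 ℕ.+ α ℕ.+ α) t t {{ℕ.>-nonZero 1≤t}} (ℕ.≤-trans (ℕ.m≤m+n _ B) (ℕ.≤-reflexive (sym (trans t²≡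
    (cong (ℕ._+ B) (Sℕ.solve 2 (λ a t → t Sℕ.:+ a Sℕ.:* t Sℕ.:+ a Sℕ.:* t Sℕ.:= (Sℕ.con 1 Sℕ.:+ a Sℕ.:+ a) Sℕ.:* t) refl α t))))))
    where module Sℕ = +-*-Solver

  t≡ : t ≡ 1 ℕ.+ α ℕ.+ α ℕ.+ γ
  t≡ = sym (ℕ.m+[n∸m]≡n 1+2α≤t)

  β≡ : β ≡ 1 ℕ.+ α ℕ.+ γ
  β≡ = ℕ.+-cancelˡ-≡ α _ _ (trans α+β≡t (trans t≡ (Sℕ.solve 2 (λ a c → Sℕ.con 1 Sℕ.:+ a Sℕ.:+ a Sℕ.:+ c Sℕ.:= a Sℕ.:+ (Sℕ.con 1 Sℕ.:+ a Sℕ.:+ c)) refl α γ)))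
    where module Sℕ = +-*-Solver

  B≡ : B ≡ γ ℕ.* t
  B≡ = ℕ.+-cancelˡ-≡ (t ℕ.+ α ℕ.* t ℕ.+ α ℕ.* t) _ _ (trans (sym t²≡) (trans (cong (ℕ._* t) t≡)
    (Sℕ.solve 3 (λ a c t → (Sℕ.con 1 Sℕ.:+ a Sℕ.:+ a Sℕ.:+ c) Sℕ.:* t Sℕ.:= t Sℕ.:+ a Sℕ.:* t Sℕ.:+ a Sℕ.:* t Sℕ.:+ c Sℕ.:* t) refl α γ t)))
    where module Sℕ = +-*-Solver

  γ≡0 : γ ≡ 0
  γ≡0 = energy-numeric t α β B γ 1≤t t≡ β≡ B≡ energy-inequality

  differences : ∀ {y z} → P y → P z → y ≢ z → P (y - z) ⊎ P (- (y - z))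
  differences {y} {z} py pz y≢z with P? (y - z) | P? (- (y - z))
  ... | yes p | _ = inj₁ p
  ... | no _ | yes p = inj₂ p
  ... | no ¬p | no ¬p′ = ⊥-elim (ℕ.<⇒≱ 1≤s (ℕ.≤-reflexive s≡0))
    where
    oz : Other (y - z)
    oz = (λ e → y≢z (x-y≡0⇒x≡y e)) , ¬p , ¬p′
    s≡0 : s (y - z) ≡ 0
    s≡0 = ℕ.n≤0⇒n≡0 (ℕ.≤-trans (ℕ.≤-reflexive (sym (trans (cong (ℕ._* s (y - z)) (ι-yes (Other? (y - z)) oz)) (ℕ.*-identityˡ _))))
      (ℕ.≤-trans (sum≥term (λ z → o z ℕ.* s z) (y - z)) (ℕ.≤-reflexive (trans B≡ (cong (ℕ._* t) γ≡0)))))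
    1≤s : 1 ℕ.≤ s (y - z)
    1≤s = ℕ.≤-trans (ℕ.≤-reflexive (sym (cong₂ ℕ._*_ (ι-yes (P? y) py) (ι-yes (P? (y - (y - z))) (subst P (solve 2 (λ y z → z := y :- (y :- z)) refl y z) pz)))))
      (sum≥term (λ x → χ x ℕ.* χ (x - (y - z))) y)

  absurd : 3 ℕ.≤ t → ⊥
  absurd 3≤t = contradiction₂ two
    where
    Rep : Fin q → Set
    Rep x = P x × P (w - x)
    Rep? : ∀ x → Dec (Rep x)
    Rep? x = P? x ×-dec P? (w - x)
    term≤1 : ∀ x → χ x ℕ.* χ (w - x) ℕ.≤ 1
    term≤1 x = ℕ.*-mono-≤ (ι≤1 (P? x)) (ι≤1 (P? (w - x)))
    term≡0 : ∀ x → ¬ Rep x → χ x ℕ.* χ (w - x) ≡ 0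
    term≡0 x ¬r with P? x | P? (w - x)
    ... | yes p | yes p′ = ⊥-elim (¬r (p , p′))
    ... | yes _ | no _ = refl
    ... | no _ | _ = refl
    2≤β : 2 ℕ.≤ β
    2≤β = subst (2 ℕ.≤_) (sym (trans β≡ (trans (cong (1 ℕ.+ α ℕ.+_) γ≡0) (ℕ.+-identityʳ _)))) (ℕ.s≤s (pos α (ℕ.≤-pred (subst (3 ℕ.≤_) (trans t≡ (trans (cong (1 ℕ.+ α ℕ.+ α ℕ.+_) γ≡0) (ℕ.+-identityʳ _))) 3≤t))))
      where
      pos : ∀ a → 2 ℕ.≤ a ℕ.+ a → 1 ℕ.≤ a
      pos (suc a) _ = ℕ.s≤s ℕ.z≤n
    two : ∃₂ λ x x′ → Rep x × Rep x′ × x ≢ x′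
    two with Fin.any? Rep?
    ... | no none = ⊥-elim (ℕ.<⇒≱ 2≤β (ℕ.≤-trans (ℕ.≤-reflexive (ℕΣ.sum-zero (λ x → term≡0 x (λ r → none (x , r))))) ℕ.z≤n))
    ... | yes (x , rx) with Fin.any? (λ x′ → Rep? x′ ×-dec ¬? (x Fin.≟ x′))
    ... | yes (x′ , rx′ , ne) = x , x′ , rx , rx′ , ne
    ... | no none = ⊥-elim (ℕ.<⇒≱ 2≤β (ℕ.≤-trans (ℕ.≤-reflexive (ℕΣ.sum-single _ x (λ x′ x′≢x → term≡0 x′ (λ r → none (x′ , r , λ e → x′≢x (sym e)))))) (term≤1 x)))
    contradiction₂ : (∃₂ λ x x′ → Rep x × Rep x′ × x ≢ x′) → ⊥
    contradiction₂ (x , x′ , (px , py) , (px′ , py′) , x≢x′) = finish (differences pA pA′ A≢A′) (differences pX pX′ X≢X′)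
      where
      y = w - x
      y′ = w - x′
      A = inv y
      A′ = inv y′
      X = x * A
      X′ = x′ * A′
      pA = P-inv py
      pA′ = P-inv py′
      pX = P-* px pA
      pX′ = P-* px′ pA′
      A≢A′ : A ≢ A′
      A≢A′ e = x≢x′ (trans (solve 2 (λ w x → x := w :- (w :- x)) refl w x) (trans (cong (λ v → w - v) (trans (sym (inv-involutive y)) (trans (cong inv e) (inv-involutive y′)))) (solve 2 (λ w x → w :- (w :- x) := x) refl w x′)))
      X≡ : ∀ x → w - x ≢ 0# → x * inv (w - x) ≡ w * inv (w - x) - 1#
      X≡ x ne = begin
        x * inv (w - x)                              ≡⟨ solve 3 (λ w x i → x :* i := w :* i :- (w :- x) :* i) refl w x (inv (w - x)) ⟩
        w * inv (w - x) - (w - x) * inv (w - x)      ≡⟨ cong (λ v → w * inv (w - x) - v) (inv-r ne) ⟩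
        w * inv (w - x) - 1#                         ∎
      -- From w = x + y follows x/y = w/y - 1, so passing from the difference of the 1/y to the
      -- difference of the x/y multiplies by w. Both differences lie in P ∪ -P, and then so does
      -- their ratio w.
      key : X - X′ ≡ w * (A - A′)
      key = trans (cong₂ (λ a b → a - b) (X≡ x (P-≢0 py)) (X≡ x′ (P-≢0 py′))) (solve 4 (λ w a b o → (w :* a :- o) :- (w :* b :- o) := w :* (a :- b)) refl w A A′ 1#)
      X≢X′ : X ≢ X′
      X≢X′ e = *-≢0 w≢0 (λ e → A≢A′ (x-y≡0⇒x≡y e)) (trans (sym key) (x≡y⇒x-y≡0 e))
      divide-out : ∀ {a} v → P a → P (v * a) → P v
      divide-out {a} v pa p = subst P (trans (*-assoc _ _ _) (trans (cong (v *_) (inv-r (P-≢0 pa))) (*-identityʳ v))) (P-* p (P-inv pa))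
      finish : P (A - A′) ⊎ P (- (A - A′)) → P (X - X′) ⊎ P (- (X - X′)) → ⊥
      finish (inj₁ p) (inj₁ p′) = ¬Pw (divide-out w p (subst P key p′))
      finish (inj₁ p) (inj₂ p′) = ¬P-w (divide-out (- w) p (subst P (trans (cong -_ key) (solve 2 (λ w a → :- (w :* a) := (:- w) :* a) refl w (A - A′))) p′))
      finish (inj₂ p) (inj₁ p′) = ¬P-w (divide-out (- w) p (subst P (trans key (solve 2 (λ w a → w :* a := (:- w) :* (:- a)) refl w (A - A′))) p′))
      finish (inj₂ p) (inj₂ p′) = ¬Pw (divide-out w p (subst P (trans (cong -_ key) (solve 2 (λ w a → :- (w :* a) := w :* (:- a)) refl w (A - A′))) p′))

module PowerSums {q : ℕ} (G : FiniteField q) (k : ℕ) (1≤k : 1 ℕ.≤ k) where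
  open Arithmetic G
  open ≡-Reasoning

  P : Fin q → Set
  P z = ∃ λ x → x ≢ 0# × pow x k ≡ z

  P? : ∀ z → Dec (P z)
  P? z = Fin.any? (λ x → nonzero? x ×-dec (pow x k Fin.≟ z))

  t : ℕ
  t = # P?

  P-pow : ∀ {x} → x ≢ 0# → P (pow x k)
  P-pow {x} x≢0 = x , x≢0 , refl

  P-1 : P 1#
  P-1 = 1# , 1≢0 , pow-1# k

  P-* : ∀ {y z} → P y → P z → P (y * z)
  P-* (x , x≢0 , refl) (x′ , x′≢0 , refl) = x * x′ , *-≢0 x≢0 x′≢0 , pow-* x x′ k

  P-≢0 : ∀ {z} → P z → z ≢ 0#
  P-≢0 (x , x≢0 , refl) = pow-≢0 k x≢0

  P-inv : ∀ {z} → P z → P (inv z)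
  P-inv {z} pz@(x , x≢0 , refl) = inv x , inv≢0 x≢0 , *-cancelˡ (P-≢0 pz) (trans (trans (*-comm _ _) (inv-pow k x≢0)) (sym (inv-r (P-≢0 pz))))

  -- Sums of exactly m nonzero powers: every summand occupies a diagonal position, and at most two
  -- of the 2n positions may hold a zero.
  E : ℕ → Fin q → Set
  E zero z = z ≡ 0#
  E (suc m) z = ∃ λ x → x ≢ 0# × E m (z - pow x k)

  E? : ∀ m z → Dec (E m z)
  E? zero z = z Fin.≟ 0#
  E? (suc m) z = Fin.any? (λ x → nonzero? x ×-dec E? m (z - pow x k))

  Invariant : (Fin q → Set) → Set
  Invariant X = ∀ {z a} → P a → X z → X (z * a)

  E-invariant : ∀ m → Invariant (E m)
  E-invariant zero {z} {a} _ z≡0 = trans (cong (_* a) z≡0) (zeroˡ a)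
  E-invariant (suc m) {z} pa@(y , y≢0 , refl) (x , x≢0 , e) = x * y , *-≢0 x≢0 y≢0 ,
    subst (E m) (trans (solve 3 (λ z p a → (z :- p) :* a := z :* a :- p :* a) refl z (pow x k) (pow y k)) (cong (λ p → z * pow y k - p) (sym (pow-* x y k))))
      (E-invariant m pa e)

  E-add : ∀ m m′ {y z} → E m y → E m′ z → E (m ℕ.+ m′) (y + z)
  E-add zero m′ {y} {z} refl ez = subst (E m′) (sym (+-identityˡ z)) ez
  E-add (suc m) m′ {y} {z} (x , x≢0 , ey) ez = x , x≢0 , subst (E (m ℕ.+ m′))
    (solve 3 (λ y z p → y :- p :+ z := y :+ z :- p) refl y z (pow x k)) (E-add m m′ ey ez)

  E-split : ∀ m m′ {z} → E (m ℕ.+ m′) z → ∃₂ λ z₁ z₂ → E m z₁ × E m′ z₂ × z₁ + z₂ ≡ z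
  E-split zero m′ {z} e = 0# , z , refl , e , +-identityˡ z
  E-split (suc m) m′ {z} (x , x≢0 , e) with E-split m m′ e
  ... | z₁ , z₂ , e₁ , e₂ , eq = z₁ + pow x k , z₂ ,
    (x , x≢0 , subst (E m) (solve 2 (λ z p → z := z :+ p :- p) refl z₁ (pow x k)) e₁) , e₂ ,
    trans (solve 3 (λ a b p → a :+ p :+ b := a :+ b :+ p) refl z₁ z₂ (pow x k)) (trans (cong (_+ pow x k) eq) (solve 2 (λ z p → z :- p :+ p := z) refl z (pow x k)))

  P⇒E1 : ∀ {z} → P z → E 1 z
  P⇒E1 (x , x≢0 , e) = x , x≢0 , x≡y⇒x-y≡0 (sym e)

  E-multiple : ∀ m j {z} → E m z → z ≡ 0# → E (j ℕ.* m) 0#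
  E-multiple m zero e z≡0 = refl
  E-multiple m (suc j) e z≡0 = subst (E (m ℕ.+ j ℕ.* m)) (trans (cong (_+ 0#) z≡0) (+-identityˡ 0#)) (E-add m (j ℕ.* m) e (E-multiple m j e z≡0))

  E⇒vector : ∀ m {z} → E m z → Σ (Fin m → Fin q) λ v → (∀ i → v i ≢ 0#) × FΣ.sum (λ i → pow (v i) k) ≡ z
  E⇒vector zero e = (λ ()) , (λ ()) , trans (FΣ.sum-empty _) (sym e)
  E⇒vector (suc m) {z} (x , x≢0 , e) with E⇒vector m e
  ... | v , v≢0 , eq = v′ , (λ { zero → x≢0 ; (suc i) → v≢0 i }) , trans (FΣ.sum-suc _) (trans (cong (pow x k +_) eq) (solve 2 (λ z p → p :+ (z :- p) := z) refl z (pow x k)))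
    where
    v′ : Fin (suc m) → Fin q
    v′ zero = x
    v′ (suc i) = v i

  unity? : ∀ x → Dec (pow x k ≡ 1#)
  unity? x = pow x k Fin.≟ 1#

  D : ℕ
  D = # unity?

  -- Each nonzero k-th power has exactly D roots.
  #nonzero≡Dt : # nonzero? ≡ D ℕ.* t
  #nonzero≡Dt = trans (ℕΣ.sum-cong (λ x → sym (split x))) (trans (ℕΣ.sum-swap _) (trans (ℕΣ.sum-cong fibre) (sym (ℕΣ.*-sum D _))))
    where
    split : ∀ x → ℕΣ.sum (λ z → ι (nonzero? x ×-dec (pow x k Fin.≟ z))) ≡ ι (nonzero? x)
    split x = trans (ℕΣ.sum-single _ (pow x k) (λ z z≢ → ι-no (nonzero? x ×-dec (pow x k Fin.≟ z)) (λ e → z≢ (sym (proj₂ e)))))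
      (ι-cong (nonzero? x ×-dec (pow x k Fin.≟ pow x k)) (nonzero? x) proj₁ (λ n → n , refl))
    fibre : ∀ z → ℕΣ.sum (λ x → ι (nonzero? x ×-dec (pow x k Fin.≟ z))) ≡ D ℕ.* ι (P? z)
    fibre z with P? z
    ... | no ¬pz = trans (ℕΣ.sum-zero (λ x → ι-no (nonzero? x ×-dec (pow x k Fin.≟ z)) (λ e → ¬pz (x , e)))) (sym (ℕ.*-zeroʳ D))
    ... | yes (y , y≢0 , refl) = trans (ℕΣ.sum-permute _ (scale y y≢0)) (trans (ℕΣ.sum-cong (λ x →
          ι-cong (nonzero? (y * x) ×-dec (pow (y * x) k Fin.≟ pow y k)) (unity? x)
            (λ (_ , e) → *-cancelˡ (pow-≢0 k y≢0) (trans (sym (pow-* y x k)) (trans e (sym (*-identityʳ _)))))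
            (λ e → *-≢0 y≢0 (λ x≡0 → 1≢0 (trans (sym e) (trans (cong (λ z → pow z k) x≡0) (pow-0# 1≤k)))) ,
                   trans (pow-* y x k) (trans (cong (pow y k *_) e) (*-identityʳ _))))) (sym (ℕ.*-identityʳ D)))

  1≤t : 1 ℕ.≤ t
  1≤t = subst (ℕ._≤ t) (ι-yes (P? 1#) P-1) (sum≥term _ 1#)

  1≤D : 1 ℕ.≤ D
  1≤D = subst (ℕ._≤ D) (ι-yes (unity? 1#) (pow-1# k)) (sum≥term _ 1#)

  -- The power a₀ = uᵏ serves twice: a₀ ≠ 1 makes 1 - a₀ a nonzero translation and the sum of z over
  -- an invariant set vanish, and a₀² ≠ 1 makes the sum of z² vanish.
  module Generated (gen : ∀ x → SumOfPowers k x) (u : Fin q) (u≢0 : u ≢ 0#) (uu≢1 : pow u k * pow u k ≢ 1#) where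
    a₀ : Fin q
    a₀ = pow u k

    a₀≢1 : a₀ ≢ 1#
    a₀≢1 e = uu≢1 (trans (cong₂ _*_ e e) (*-identityˡ 1#))

    P-a₀ : P a₀
    P-a₀ = P-pow u≢0

    -- Taking a = yᵏ and b = yᵏ a₀ makes X stable under translation by yᵏ (1 - a₀). Iterating, X
    -- absorbs c (1 - a₀) for every sum c of k-th powers. By `gen` these are all multiples of 1 -
    -- a₀, hence all of F.
    stable⇒full : ∀ {X : Fin q → Set} → (∀ {z a b} → P a → P b → X z → X (z - b + a)) → ∃ X → ∀ z → X z
    stable⇒full {X} stable (z₀ , xz₀) z = subst X (begin
        z₀ + (z - z₀) * inv δ * δ    ≡⟨ cong (z₀ +_) (trans (*-assoc _ _ _) (trans (cong ((z - z₀) *_) (inv-l δ≢0)) (*-identityʳ _))) ⟩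
        z₀ + (z - z₀)                ≡⟨ solve 2 (λ y z → y :+ (z :- y) := z) refl z₀ z ⟩
        z                            ∎) (translate (gen ((z - z₀) * inv δ)) xz₀)
      where
      δ : Fin q
      δ = 1# - a₀
      δ≢0 : δ ≢ 0#
      δ≢0 e = a₀≢1 (sym (x-y≡0⇒x≡y e))
      translate : ∀ {c} → SumOfPowers k c → ∀ {z} → X z → X (z + c * δ)
      translate (empty {c} c≡0) {z} xz = subst X (sym (trans (cong (λ c → z + c * δ) c≡0) (trans (cong (z +_) (zeroˡ δ)) (+-identityʳ z)))) xz
      translate (step {c} {c′} y s c≡) {z} xz with y Fin.≟ 0#
      ... | yes refl = subst (λ c → X (z + c * δ)) (sym (trans c≡ (trans (cong (c′ +_) (pow-0# 1≤k)) (+-identityʳ c′)))) (translate s xz)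
      ... | no y≢0 = subst X (begin
          z + c′ * δ - pow y k * a₀ + pow y k                  ≡⟨ cong (z + c′ * δ - pow y k * a₀ +_) (*-identityʳ _) ⟨
          z + c′ * δ - pow y k * a₀ + pow y k * 1#             ≡⟨ solve 5 (λ z c o a p → z :+ c :* (o :- a) :- p :* a :+ p :* o := z :+ (c :+ p) :* (o :- a)) refl z c′ 1# a₀ (pow y k) ⟩
          z + (c′ + pow y k) * δ                               ≡⟨ cong (λ c → z + c * δ) c≡ ⟨
          z + c * δ                                            ∎) (stable (P-pow y≢0) (P-* (P-pow y≢0) P-a₀) (translate s xz))

    module _ {X : Fin q → Set} (X? : ∀ z → Dec (X z)) where
      weigh : (Fin q → Fin q) → Fin q
      weigh g = FΣ.sum (λ z → nat (ι (X? z)) * g z)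

      weigh-1 : weigh (λ _ → 1#) ≡ nat (# X?)
      weigh-1 = trans (FΣ.sum-cong (λ z → *-identityʳ _)) (sum-nat (λ z → ι (X? z)))
        where
        sum-nat : ∀ {n} (f : Fin n → ℕ) → FΣ.sum (λ z → nat (f z)) ≡ nat (ℕΣ.sum f)
        sum-nat {zero} f = trans (FΣ.sum-empty _) (cong nat (sym (ℕΣ.sum-empty f)))
        sum-nat {suc n} f = trans (FΣ.sum-suc _) (trans (cong (nat (f zero) +_) (sum-nat (λ i → f (suc i)))) (trans (sym (nat-+ (f zero) (ℕΣ.sum (λ i → f (suc i))))) (cong nat (sym (ℕΣ.sum-suc f)))))

      -- Substituting a₀ z for z permutes X and multiplies the sum by b ≠ 1.
      weigh-homogeneous : Invariant X → ∀ {g b} → b ≢ 1# → (∀ z → g (a₀ * z) ≡ b * g z) → weigh g ≡ 0#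
      weigh-homogeneous inv-X {g} {b} b≢1 hom = *-cancelˡ (λ e → b≢1 (sym (x-y≡0⇒x≡y e))) (begin
        (1# - b) * weigh g          ≡⟨ solve 3 (λ o b s → (o :- b) :* s := o :* s :- b :* s) refl 1# b (weigh g) ⟩
        1# * weigh g - b * weigh g  ≡⟨ cong (_- b * weigh g) (trans (*-identityˡ _) scaled) ⟩
        b * weigh g - b * weigh g   ≡⟨ -‿inverseʳ _ ⟩
        0#                          ≡⟨ zeroʳ _ ⟨
        (1# - b) * 0#               ∎)
        where
        scaled : weigh g ≡ b * weigh g
        scaled = begin
          weigh g                                                  ≡⟨ FΣ.sum-permute _ (scale a₀ (P-≢0 P-a₀)) ⟩
          FΣ.sum (λ z → nat (ι (X? (a₀ * z))) * g (a₀ * z))        ≡⟨ FΣ.sum-cong (λ z → cong₂ _*_ (cong nat (ι-cong (X? (a₀ * z)) (X? z) (down z) (λ xz → subst X (*-comm z a₀) (inv-X P-a₀ xz)))) (hom z)) ⟩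
          FΣ.sum (λ z → nat (ι (X? z)) * (b * g z))                ≡⟨ FΣ.sum-cong (λ z → solve 3 (λ n b g → n :* (b :* g) := b :* (n :* g)) refl (nat (ι (X? z))) b (g z)) ⟩
          FΣ.sum (λ z → b * (nat (ι (X? z)) * g z))                ≡⟨ FΣ.*-sum b _ ⟨
          b * weigh g                                              ∎
          where
          down : ∀ z → X (a₀ * z) → X z
          down z x = subst X (trans (*-comm _ _) (*-inv-cancelˡ z (P-≢0 P-a₀))) (inv-X (P-inv P-a₀) x)

      Σz≡0 : Invariant X → weigh (λ z → z) ≡ 0#
      Σz≡0 inv-X = weigh-homogeneous inv-X a₀≢1 (λ z → refl)

      Σz²≡0 : Invariant X → weigh (λ z → z * z) ≡ 0#
      Σz²≡0 inv-X = weigh-homogeneous inv-X uu≢1 (λ z → solve 2 (λ a z → a :* z :* (a :* z) := a :* a :* (z :* z)) refl a₀ z)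

    -- The sumset X + P of an invariant set X gains at least two elements unless it is everything: if it gained only z_a over the
    -- translate X + a, the sums of z and of z² over the invariant sets X and X + P vanish and determine z_a = -|X| a and |X|(|X| + 1) = 0.
    module Growth {X : Fin q → Set} (X? : ∀ z → Dec (X z)) (inv-X : Invariant X) (x₀ : ∃ X) where
      Z : Fin q → Set
      Z z = ∃ λ x → x ≢ 0# × X (z - pow x k)

      Z? : ∀ z → Dec (Z z)
      Z? z = Fin.any? (λ x → nonzero? x ×-dec X? (z - pow x k))

      intro : ∀ {z a} → P a → X (z - a) → Z z
      intro (x , x≢0 , refl) h = x , x≢0 , h

      inv-Z : Invariant Z
      inv-Z {z} {b} pb@(y , y≢0 , refl) (x , x≢0 , h) = intro (P-* (P-pow x≢0) pb)
        (subst X (solve 3 (λ z p b → (z :- p) :* b := z :* b :- p :* b) refl z (pow x k) b) (inv-X pb h))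

      z₀ : ∃ Z
      z₀ = proj₁ x₀ + 1# , intro P-1 (subst X (solve 2 (λ z o → z := z :+ o :- o) refl (proj₁ x₀) 1#) (proj₂ x₀))

      shifted? : ∀ a z → Dec (X (z - a))
      shifted? a z = X? (z - a)

      #shifted : ∀ a → # (shifted? a) ≡ # X?
      #shifted a = sym (#-permute X? (shift (- a)))

      -- Every translate X + b with b in P lies in Z and has |X| elements, so all of them equal Z;
      -- then Z - b + a ⊆ Z.
      full-if-small : # Z? ℕ.≤ # X? → ∀ z → Z z
      full-if-small le = stable⇒full (λ {z} {a} {b} pa pb zz → intro pa (subst X (solve 3 (λ z a b → z :- b := z :- b :+ a :- a) refl z a b)
          (#-≤⇒⊇ (shifted? b) Z? (λ y → intro pb) (ℕ.≤-trans le (ℕ.≤-reflexive (sym (#shifted b)))) z zz))) z₀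

      module OneMore (eq : # Z? ≡ suc (# X?)) where
        missing : ∀ {a} → P a → ∃ λ z → Z z × ¬ X (z - a)
        missing {a} pa with Fin.any? (λ z → Z? z ×-dec ¬? (X? (z - a)))
        ... | yes m = m
        ... | no none = ⊥-elim (ℕ.<⇒≱ (ℕ.≤-reflexive (sym eq)) (ℕ.≤-trans (#-mono Z? (shifted? a) below) (ℕ.≤-reflexive (#shifted a))))
          where
          below : ∀ z → Z z → X (z - a)
          below z zz with X? (z - a)
          ... | yes x = x
          ... | no ¬x = ⊥-elim (none (z , zz , ¬x))

        module At {a} (pa : P a) where
          m : Fin q
          m = proj₁ (missing pa)

          m∈Z : Z m
          m∈Z = proj₁ (proj₂ (missing pa))

          m∉ : ¬ X (m - a)
          m∉ = proj₂ (proj₂ (missing pa))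

          cover : ∀ z → Z z → X (z - a) ⊎ z ≡ m
          cover = #-≤⇒⊇ (λ z → X? (z - a) ⊎-dec (z Fin.≟ m)) Z? (λ { z (inj₁ h) → intro pa h ; z (inj₂ refl) → m∈Z })
            (ℕ.≤-trans (ℕ.≤-reflexive (trans eq (trans (ℕ.+-comm 1 _) (cong₂ ℕ._+_ (sym (#shifted a)) (sym (#-point m))))))
              (#-disjoint (shifted? a) (Fin._≟ m) _ (λ _ → inj₁) (λ _ → inj₂) (λ { z h refl → m∉ h })))

          weights : ∀ g → weigh Z? g ≡ weigh X? (λ z → g (z + a)) + g m
          weights g = begin
            weigh Z? g                                                                  ≡⟨ FΣ.sum-cong (λ z → trans (cong (_* g z) (pointwise z)) (distribʳ _ _ _)) ⟩
            FΣ.sum (λ z → nat (ι (X? (z - a))) * g z + nat (ι (z Fin.≟ m)) * g z)       ≡⟨ FΣ.sum-+ _ _ ⟩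
            FΣ.sum (λ z → nat (ι (X? (z - a))) * g z) + FΣ.sum (λ z → nat (ι (z Fin.≟ m)) * g z)
              ≡⟨ cong₂ _+_ (trans (FΣ.sum-permute _ (shift a)) (FΣ.sum-cong (λ z → cong (λ y → nat (ι (X? y)) * g (z + a)) (solve 2 (λ z a → z :+ a :- a := z) refl z a))))
                 (trans (FΣ.sum-single _ m (λ z z≢m → trans (cong (λ n → nat n * g z) (ι-no (z Fin.≟ m) z≢m)) (zeroˡ _)))
                    (trans (cong (λ n → nat n * g m) (ι-yes (m Fin.≟ m) refl)) (trans (cong (_* g m) nat-1) (*-identityˡ _)))) ⟩
            weigh X? (λ z → g (z + a)) + g m                                            ∎
            where
            pointwise : ∀ z → nat (ι (Z? z)) ≡ nat (ι (X? (z - a))) + nat (ι (z Fin.≟ m))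
            pointwise z = trans (cong nat (lem z)) (nat-+ (ι (X? (z - a))) (ι (z Fin.≟ m)))
              where
              lem : ∀ z → ι (Z? z) ≡ ι (X? (z - a)) ℕ.+ ι (z Fin.≟ m)
              lem z with X? (z - a) | z Fin.≟ m
              ... | yes h | yes refl = ⊥-elim (m∉ h)
              ... | yes h | no _ = ι-yes (Z? z) (intro pa h)
              ... | no _ | yes refl = ι-yes (Z? z) m∈Z
              ... | no ¬h | no ¬m = ι-no (Z? z) (λ zz → case cover z zz of λ { (inj₁ h) → ¬h h ; (inj₂ e) → ¬m e })

          c : Fin q
          c = nat (# X?)

          m≡ : m ≡ - (c * a)
          m≡ = begin
            m                        ≡⟨ solve 3 (λ m s t → m := s :+ t :+ m :- t :- s) refl m (weigh X? (λ z → z)) (c * a) ⟩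
            weigh X? (λ z → z) + c * a + m - c * a - weigh X? (λ z → z)  ≡⟨ cong₂ (λ s s′ → s - c * a - s′) sum0 (Σz≡0 X? inv-X) ⟩
            0# - c * a - 0#          ≡⟨ solve 2 (λ o x → o :- x :- o := :- x) refl 0# (c * a) ⟩
            - (c * a)                ∎
            where
            sum0 : weigh X? (λ z → z) + c * a + m ≡ 0#
            sum0 = trans (cong (_+ m) (sym (trans (FΣ.sum-cong (λ z → distribˡ _ _ _)) (trans (FΣ.sum-+ _ _) (cong (weigh X? (λ z → z) +_)
                (trans (FΣ.sum-cong (λ z → cong (_* a) (sym (*-identityʳ (nat (ι (X? z))))))) (trans (sym (FΣ.sum-* a _)) (cong (_* a) (weigh-1 X?)))))))))
              (trans (sym (weights (λ z → z))) (Σz≡0 Z? inv-Z))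

          cc≡ : c * (c + 1#) ≡ 0#
          cc≡ = *-cancelˡ (*-≢0 (P-≢0 pa) (P-≢0 pa)) (begin
            a * a * (c * (c + 1#))                          ≡⟨ solve 3 (λ a c o → a :* a :* (c :* (c :+ o)) := c :* (o :* a :* a) :+ (:- (c :* a)) :* (:- (c :* a))) refl a c 1# ⟩
            c * (1# * a * a) + - (c * a) * - (c * a)        ≡⟨ cong₂ _+_ (cong (c *_) (cong (_* a) (*-identityˡ a))) (cong₂ _*_ (sym m≡) (sym m≡)) ⟩
            c * (a * a) + m * m                             ≡⟨ cong (_+ m * m) squares ⟨
            weigh X? (λ z → (z + a) * (z + a)) + m * m      ≡⟨ weights (λ z → z * z) ⟨
            weigh Z? (λ z → z * z)                          ≡⟨ Σz²≡0 Z? inv-Z ⟩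
            0#                                              ≡⟨ zeroʳ _ ⟨
            a * a * 0#                                      ∎)
            where
            squares : weigh X? (λ z → (z + a) * (z + a)) ≡ c * (a * a)
            squares = begin
              weigh X? (λ z → (z + a) * (z + a))
                ≡⟨ FΣ.sum-cong (λ z → trans (cong (λ n → n * ((z + a) * (z + a))) (sym (*-identityʳ (nat (ι (X? z))))))
                     (solve 4 (λ n o z a → n :* o :* ((z :+ a) :* (z :+ a)) := (n :* (o :* (z :* z)) :+ n :* (o :* z) :* (a :+ a)) :+ n :* o :* (a :* a)) refl (nat (ι (X? z))) 1# z a)) ⟩
              FΣ.sum (λ z → (nat (ι (X? z)) * (1# * (z * z)) + nat (ι (X? z)) * (1# * z) * (a + a)) + nat (ι (X? z)) * 1# * (a * a))
                ≡⟨ trans (FΣ.sum-+ _ _) (cong₂ _+_ (trans (FΣ.sum-+ _ _) (cong₂ _+_ (FΣ.sum-cong (λ z → cong (nat (ι (X? z)) *_) (*-identityˡ (z * z)))) (trans (sym (FΣ.sum-* (a + a) _)) (cong (_* (a + a)) (FΣ.sum-cong (λ z → cong (nat (ι (X? z)) *_) (*-identityˡ z))))))) (trans (sym (FΣ.sum-* (a * a) _)) (cong (_* (a * a)) (weigh-1 X?)))) ⟩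
              weigh X? (λ z → z * z) + weigh X? (λ z → z) * (a + a) + c * (a * a)
                ≡⟨ cong (_+ c * (a * a)) (trans (cong₂ _+_ (Σz²≡0 X? inv-X) (trans (cong (_* (a + a)) (Σz≡0 X? inv-X)) (zeroˡ _))) (+-identityˡ 0#)) ⟩
              0# + c * (a * a)
                ≡⟨ +-identityˡ _ ⟩
              c * (a * a) ∎

        full : ∀ z → Z z
        full with nat (# X?) Fin.≟ 0#
        -- If |X| = 0 in F, the extra point of Z over every translate is 0. It does not lie in X +
        -- a, so X + a ⊆ X + b for all a, b in P.
        ... | yes c≡0 = λ z → intro P-1 (all (z - 1#))
          where
          m≡0 : ∀ {a} (pa : P a) → At.m pa ≡ 0#
          m≡0 {a} pa = trans (At.m≡ pa) (trans (cong (λ c → - (c * a)) c≡0) (trans (cong -_ (zeroˡ a)) -0#≡0#))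
          all : ∀ z → X z
          all = stable⇒full step′ x₀
            where
            step′ : ∀ {z a b} → P a → P b → X z → X (z - b + a)
            step′ {z} {a} {b} pa pb xz with At.cover pb (z + a) za
              where
              za : Z (z + a)
              za = intro pa (subst X (solve 2 (λ z a → z := z :+ a :- a) refl z a) xz)
            ... | inj₁ h = subst X (solve 3 (λ z a b → z :+ a :- b := z :- b :+ a) refl z a b) h
            ... | inj₂ e = ⊥-elim (At.m∉ pa (subst X (trans (solve 2 (λ z a → z := z :+ a :- a) refl z a) (cong (_- a) (trans e (trans (m≡0 pb) (sym (m≡0 pa)))))) xz))
        -- Now |X| = -1 in F, so the extra point over X + a is a itself. Translation by a - b
        -- carries the extra point b to a, and for any other z in Z the element z - b lies in X, so
        -- z - b + a is again in Z.
        ... | no c≢0 = stable⇒full step′ z₀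
          where
          m≡a : ∀ {a} (pa : P a) → At.m pa ≡ a
          m≡a {a} pa = trans (At.m≡ pa) (begin
            - (nat (# X?) * a)                       ≡⟨ solve 3 (λ c a o → :- (c :* a) := o :* a :- (c :+ o) :* a) refl (nat (# X?)) a 1# ⟩
            1# * a - (nat (# X?) + 1#) * a           ≡⟨ cong₂ (λ x y → x - y * a) (*-identityˡ a) (*-cancelˡ c≢0 (trans (At.cc≡ pa) (sym (zeroʳ _)))) ⟩
            a - 0# * a                               ≡⟨ cong (λ x → a - x) (zeroˡ a) ⟩
            a - 0#                                   ≡⟨ x-0≡x a ⟩
            a                                        ∎)
          step′ : ∀ {z a b} → P a → P b → Z z → Z (z - b + a)
          step′ {z} {a} {b} pa pb zz with At.cover pb z zz
          ... | inj₁ h = intro pa (subst X (solve 3 (λ z a b → z :- b := z :- b :+ a :- a) refl z a b) h)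
          ... | inj₂ e = subst Z (sym (begin
            z - b + a     ≡⟨ cong (λ y → y - b + a) (trans e (m≡a pb)) ⟩
            b - b + a     ≡⟨ solve 2 (λ a b → b :- b :+ a := a) refl a b ⟩
            a             ≡⟨ m≡a pa ⟨
            At.m pa       ∎)) (At.m∈Z pa)

      growth : (∀ z → Z z) ⊎ (# X? ℕ.+ 2 ℕ.≤ # Z?)
      growth with # X? ℕ.+ 2 ℕ.≤? # Z?
      ... | yes le = inj₂ le
      ... | no nle with # Z? ℕ.≤? # X?
      ... | yes le = inj₁ (full-if-small le)
      ... | no nle′ = inj₁ (OneMore.full (ℕ.≤-antisym (ℕ.≤-pred (subst (suc (# Z?) ℕ.≤_) (ℕ.+-comm (# X?) 2) (ℕ.≰⇒> nle))) (ℕ.≰⇒> nle′)))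

    #-coset : ∀ {z} → z ≢ 0# → # (λ y → P? (inv z * y)) ≡ t
    #-coset {z} z≢0 = sym (#-permute P? (scale (inv z) (inv≢0 z≢0)))

    -- An invariant set of nonzero elements is a union of cosets of P.
    t∣# : ∀ b {X : Fin q → Set} (X? : ∀ z → Dec (X z)) → Invariant X → ¬ X 0# → # X? ℕ.≤ b → t ∣ # X?
    t∣# b {X} X? inv-X ¬X0 le with Fin.any? X?
    ... | no none = subst (t ∣_) (sym (ℕΣ.sum-zero (λ z → ι-no (X? z) (λ x → none (z , x))))) (t ∣0)
    t∣# zero X? inv-X ¬X0 le | yes (z , xz) = ⊥-elim (ℕ.<⇒≱ (ℕ.≤-trans (ℕ.≤-reflexive (sym (ι-yes (X? z) xz))) (sum≥term _ z)) le)
    t∣# (suc b) {X} X? inv-X ¬X0 le | yes (z , xz) = subst (t ∣_) (sym #X≡) (∣m∣n⇒∣m+n ∣-refl (t∣# b Y? inv-Y (λ y0 → ¬X0 (proj₁ y0)) le′))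
      where
      z≢0 : z ≢ 0#
      z≢0 refl = ¬X0 xz
      C? : ∀ y → Dec (P (inv z * y))
      C? y = P? (inv z * y)
      Y : Fin q → Set
      Y y = X y × ¬ P (inv z * y)
      Y? : ∀ y → Dec (Y y)
      Y? y = X? y ×-dec ¬? (C? y)
      inv-Y : Invariant Y
      inv-Y {y} {a} pa (xy , ¬c) = inv-X pa xy , λ c → ¬c (subst P (begin
        inv z * (y * a) * inv a     ≡⟨ solve 4 (λ i y a b → i :* (y :* a) :* b := i :* y :* (a :* b)) refl (inv z) y a (inv a) ⟩
        inv z * y * (a * inv a)     ≡⟨ cong (inv z * y *_) (inv-r (P-≢0 pa)) ⟩
        inv z * y * 1#              ≡⟨ *-identityʳ _ ⟩
        inv z * y                   ∎) (P-* c (P-inv pa)))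
      #X≡ : # X? ≡ t ℕ.+ # Y?
      #X≡ = trans (ℕ.≤-antisym
        (#-⊎ C? Y? X? (λ y xy → split y xy))
        (#-disjoint C? Y? X? (λ y c → subst X (*-cancel-inv y z≢0) (inv-X c xz)) (λ _ → proj₁) (λ _ c (_ , ¬c) → ¬c c)))
        (cong (ℕ._+ # Y?) (#-coset z≢0))
        where
        split : ∀ y → X y → P (inv z * y) ⊎ Y y
        split y xy with C? y
        ... | yes c = inj₁ c
        ... | no ¬c = inj₂ (xy , ¬c)
      le′ : # Y? ℕ.≤ b
      le′ = ℕ.≤-pred (ℕ.≤-trans (ℕ.+-monoˡ-≤ (# Y?) 1≤t) (ℕ.≤-trans (ℕ.≤-reflexive (sym #X≡)) le))

    E* : ℕ → Fin q → Set
    E* m z = z ≢ 0# × E m z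

    E*? : ∀ m z → Dec (E* m z)
    E*? m z = nonzero? z ×-dec E? m z

    t∣#E* : ∀ m → t ∣ # (E*? m)
    t∣#E* m = t∣# (# (E*? m)) (E*? m) (λ pa (z≢0 , e) → *-≢0 z≢0 (P-≢0 pa) , E-invariant m pa e) (λ (z≢0 , _) → z≢0 refl) ℕ.≤-refl

    E-nonempty : ∀ m → ∃ (E m)
    E-nonempty zero = 0# , refl
    E-nonempty (suc m) with E-nonempty m
    ... | z , e = z + pow 1# k , 1# , 1≢0 , subst (E m) (solve 2 (λ z p → z := z :+ p :- p) refl z (pow 1# k)) e

    full-suc : ∀ m → (∀ z → E m z) → ∀ z → E (suc m) z
    full-suc m full z = 1# , 1≢0 , full _

    -- One new element would not suffice, as it might be 0. Two new elements leave strictly more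
    -- nonzero ones than the multiple of t reached before, and divisibility by t rounds this up to
    -- the next multiple.
    E-size : ∀ m → (∀ z → E (suc m) z) ⊎ (suc m ℕ.* t ℕ.≤ # (E*? (suc m)))
    E-size zero = inj₂ (ℕ.≤-trans (ℕ.≤-reflexive (ℕ.+-identityʳ t)) (#-mono P? (E*? 1) (λ z pz → P-≢0 pz , P⇒E1 pz)))
    E-size (suc m) with E-size m
    ... | inj₁ full = inj₁ (full-suc (suc m) full)
    ... | inj₂ le with Growth.growth (E? (suc m)) (E-invariant (suc m)) (E-nonempty (suc m))
    ... | inj₁ full = inj₁ full
    ... | inj₂ grow = inj₂ (round-up {suc m} (t∣#E* (suc (suc m))) (ℕ.≤-trans (ℕ.s≤s (ℕ.≤-trans le (#-mono (E*? (suc m)) (E? (suc m)) (λ _ → proj₂)))) (ℕ.≤-pred strict)))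
      where
      split : ∀ m z → E m z → z ≡ 0# ⊎ E* m z
      split m z e with z Fin.≟ 0#
      ... | yes z≡0 = inj₁ z≡0
      ... | no z≢0 = inj₂ (z≢0 , e)
      strict : suc (suc (# (E? (suc m)))) ℕ.≤ suc (# (E*? (suc (suc m))))
      strict = ℕ.≤-trans (ℕ.≤-reflexive (ℕ.+-comm 2 _)) (ℕ.≤-trans grow (ℕ.≤-trans (#-⊎ (Fin._≟ 0#) (E*? (2 ℕ.+ m)) (E? (2 ℕ.+ m)) (split (2 ℕ.+ m))) (ℕ.≤-reflexive (cong (ℕ._+ # (E*? (2 ℕ.+ m))) (#-point 0#)))))
      round-up : ∀ {j b} → t ∣ b → suc (j ℕ.* t) ℕ.≤ b → suc j ℕ.* t ℕ.≤ b
      round-up {j} (divides c refl) lt = ℕ.*-monoˡ-≤ t (ℕ.*-cancelʳ-< t j c lt)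

    E-covers-nonzero : ∀ m → 1 ℕ.≤ m → D ℕ.≤ m → ∀ z → z ≢ 0# → E m z
    E-covers-nonzero (suc m) _ D≤m z z≢0 with E-size m
    ... | inj₁ full = full z
    ... | inj₂ le = proj₂ (#-≤⇒⊇ (E*? (suc m)) nonzero? (λ _ → proj₁) (ℕ.≤-trans (ℕ.≤-reflexive #nonzero≡Dt) (ℕ.≤-trans (ℕ.*-monoˡ-≤ t D≤m) le)) z z≢0)

    -- With a summand to spare, one power is subtracted first so that the remainder is not 0: 1
    -- serves unless z = 1, and then a₀ does.
    E-covers : ∀ m → D ℕ.< m → ∀ z → E m z
    E-covers (suc zero) (ℕ.s≤s D≤0) = ⊥-elim (ℕ.<⇒≱ 1≤D D≤0)
    E-covers (suc (suc m)) (ℕ.s≤s D≤m) z with z Fin.≟ 1#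
    ... | no z≢1 = 1# , 1≢0 , E-covers-nonzero (suc m) (ℕ.s≤s ℕ.z≤n) D≤m _ (λ e → z≢1 (trans (x-y≡0⇒x≡y e) (pow-1# k)))
    ... | yes refl = u , u≢0 , E-covers-nonzero (suc m) (ℕ.s≤s ℕ.z≤n) D≤m _ (λ e → a₀≢1 (sym (x-y≡0⇒x≡y e)))

    -- With d = D even, zero is a sum of d, d - 1 or d - 2 nonzero powers.  Otherwise all inequalities |E m \ 0| ≥ m t
    -- are sharp, so P + P is the union of P and one further coset wP.
    module ZeroTrace (n″ : ℕ) (D≡ : D ≡ 4 ℕ.+ n″ ℕ.+ n″)
      (¬E₀ : ¬ E (4 ℕ.+ n″ ℕ.+ n″) 0#) (¬E₁ : ¬ E (3 ℕ.+ n″ ℕ.+ n″) 0#) (¬E₂ : ¬ E (2 ℕ.+ n″ ℕ.+ n″) 0#) (3≤t : 3 ℕ.≤ t) where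

      d″ : ℕ
      d″ = 2 ℕ.+ n″ ℕ.+ n″

      ¬E20 : ¬ E 2 0#
      ¬E20 e = ¬E₀ (subst (λ m → E m 0#) (eq n″) (E-multiple 2 (2 ℕ.+ n″) e refl))
        where
        eq : ∀ j → (2 ℕ.+ j) ℕ.* 2 ≡ 4 ℕ.+ j ℕ.+ j
        eq = Sℕ.solve 1 (λ j → (Sℕ.con 2 Sℕ.:+ j) Sℕ.:* Sℕ.con 2 Sℕ.:= Sℕ.con 4 Sℕ.:+ j Sℕ.:+ j) refl
          where module Sℕ = +-*-Solver

      opposite : ∀ i j {z} → E i z → E j (- z) → E (i ℕ.+ j) 0#
      opposite i j {z} ei ej = subst (E (i ℕ.+ j)) (-‿inverseʳ z) (E-add i j ei ej)

      ¬P-1 : ¬ P (- 1#)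
      ¬P-1 p = ¬E20 (opposite 1 1 (P⇒E1 P-1) (P⇒E1 p))

      E₁₂ : Fin q → Set
      E₁₂ z = z ≢ 0# × (E 1 z ⊎ E 2 z)

      E₁₂? : ∀ z → Dec (E₁₂ z)
      E₁₂? z = nonzero? z ×-dec (E? 1 z ⊎-dec E? 2 z)

      -- If z were a sum of D - 2 powers and -z of one or two, 0 would be a sum of D - 1 or D
      -- powers. So -E₁₂ avoids `E* d″`, which takes up at least (D - 2) t of the D t nonzero
      -- elements.
      #E₁₂≤2t : # E₁₂? ℕ.≤ 2 ℕ.* t
      #E₁₂≤2t = ℕ.+-cancelˡ-≤ (d″ ℕ.* t) _ _ (ℕ.≤-trans (ℕ.+-monoˡ-≤ (# E₁₂?) big) (ℕ.≤-trans sum≤ (ℕ.≤-reflexive total)))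
        where
        big : d″ ℕ.* t ℕ.≤ # (E*? d″)
        big with E-size (suc (n″ ℕ.+ n″))
        ... | inj₁ full = ⊥-elim (¬E₂ (full 0#))
        ... | inj₂ le = le
        neg? : ∀ z → Dec (E₁₂ (0# - z))
        neg? z = E₁₂? (0# - z)
        0-z : ∀ z → 0# - z ≡ - z
        0-z z = +-identityˡ (- z)
        disjoint : ∀ z → E* d″ z → ¬ E₁₂ (0# - z)
        disjoint z (_ , e) (_ , inj₁ e₁) = ¬E₁ (subst (λ m → E m 0#) (ℕ.+-comm d″ 1) (opposite d″ 1 e (subst (E 1) (0-z z) e₁)))
        disjoint z (_ , e) (_ , inj₂ e₂) = ¬E₀ (subst (λ m → E m 0#) (ℕ.+-comm d″ 2) (opposite d″ 2 e (subst (E 2) (0-z z) e₂)))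
        sum≤ : # (E*? d″) ℕ.+ # E₁₂? ℕ.≤ # nonzero?
        sum≤ = subst (λ x → # (E*? d″) ℕ.+ x ℕ.≤ # nonzero?) (sym (#-permute E₁₂? (reflect 0#)))
          (#-disjoint (E*? d″) neg? nonzero? (λ _ → proj₁) (λ z (ne , _) z≡0 → ne (trans (cong (λ z → 0# - z) z≡0) (-‿inverseʳ 0#))) disjoint)
        total : # nonzero? ≡ d″ ℕ.* t ℕ.+ 2 ℕ.* t
        total = trans #nonzero≡Dt (trans (cong (ℕ._* t) (trans D≡ (ℕ.+-comm 2 d″))) (ℕ.*-distribʳ-+ t d″ 2))

      2t≤#E2 : 2 ℕ.* t ℕ.≤ # (E*? 2)
      2t≤#E2 with E-size 1
      ... | inj₁ full = ⊥-elim (¬E20 (full 0#))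
      ... | inj₂ le = le

      -- The nonzero sums of two powers alone account for 2t elements, which is all of `E₁₂`, so the
      -- power 1 is among them.
      E21 : E 2 1#
      E21 = proj₂ (#-≤⇒⊇ (E*? 2) E₁₂? (λ z (ne , e) → ne , inj₂ e) (ℕ.≤-trans #E₁₂≤2t 2t≤#E2) 1# (1≢0 , inj₁ (P⇒E1 P-1)))

      #E2≤2t : # (E*? 2) ℕ.≤ 2 ℕ.* t
      #E2≤2t = ℕ.≤-trans (#-mono (E*? 2) E₁₂? (λ z (ne , e) → ne , inj₂ e)) #E₁₂≤2t

      -- Because 1 is a sum of two powers, so is every power, and any summand may be split in two.
      E-suc : ∀ m {z} → E (suc m) z → E (suc (suc m)) z
      E-suc m {z} (x , x≢0 , e) = subst (E (2 ℕ.+ m)) (begin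
          1# * pow x k + (z - pow x k)   ≡⟨ cong (_+ (z - pow x k)) (*-identityˡ _) ⟩
          pow x k + (z - pow x k)        ≡⟨ solve 2 (λ p z → p :+ (z :- p) := z) refl (pow x k) z ⟩
          z                              ∎) (E-add 2 m (E-invariant 2 (P-pow x≢0) E21) e)

      ¬E30 : ¬ E 3 0#
      ¬E30 e = ¬E₀ (up (suc (n″ ℕ.+ n″)) e)
        where
        up : ∀ j → E 3 0# → E (3 ℕ.+ j) 0#
        up zero e = e
        up (suc j) e = subst (λ m → E m 0#) (sym (ℕ.+-suc 3 j)) (E-suc (2 ℕ.+ j) (up j e))

      second : ∃ λ w → E* 2 w × ¬ P w
      second with Fin.any? (λ w → E*? 2 w ×-dec ¬? (P? w))
      ... | yes r = r
      ... | no none = ⊥-elim (ℕ.<⇒≱ (ℕ.<-≤-trans (ℕ.+-monoʳ-< t (ℕ.≤-trans 1≤t (ℕ.≤-reflexive (sym (ℕ.+-identityʳ t))))) (ℕ.≤-trans 2t≤#E2 (#-mono (E*? 2) P? below))) (ℕ.≤-reflexive (sym (ℕ.+-identityʳ t))))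
        where
        below : ∀ z → E* 2 z → P z
        below z e with P? z
        ... | yes p = p
        ... | no ¬p = ⊥-elim (none (z , e , ¬p))

      w : Fin q
      w = proj₁ second

      w≢0 : w ≢ 0#
      w≢0 = proj₁ (proj₁ (proj₂ second))

      ¬Pw : ¬ P w
      ¬Pw = proj₂ (proj₂ second)

      ¬P-w : ¬ P (- w)
      ¬P-w p = ¬E30 (opposite 2 1 (proj₂ (proj₁ (proj₂ second))) (P⇒E1 p))

      wP : Fin q → Set
      wP z = P (inv w * z)

      wP? : ∀ z → Dec (wP z)
      wP? z = P? (inv w * z)

      P⇒¬wP : ∀ {z} → P z → ¬ wP z
      P⇒¬wP {z} pz c = ¬Pw (subst P (begin
        z * inv (inv w * z)               ≡⟨ *-cancelˡ (P-≢0 c) (trans (solve 3 (λ c z i → c :* (z :* i) := z :* (c :* i)) refl (inv w * z) z (inv (inv w * z)))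
                                              (trans (cong (z *_) (inv-r (P-≢0 c))) (trans (*-identityʳ z) (sym (trans (solve 3 (λ i z w → i :* z :* w := i :* w :* z) refl (inv w) z w) (trans (cong (_* z) (inv-l w≢0)) (*-identityˡ z))))))) ⟩
        w                                 ∎) (P-* pz (P-inv c)))

      E2⇒ : ∀ z → z ≢ 0# → E 2 z → P z ⊎ wP z
      E2⇒ z z≢0 e = #-≤⇒⊇ (λ z → P? z ⊎-dec wP? z) (E*? 2)
        (λ { z (inj₁ pz) → P-≢0 pz , subst (E 2) (*-identityˡ z) (E-invariant 2 pz E21)
           ; z (inj₂ c) → (λ z≡0 → P-≢0 c (trans (cong (inv w *_) z≡0) (zeroʳ _))) , subst (E 2) (*-cancel-inv z w≢0) (E-invariant 2 c (proj₂ (proj₁ (proj₂ second)))) })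
        (ℕ.≤-trans #E2≤2t (ℕ.≤-trans (ℕ.≤-reflexive (cong₂ ℕ._+_ refl (trans (ℕ.+-identityʳ t) (sym (#-coset w≢0)))))
          (#-disjoint P? wP? _ (λ _ → inj₁) (λ _ → inj₂) (λ _ → P⇒¬wP)))) z (z≢0 , e)

      absurd : ⊥
      absurd = SharpSumset.absurd G P P? P-1 P-* P-≢0 P-inv ¬P-1 w w≢0 ¬Pw ¬P-w sumset 3≤t
        where
        sumset : ∀ {y z} → P y → P z → P (y + z) ⊎ P (inv w * (y + z))
        sumset {y} {z} py pz = E2⇒ (y + z) (λ e → ¬E20 (subst (E 2) e sum)) sum
          where
          sum : E 2 (y + z)
          sum = E-add 1 1 (P⇒E1 py) (P⇒E1 pz)

-- The trace as a sum over two diagonals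

module TraceSplitting {q : ℕ} (G : FiniteField q) (k : ℕ) (1≤k : 1 ℕ.≤ k) (gen : ∀ x → FieldOps.SumOfPowers (FiniteField.asField G) k x) where
  open Arithmetic G
  open PowerSums G k 1≤k
  open ≡-Reasoning

  Split : ℕ → Fin q → Set
  Split n τ = ∃₂ λ (x y : Fin n → Fin q) → AtMostOneZero x × AtMostOneZero y × FΣ.sum (λ i → pow (x i) k + pow (y i) k) ≡ τ

  TwoPower : Fin q → Set
  TwoPower c = ∃₂ λ x y → pow x k + pow y k ≡ c

  noZero : ∀ {n} {x : Fin n → Fin q} → (∀ i → x i ≢ 0#) → AtMostOneZero x
  noZero x≢0 i j e _ = ⊥-elim (x≢0 i e)

  pad : ∀ {n} → (Fin n → Fin q) → Fin (suc n) → Fin q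
  pad v zero = 0#
  pad v (suc i) = v i

  pad-one : ∀ {n} {v : Fin n → Fin q} → (∀ i → v i ≢ 0#) → AtMostOneZero (pad v)
  pad-one v≢0 zero zero _ _ = refl
  pad-one v≢0 (suc i) _ e _ = ⊥-elim (v≢0 i e)
  pad-one v≢0 zero (suc j) _ e = ⊥-elim (v≢0 j e)

  pad-sum : ∀ {n} (v : Fin n → Fin q) → FΣ.sum (λ i → pow (pad v i) k) ≡ FΣ.sum (λ i → pow (v i) k)
  pad-sum v = trans (FΣ.sum-suc _) (trans (cong (_+ FΣ.sum (λ i → pow (v i) k)) (pow-0# 1≤k)) (+-identityˡ _))

  E⇒Split : ∀ n {τ} → E (n ℕ.+ n) τ → Split n τ
  E⇒Split n e with E-split n n e
  ... | z₁ , z₂ , e₁ , e₂ , eq with E⇒vector n e₁ | E⇒vector n e₂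
  ... | x , x≢0 , ex | y , y≢0 , ey = x , y , noZero x≢0 , noZero y≢0 , trans (FΣ.sum-+ _ _) (trans (cong₂ _+_ ex ey) eq)

  E⇒Split₁ : ∀ n {τ} → E (n ℕ.+ suc n) τ → Split (suc n) τ
  E⇒Split₁ n e with E-split n (suc n) e
  ... | z₁ , z₂ , e₁ , e₂ , eq with E⇒vector n e₁ | E⇒vector (suc n) e₂
  ... | x , x≢0 , ex | y , y≢0 , ey = pad x , y , pad-one x≢0 , noZero y≢0 , trans (FΣ.sum-+ _ _) (trans (cong₂ _+_ (trans (pad-sum x) ex) ey) eq)

  E⇒Split₂ : ∀ n {τ} → E (n ℕ.+ n) τ → Split (suc n) τ
  E⇒Split₂ n e with E-split n n e
  ... | z₁ , z₂ , e₁ , e₂ , eq with E⇒vector n e₁ | E⇒vector n e₂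
  ... | x , x≢0 , ex | y , y≢0 , ey = pad x , pad y , pad-one x≢0 , pad-one y≢0 , trans (FΣ.sum-+ _ _) (trans (cong₂ _+_ (trans (pad-sum x) ex) (trans (pad-sum y) ey)) eq)

  -- The growth argument needs a power whose square is not 1. It is missing exactly if P ⊆ {1, -1},
  -- so for t ≥ 3 it exists.
  NonInvolution : Set
  NonInvolution = ∃ λ u → u ≢ 0# × pow u k * pow u k ≢ 1#

  nonInvolution? : Dec NonInvolution
  nonInvolution? = Fin.any? (λ u → nonzero? u ×-dec ¬? (pow u k * pow u k Fin.≟ 1#))

  involutions⇒t≤2 : ¬ NonInvolution → t ℕ.≤ 2
  involutions⇒t≤2 none = ℕ.≤-trans (#-mono P? (λ z → pow z 2 Fin.≟ 1#) lem) (#pow≡1≤ (ℕ.s≤s ℕ.z≤n))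
    where
    lem : ∀ z → P z → pow z 2 ≡ 1#
    lem z (x , x≢0 , refl) with pow x k * pow x k Fin.≟ 1#
    ... | yes e = trans (cong (pow x k *_) (*-identityʳ _)) e
    ... | no ne = ⊥-elim (none (x , x≢0 , ne))

  module Large (nonInvolution : NonInvolution) where
    open Generated gen (proj₁ nonInvolution) (proj₁ (proj₂ nonInvolution)) (proj₂ (proj₂ nonInvolution))

    split-strict : ∀ n → D ℕ.< n ℕ.+ n → ∀ τ → Split n τ
    split-strict n D<2n τ = E⇒Split n (E-covers (n ℕ.+ n) D<2n τ)

    split : ∀ n → 2 ℕ.≤ n → 3 ℕ.≤ t → D ℕ.≤ n ℕ.+ n → ∀ τ → Split n τ
    split (suc zero) (ℕ.s≤s ())
    split n@(suc n′@(suc n″)) _ 3≤t D≤2n τ with D ℕ.<? n ℕ.+ n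
    ... | yes D<2n = split-strict n D<2n τ
    ... | no D≮2n with τ Fin.≟ 0#
    ... | no τ≢0 = E⇒Split n (E-covers-nonzero (n ℕ.+ n) (ℕ.s≤s ℕ.z≤n) D≤2n τ τ≢0)
    -- Each diagonal admits one zero, so 2n, 2n - 1 or 2n - 2 nonzero summands serve equally well.
    ... | yes refl with E? (n ℕ.+ n) 0# | E? (n′ ℕ.+ n) 0# | E? (n′ ℕ.+ n′) 0#
    ... | yes e | _ | _ = E⇒Split n e
    ... | no _ | yes e | _ = E⇒Split₁ n′ e
    ... | no _ | no _ | yes e = E⇒Split₂ n′ e
    ... | no ¬e₀ | no ¬e₁ | no ¬e₂ = ⊥-elim (ZeroTrace.absurd n″ (trans (ℕ.≤-antisym D≤2n (ℕ.≮⇒≥ D≮2n)) eq₀)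
          (subst (λ m → ¬ E m 0#) eq₀ ¬e₀) (subst (λ m → ¬ E m 0#) eq₁ ¬e₁) (subst (λ m → ¬ E m 0#) eq₂ ¬e₂) 3≤t)
      where
      eq₂ : n′ ℕ.+ n′ ≡ 2 ℕ.+ n″ ℕ.+ n″
      eq₂ = cong suc (ℕ.+-suc n″ n″)
      eq₁ : n′ ℕ.+ n ≡ 3 ℕ.+ n″ ℕ.+ n″
      eq₁ = trans (ℕ.+-suc n′ n′) (cong suc eq₂)
      eq₀ : n ℕ.+ n ≡ 4 ℕ.+ n″ ℕ.+ n″
      eq₀ = cong suc eq₁

    twoPower : D ℕ.≤ 2 → ∀ c → TwoPower c
    twoPower D≤2 c with c Fin.≟ 0#
    ... | yes refl = 0# , 0# , trans (cong₂ _+_ (pow-0# 1≤k) (pow-0# 1≤k)) (+-identityˡ 0#)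
    ... | no c≢0 with E-covers-nonzero 2 (ℕ.s≤s ℕ.z≤n) D≤2 c c≢0
    ... | x , _ , y , _ , e = x , y , sym (begin
        c                                                 ≡⟨ solve 3 (λ c p r → c := (c :- p :- r) :+ (p :+ r)) refl c (pow x k) (pow y k) ⟩
        (c - pow x k - pow y k) + (pow x k + pow y k)     ≡⟨ cong (_+ (pow x k + pow y k)) e ⟩
        0# + (pow x k + pow y k)                          ≡⟨ +-identityˡ _ ⟩
        pow x k + pow y k                                 ∎)

  -- Here P = {1, -1} and t = 2. As F consists of sums of signs, it is the prime field with q = 2D +
  -- 1 elements, and splitting the trace amounts to counting signs.
  module PlusMinusOne (none : ¬ NonInvolution) (2≤t : 2 ℕ.≤ t) where
    P⇒±1 : ∀ {z} → P z → z ≡ 1# ⊎ z ≡ - 1#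
    P⇒±1 {z} (x , x≢0 , refl) with pow x k * pow x k Fin.≟ 1# | pow x k Fin.≟ 1#
    ... | no ne | _ = ⊥-elim (none (x , x≢0 , ne))
    ... | yes _ | yes e = inj₁ e
    ... | yes e | no ne = inj₂ (x-y≡0⇒x≡y (*-cancelˡ (λ e → ne (x-y≡0⇒x≡y e)) (begin
      (pow x k - 1#) * (pow x k - - 1#)   ≡⟨ solve 2 (λ p o → (p :- o) :* (p :- (:- o)) := p :* p :- o :* o) refl (pow x k) 1# ⟩
      pow x k * pow x k - 1# * 1#         ≡⟨ x≡y⇒x-y≡0 (trans e (sym (*-identityˡ 1#))) ⟩
      0#                                  ≡⟨ zeroʳ _ ⟨
      (pow x k - 1#) * 0#                 ∎)))

    other : ∃ λ z → P z × z ≢ 1#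
    other with Fin.any? (λ z → P? z ×-dec ¬? (z Fin.≟ 1#))
    ... | yes r = r
    ... | no no-other = ⊥-elim (ℕ.<⇒≱ 2≤t (ℕ.≤-trans (#-mono P? (Fin._≟ 1#) lem) (ℕ.≤-reflexive (#-point 1#))))
      where
      lem : ∀ z → P z → z ≡ 1#
      lem z pz with z Fin.≟ 1#
      ... | yes e = e
      ... | no ne = ⊥-elim (no-other (z , pz , ne))

    P-1# : P (- 1#) × - 1# ≢ 1#
    P-1# with P⇒±1 (proj₁ (proj₂ other))
    ... | inj₁ e = ⊥-elim (proj₂ (proj₂ other) e)
    ... | inj₂ e = subst P e (proj₁ (proj₂ other)) , (λ e′ → proj₂ (proj₂ other) (trans e e′))

    q≡ : q ≡ suc (D ℕ.* t)
    q≡ = trans (sym #nonzero) (cong suc #nonzero≡Dt)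

    nat-neg1 : nat (D ℕ.* t) ≡ - 1#
    nat-neg1 = x-y≡0⇒x≡y (trans (solve 2 (λ n o → n :- (:- o) := o :+ n) refl (nat (D ℕ.* t)) 1#) (trans (cong nat (sym q≡)) nat-q))

    natural : ∀ {x} → SumOfPowers k x → ∃ λ j → x ≡ nat j
    natural (empty e) = 0 , e
    natural (step {x} {y} z s e) with natural s | z Fin.≟ 0#
    ... | j , refl | yes refl = j , trans e (trans (cong (nat j +_) (pow-0# 1≤k)) (+-identityʳ _))
    ... | j , refl | no z≢0 with P⇒±1 (P-pow z≢0)
    ... | inj₁ p = 1 ℕ.+ j , trans e (trans (cong (nat j +_) p) (+-comm _ _))
    ... | inj₂ p = D ℕ.* t ℕ.+ j , trans e (trans (cong (nat j +_) p) (trans (+-comm _ _) (trans (cong (_+ nat j) (sym nat-neg1)) (sym (nat-+ (D ℕ.* t) j)))))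

    signed : ∀ x → ∃ λ j → j ℕ.≤ D × (x ≡ nat j ⊎ x ≡ - nat j)
    signed x with natural (gen x)
    ... | j₀ , refl = go (j₀ % suc (D ℕ.* t)) (m%n<n j₀ (suc (D ℕ.* t))) reduced
      where
      nat-q′ : nat (suc (D ℕ.* t)) ≡ 0#
      nat-q′ = trans (cong nat (sym q≡)) nat-q
      reduced : nat j₀ ≡ nat (j₀ % suc (D ℕ.* t))
      reduced = begin
        nat j₀                                                                                  ≡⟨ cong nat (m≡m%n+[m/n]*n j₀ (suc (D ℕ.* t))) ⟩
        nat (j₀ % suc (D ℕ.* t) ℕ.+ j₀ / suc (D ℕ.* t) ℕ.* suc (D ℕ.* t))                       ≡⟨ nat-+ (j₀ % suc (D ℕ.* t)) (j₀ / suc (D ℕ.* t) ℕ.* suc (D ℕ.* t)) ⟩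
        nat (j₀ % suc (D ℕ.* t)) + nat (j₀ / suc (D ℕ.* t) ℕ.* suc (D ℕ.* t))                   ≡⟨ cong (nat (j₀ % suc (D ℕ.* t)) +_) (trans (nat-* (j₀ / suc (D ℕ.* t)) (suc (D ℕ.* t))) (trans (cong (nat (j₀ / suc (D ℕ.* t)) *_) nat-q′) (zeroʳ _))) ⟩
        nat (j₀ % suc (D ℕ.* t)) + 0#                                                           ≡⟨ +-identityʳ _ ⟩
        nat (j₀ % suc (D ℕ.* t))                                                                ∎
      go : ∀ j → j ℕ.< suc (D ℕ.* t) → nat j₀ ≡ nat j → ∃ λ j → j ℕ.≤ D × (nat j₀ ≡ nat j ⊎ nat j₀ ≡ - nat j)
      go j j<q e with j ℕ.≤? D
      ... | yes j≤D = j , j≤D , inj₁ e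
      -- Since q = D t + 1 with t ≤ 2, for j > D the complement q - j is at most D t - D ≤ D.
      ... | no j≰D = suc (D ℕ.* t) ℕ.∸ j , small , inj₂ (trans e (x-y≡0⇒x≡y (trans (solve 2 (λ a b → a :- (:- b) := a :+ b) refl (nat j) (nat (suc (D ℕ.* t) ℕ.∸ j)))
             (trans (sym (nat-+ j (suc (D ℕ.* t) ℕ.∸ j))) (trans (cong nat (ℕ.m+[n∸m]≡n (ℕ.<⇒≤ j<q))) nat-q′)))))
        where
        small : suc (D ℕ.* t) ℕ.∸ j ℕ.≤ D
        small = ℕ.≤-trans (ℕ.∸-monoʳ-≤ (suc (D ℕ.* t)) (ℕ.≰⇒> j≰D)) (ℕ.≤-trans (ℕ.∸-monoˡ-≤ D (ℕ.*-monoʳ-≤ D (involutions⇒t≤2 none)))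
          (ℕ.≤-reflexive (trans (cong (ℕ._∸ D) (ℕ.*-comm D 2)) (trans (ℕ.m+n∸m≡n D (D ℕ.+ 0)) (ℕ.+-identityʳ D)))))

    2≢0 : 1# + 1# ≢ 0#
    2≢0 e = proj₂ P-1# (sym (x-y≡0⇒x≡y (trans (solve 1 (λ o → o :- (:- o) := o :+ o) refl 1#) e)))

    E-repeat : ∀ j {v} → E 2 v → E (j ℕ.* 2) (nat j * v)
    E-repeat zero e = zeroˡ _
    E-repeat (suc j) {v} e = subst (E (2 ℕ.+ j ℕ.* 2)) (sym (trans (distribʳ v 1# (nat j)) (cong (_+ nat j * v) (*-identityˡ v)))) (E-add 2 (j ℕ.* 2) e (E-repeat j e))

    E-exact : ∀ n j {v} → j ℕ.≤ n → E 2 v → E (n ℕ.+ n) (nat j * v)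
    E-exact n j {v} j≤n e = subst₂ E size (+-identityʳ _) (E-add (j ℕ.* 2) ((n ℕ.∸ j) ℕ.* 2) (E-repeat j e) (E-multiple 2 (n ℕ.∸ j) E20 refl))
      where
      E20 : E 2 0#
      E20 = subst (E 2) (-‿inverseʳ 1#) (E-add 1 1 (P⇒E1 P-1) (P⇒E1 (proj₁ P-1#)))
      size : j ℕ.* 2 ℕ.+ (n ℕ.∸ j) ℕ.* 2 ≡ n ℕ.+ n
      size = trans (sym (ℕ.*-distribʳ-+ 2 j (n ℕ.∸ j))) (trans (cong (ℕ._* 2) (ℕ.m+[n∸m]≡n j≤n)) (trans (ℕ.*-comm n 2) (cong (n ℕ.+_) (ℕ.+-identityʳ n))))

    -- A sum of 2n signs is an even integer between -2n and 2n, so τ is halved first. Then τ/2 = ±j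
    -- with j ≤ D ≤ n; j pairs of equal signs give τ, and the other n - j pairs cancel.
    split : ∀ n → D ℕ.≤ n → ∀ τ → Split n τ
    split n D≤n τ with signed (τ * inv (1# + 1#))
    ... | j , j≤D , sign = E⇒Split n (value sign)
      where
      undo : τ * inv (1# + 1#) * (1# + 1#) ≡ τ
      undo = trans (*-assoc _ _ _) (trans (cong (τ *_) (inv-l 2≢0)) (*-identityʳ τ))
      value : τ * inv (1# + 1#) ≡ nat j ⊎ τ * inv (1# + 1#) ≡ - nat j → E (n ℕ.+ n) τ
      value (inj₁ e) = subst (E (n ℕ.+ n)) (trans (cong (_* (1# + 1#)) (sym e)) undo)
        (E-exact n j (ℕ.≤-trans j≤D D≤n) (E-add 1 1 (P⇒E1 P-1) (P⇒E1 P-1)))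
      value (inj₂ e) = subst (E (n ℕ.+ n)) (trans (solve 2 (λ j o → j :* ((:- o) :+ (:- o)) := (:- j) :* (o :+ o)) refl (nat j) 1#) (trans (cong (_* (1# + 1#)) (sym e)) undo))
        (E-exact n j (ℕ.≤-trans j≤D D≤n) (E-add 1 1 (P⇒E1 (proj₁ P-1#)) (P⇒E1 (proj₁ P-1#))))

    twoPower : D ℕ.≤ 2 → ∀ c → TwoPower c
    twoPower D≤2 c with signed c
    ... | j , j≤D , sign = go j (ℕ.≤-trans j≤D D≤2) sign
      where
      p0 : pow 0# k ≡ 0#
      p0 = pow-0# 1≤k
      -1-root : ∃ λ x → pow x k ≡ - 1#
      -1-root = proj₁ (proj₁ P-1#) , proj₂ (proj₂ (proj₁ P-1#))
      go : ∀ j → j ℕ.≤ 2 → c ≡ nat j ⊎ c ≡ - nat j → TwoPower c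
      go 0 _ (inj₁ e) = 0# , 0# , trans (cong₂ _+_ p0 p0) (trans (+-identityˡ 0#) (sym e))
      go 0 _ (inj₂ e) = 0# , 0# , trans (cong₂ _+_ p0 p0) (trans (+-identityˡ 0#) (sym (trans e -0#≡0#)))
      go 1 _ (inj₁ e) = 1# , 0# , trans (cong₂ _+_ (pow-1# k) p0) (sym e)
      go 1 _ (inj₂ e) = proj₁ -1-root , 0# , trans (cong₂ _+_ (proj₂ -1-root) p0) (trans (+-identityʳ _) (sym (trans e (cong -_ (+-identityʳ 1#)))))
      go 2 _ (inj₁ e) = 1# , 1# , trans (cong₂ _+_ (pow-1# k) (pow-1# k)) (sym (trans e (cong (1# +_) (+-identityʳ 1#))))
      go 2 _ (inj₂ e) = proj₁ -1-root , proj₁ -1-root , trans (cong₂ _+_ (proj₂ -1-root) (proj₂ -1-root))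
        (sym (trans e (trans (cong -_ (cong (1# +_) (+-identityʳ 1#))) (solve 1 (λ o → :- (o :+ o) := (:- o) :+ (:- o)) refl 1#))))
      go (suc (suc (suc _))) (ℕ.s≤s (ℕ.s≤s ())) _

-- Triangular matrices and prescribed diagonals

module Matrices {q : ℕ} (G : FiniteField q) where
  open Arithmetic G
  open FΣ
  open ≡-Reasoning

  I-suc : ∀ {n} (i j : Fin n) → I (suc i) (suc j) ≡ I i j
  I-suc i j with i Fin.≟ j
  ... | yes _ = refl
  ... | no _ = refl

  sum-I : ∀ {n} (i : Fin n) (g : Fin n → Fin q) → sum (λ m → I i m * g m) ≡ g i
  sum-I i g = trans (sum-single _ i (λ m ne → trans (cong (_* g m) (I-off (λ e → ne (sym e)))) (zeroˡ _))) (trans (cong (_* g i) (I-diag i)) (*-identityˡ _))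

  sum-Iʳ : ∀ {n} (j : Fin n) (g : Fin n → Fin q) → sum (λ m → g m * I m j) ≡ g j
  sum-Iʳ j g = trans (sum-single _ j (λ m ne → trans (cong (g m *_) (I-off ne)) (zeroʳ _))) (trans (cong (g j *_) (I-diag j)) (*-identityʳ _))

  mul : ∀ {n} → Mat n → Mat n → Mat n
  mul A B i j = sum (λ m → A i m * B m j)

  mp : ∀ {n} → Mat n → ℕ → Mat n
  mp A zero = I
  mp A (suc k) = mul A (mp A k)

  mpow≡mp : ∀ {n} (A : Mat n) k → mpow A k ≋ mp A k
  mpow≡mp A zero i j = refl
  mpow≡mp A (suc k) i j = trans (∑≡sum (λ m → A i m * mpow A k m j)) (sum-cong (λ m → cong (A i m *_) (mpow≡mp A k m j)))

  mul-cong : ∀ {n} {A A′ B B′ : Mat n} → A ≋ A′ → B ≋ B′ → mul A B ≋ mul A′ B′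
  mul-cong a b i j = sum-cong (λ m → cong₂ _*_ (a i m) (b m j))

  mul-assoc : ∀ {n} (A B C : Mat n) → mul (mul A B) C ≋ mul A (mul B C)
  mul-assoc A B C i j = begin
    sum (λ m → sum (λ l → A i l * B l m) * C m j)     ≡⟨ sum-cong (λ m → sum-* (C m j) _) ⟩
    sum (λ m → sum (λ l → A i l * B l m * C m j))     ≡⟨ sum-swap _ ⟩
    sum (λ l → sum (λ m → A i l * B l m * C m j))     ≡⟨ sum-cong (λ l → trans (sum-cong (λ m → *-assoc _ _ _)) (sym (*-sum (A i l) _))) ⟩
    sum (λ l → A i l * sum (λ m → B l m * C m j))     ∎

  mul-Iˡ : ∀ {n} (A : Mat n) → mul I A ≋ A
  mul-Iˡ A i j = sum-I i (λ m → A m j)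

  mul-Iʳ : ∀ {n} (A : Mat n) → mul A I ≋ A
  mul-Iʳ A i j = sum-Iʳ j (A i)

  mul-⊕ʳ : ∀ {n} (A B C : Mat n) → mul (A ⊕ B) C ≋ (mul A C ⊕ mul B C)
  mul-⊕ʳ A B C i j = trans (sum-cong (λ m → distribʳ _ _ _)) (sum-+ _ _)

  mul-⊕ˡ : ∀ {n} (C A B : Mat n) → mul C (A ⊕ B) ≋ (mul C A ⊕ mul C B)
  mul-⊕ˡ C A B i j = trans (sum-cong (λ m → distribˡ _ _ _)) (sum-+ _ _)

  mp-comm : ∀ {n} (A : Mat n) k → mul (mp A k) A ≋ mul A (mp A k)
  mp-comm A zero i j = trans (mul-Iˡ A i j) (sym (mul-Iʳ A i j))
  mp-comm A (suc k) i j = trans (mul-assoc A (mp A k) A i j) (mul-cong {A = A} (λ _ _ → refl) (mp-comm A k) i j)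

  _ᵀ : ∀ {n} → Mat n → Mat n
  (A ᵀ) i j = A j i

  I-sym : ∀ {n} (i j : Fin n) → I i j ≡ I j i
  I-sym i j with i Fin.≟ j
  ... | yes refl = sym (I-diag i)
  ... | no ne = sym (I-off (λ e → ne (sym e)))

  mp-ᵀ : ∀ {n} (A : Mat n) k → mp (A ᵀ) k ≋ ((mp A k) ᵀ)
  mp-ᵀ A zero i j = I-sym i j
  mp-ᵀ A (suc k) i j = trans (sum-cong (λ m → trans (cong (A m i *_) (mp-ᵀ A k m j)) (*-comm _ _))) (mp-comm A k j i)

  trace : ∀ {n} → Mat n → Fin q
  trace A = sum (λ i → A i i)

  trace-mul : ∀ {n} (A B : Mat n) → trace (mul A B) ≡ trace (mul B A)
  trace-mul A B = trans (sum-swap _) (sum-cong (λ m → sum-cong (λ i → *-comm _ _)))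

  record Similar {n : ℕ} (M N : Mat n) : Set where
    field
      S T : Mat n
      ST  : mul S T ≋ I
      TS  : mul T S ≋ I
      N≋  : N ≋ mul (mul S M) T

  similar-trace : ∀ {n} {M N : Mat n} → Similar M N → trace N ≡ trace M
  similar-trace {M = M} {N} sim = begin
    trace N                        ≡⟨ sum-cong (λ i → N≋ i i) ⟩
    trace (mul (mul S M) T)        ≡⟨ trace-mul (mul S M) T ⟩
    trace (mul T (mul S M))        ≡⟨ sum-cong (λ i → trans (sym (mul-assoc T S M i i)) (trans (mul-cong {B = M} TS (λ _ _ → refl) i i) (mul-Iˡ M i i))) ⟩
    trace M                        ∎
    where open Similar sim

  similar-refl : ∀ {n} (M : Mat n) → Similar M M
  similar-refl M = record { S = I ; T = I ; ST = mul-Iˡ I ; TS = mul-Iˡ I ; N≋ = λ i j → sym (trans (mul-Iʳ (mul I M) i j) (mul-Iˡ M i j)) }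

  similar-trans : ∀ {n} {M N O : Mat n} → Similar M N → Similar N O → Similar M O
  similar-trans {M = M} {N} {O} s₁ s₂ = record
    { S = mul B.S A.S ; T = mul A.T B.T
    ; ST = cancel B.S A.S A.T B.T A.ST B.ST
    ; TS = cancel A.T B.T B.S A.S B.TS A.TS
    ; N≋ = λ i j → begin
        O i j                                                  ≡⟨ B.N≋ i j ⟩
        mul (mul B.S N) B.T i j                                ≡⟨ mul-cong {B = B.T} (λ i j → trans (mul-cong {A = B.S} (λ _ _ → refl) A.N≋ i j) (sym (mul-assoc B.S (mul A.S M) A.T i j))) (λ _ _ → refl) i j ⟩
        mul (mul (mul B.S (mul A.S M)) A.T) B.T i j            ≡⟨ mul-assoc (mul B.S (mul A.S M)) A.T B.T i j ⟩
        mul (mul B.S (mul A.S M)) (mul A.T B.T) i j            ≡⟨ mul-cong {B = mul A.T B.T} (λ i j → sym (mul-assoc B.S A.S M i j)) (λ _ _ → refl) i j ⟩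
        mul (mul (mul B.S A.S) M) (mul A.T B.T) i j            ∎ }
    where
    module A = Similar s₁
    module B = Similar s₂
    cancel : ∀ {n} (W X Y Z : Mat n) → mul X Y ≋ I → mul W Z ≋ I → mul (mul W X) (mul Y Z) ≋ I
    cancel W X Y Z xy wz i j = begin
      mul (mul W X) (mul Y Z) i j   ≡⟨ mul-assoc W X (mul Y Z) i j ⟩
      mul W (mul X (mul Y Z)) i j   ≡⟨ mul-cong {A = W} (λ _ _ → refl) (λ i j → trans (sym (mul-assoc X Y Z i j)) (trans (mul-cong {B = Z} xy (λ _ _ → refl) i j) (mul-Iˡ Z i j))) i j ⟩
      mul W Z i j                   ≡⟨ wz i j ⟩
      I i j                         ∎

  module Sums (k : ℕ) where
    SumOfTwo : ∀ {n} → Mat n → Set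
    SumOfTwo {n} M = ∃₂ λ (A B : Mat n) → M ≋ (mp A k ⊕ mp B k)

    conjugate-mp : ∀ {n} (S T A : Mat n) → mul S T ≋ I → mul T S ≋ I → ∀ k → mp (mul (mul T A) S) k ≋ mul (mul T (mp A k)) S
    conjugate-mp S T A st ts zero i j = sym (trans (mul-cong {B = S} (mul-Iʳ T) (λ _ _ → refl) i j) (ts i j))
    conjugate-mp S T A st ts (suc k) i j = begin
      mul (mul (mul T A) S) (mp (mul (mul T A) S) k) i j      ≡⟨ mul-cong {A = mul (mul T A) S} (λ _ _ → refl) (conjugate-mp S T A st ts k) i j ⟩
      mul (mul (mul T A) S) (mul (mul T (mp A k)) S) i j      ≡⟨ sym (mul-assoc (mul (mul T A) S) (mul T (mp A k)) S i j) ⟩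
      mul (mul (mul (mul T A) S) (mul T (mp A k))) S i j      ≡⟨ mul-cong {B = S} middle (λ _ _ → refl) i j ⟩
      mul (mul T (mul A (mp A k))) S i j                      ∎
      where
      middle : mul (mul (mul T A) S) (mul T (mp A k)) ≋ mul T (mul A (mp A k))
      middle i j = begin
        mul (mul (mul T A) S) (mul T (mp A k)) i j    ≡⟨ mul-assoc (mul T A) S (mul T (mp A k)) i j ⟩
        mul (mul T A) (mul S (mul T (mp A k))) i j    ≡⟨ mul-cong {A = mul T A} (λ _ _ → refl) (λ i j → trans (sym (mul-assoc S T (mp A k) i j)) (trans (mul-cong {B = mp A k} st (λ _ _ → refl) i j) (mul-Iˡ (mp A k) i j))) i j ⟩
        mul (mul T A) (mp A k) i j                    ≡⟨ mul-assoc T A (mp A k) i j ⟩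
        mul T (mul A (mp A k)) i j                    ∎

    similar-SumOfTwo : ∀ {n} {M N : Mat n} → Similar M N → SumOfTwo N → SumOfTwo M
    similar-SumOfTwo {M = M} {N} sim (A , B , N≡) = mul (mul T A) S , mul (mul T B) S , λ i j → begin
      M i j                                                        ≡⟨ recover i j ⟨
      mul (mul T N) S i j                                          ≡⟨ mul-cong {B = S} (mul-cong {A = T} (λ _ _ → refl) N≡) (λ _ _ → refl) i j ⟩
      mul (mul T (mp A k ⊕ mp B k)) S i j                          ≡⟨ mul-cong {B = S} (mul-⊕ˡ T (mp A k) (mp B k)) (λ _ _ → refl) i j ⟩
      mul (mul T (mp A k) ⊕ mul T (mp B k)) S i j                  ≡⟨ mul-⊕ʳ (mul T (mp A k)) (mul T (mp B k)) S i j ⟩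
      mul (mul T (mp A k)) S i j + mul (mul T (mp B k)) S i j      ≡⟨ cong₂ _+_ (conjugate-mp S T A ST TS k i j) (conjugate-mp S T B ST TS k i j) ⟨
      mp (mul (mul T A) S) k i j + mp (mul (mul T B) S) k i j      ∎
      where
      open Similar sim
      recover : mul (mul T N) S ≋ M
      recover i j = begin
        mul (mul T N) S i j                        ≡⟨ mul-cong {B = S} (λ i j → trans (mul-cong {A = T} (λ _ _ → refl) N≋ i j) (trans (sym (mul-assoc T (mul S M) T i j)) (mul-cong {B = T} (λ i j → trans (sym (mul-assoc T S M i j)) (trans (mul-cong {B = M} TS (λ _ _ → refl) i j) (mul-Iˡ M i j))) (λ _ _ → refl) i j))) (λ _ _ → refl) i j ⟩
        mul (mul M T) S i j                        ≡⟨ mul-assoc M T S i j ⟩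
        mul M (mul T S) i j                        ≡⟨ mul-cong {A = M} (λ _ _ → refl) TS i j ⟩
        mul M I i j                                ≡⟨ mul-Iʳ M i j ⟩
        M i j                                      ∎

    scalar-SumOfTwo : ∀ {n} {M : Mat n} c x y → (∀ i j → M i j ≡ c * I i j) → pow x k + pow y k ≡ c → SumOfTwo M
    scalar-SumOfTwo {n} {M} c x y M≡ eq = (λ i j → x * I i j) , (λ i j → y * I i j) , λ i j →
      trans (M≡ i j) (trans (cong (_* I i j) (sym eq)) (trans (distribʳ _ _ _) (sym (cong₂ _+_ (scalar-mp x k i j) (scalar-mp y k i j)))))
      where
      scalar-mp : ∀ x k → mp {n} (λ i j → x * I i j) k ≋ (λ i j → pow x k * I i j)
      scalar-mp x zero i j = sym (*-identityˡ _)
      scalar-mp x (suc k) i j = begin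
        sum (λ m → x * I i m * mp (λ i j → x * I i j) k m j)   ≡⟨ sum-cong (λ m → trans (cong (x * I i m *_) (scalar-mp x k m j)) (solve 4 (λ x d p e → x :* d :* (p :* e) := d :* (x :* p :* e)) refl x (I i m) (pow x k) (I m j))) ⟩
        sum (λ m → I i m * (x * pow x k * I m j))              ≡⟨ sum-I i _ ⟩
        x * pow x k * I i j                                    ∎

  Lower : ∀ {n} → Mat n → Set
  Lower A = ∀ i j → i Fin.< j → A i j ≡ 0#

  lower-mul : ∀ {n} {A B : Mat n} → Lower A → Lower B → Lower (mul A B)
  lower-mul {A = A} {B} la lb i j i<j = sum-zero (λ m → lem m)
    where
    lem : ∀ m → A i m * B m j ≡ 0#
    lem m with Fin._<?_ i m
    ... | yes i<m = trans (cong (_* B m j) (la i m i<m)) (zeroˡ _)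
    ... | no i≮m = trans (cong (A i m *_) (lb m j (ℕ.≤-<-trans (ℕ.≮⇒≥ i≮m) i<j))) (zeroʳ _)

  diag-mul : ∀ {n} {A B : Mat n} → Lower A → Lower B → ∀ i → mul A B i i ≡ A i i * B i i
  diag-mul {A = A} {B} la lb i = sum-single _ i lem
    where
    lem : ∀ m → m ≢ i → A i m * B m i ≡ 0#
    lem m m≢i with Fin.<-cmp m i
    ... | tri< m<i _ _ = trans (cong (A i m *_) (lb m i m<i)) (zeroʳ _)
    ... | tri≈ _ e _ = ⊥-elim (m≢i e)
    ... | tri> _ _ i<m = trans (cong (_* B m i) (la i m i<m)) (zeroˡ _)

  mv : ∀ {n} → Mat n → (Fin n → Fin q) → Fin n → Fin q
  mv A w i = sum (λ j → A i j * w j)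

  forward-substitution : ∀ {n} (A : Mat n) → Lower A → (∀ i → A i i ≢ 0#) → ∀ (v : Fin n → Fin q) → ∃ λ w → ∀ i → mv A w i ≡ v i
  forward-substitution {zero} A la nz v = v , λ ()
  forward-substitution {suc n} A la nz v with forward-substitution (λ i j → A (suc i) (suc j)) (λ i j lt → la (suc i) (suc j) (ℕ.s≤s lt)) (λ i → nz (suc i))
                                                 (λ i → v (suc i) - A (suc i) zero * (inv (A zero zero) * v zero))
  ... | w , ok = w′ , λ { zero → first ; (suc i) → later i }
    where
    w₀ : Fin q
    w₀ = inv (A zero zero) * v zero
    w′ : Fin (suc n) → Fin q
    w′ zero = w₀
    w′ (suc i) = w i
    first : mv A w′ zero ≡ v zero
    first = trans (sum-suc _) (trans (cong₂ _+_ (*-cancel-inv (v zero) (nz zero)) (sum-zero (λ j → trans (cong (_* w j) (la zero (suc j) (ℕ.s≤s ℕ.z≤n))) (zeroˡ _)))) (+-identityʳ _))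
    later : ∀ i → mv A w′ (suc i) ≡ v (suc i)
    later i = trans (sum-suc _) (trans (cong (A (suc i) zero * w₀ +_) (ok i)) (solve 2 (λ a v → a :+ (v :- a) := v) refl (A (suc i) zero * w₀) (v (suc i))))

  -- h k r x is the sum of r^a x^b over a + b = k - 1.
  h : ℕ → Fin q → Fin q → Fin q
  h zero r x = 0#
  h (suc k) r x = pow r k + x * h k r x

  h-difference : ∀ k r x → (x - r) * h k r x ≡ pow x k - pow r k
  h-difference zero r x = trans (zeroʳ _) (sym (-‿inverseʳ 1#))
  h-difference (suc k) r x = begin
    (x - r) * (pow r k + x * h k r x)             ≡⟨ solve 4 (λ x r p h → (x :- r) :* (p :+ x :* h) := (x :- r) :* p :+ x :* ((x :- r) :* h)) refl x r (pow r k) (h k r x) ⟩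
    (x - r) * pow r k + x * ((x - r) * h k r x)   ≡⟨ cong (λ z → (x - r) * pow r k + x * z) (h-difference k r x) ⟩
    (x - r) * pow r k + x * (pow x k - pow r k)   ≡⟨ solve 4 (λ x r p s → (x :- r) :* p :+ x :* (s :- p) := x :* s :- r :* p) refl x r (pow r k) (pow x k) ⟩
    x * pow x k - r * pow r k                     ∎

  -- At x = r the divided difference (x^m - r^m)/(x - r) becomes the derivative m r^(m-1). For m = k
  -- and r ≠ 0 it survives because p ∤ k.
  h-diagonal : ∀ k r → h (suc k) r r ≡ nat (suc k) * pow r k
  h-diagonal zero r = trans (cong (1# +_) (zeroʳ r)) (sym (*-identityʳ _))
  h-diagonal (suc k) r = begin
    r * pow r k + r * h (suc k) r r                  ≡⟨ cong (λ z → r * pow r k + r * z) (h-diagonal k r) ⟩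
    r * pow r k + r * (nat (suc k) * pow r k)        ≡⟨ cong (_+ r * (nat (suc k) * pow r k)) (*-identityˡ _) ⟨
    1# * (r * pow r k) + r * (nat (suc k) * pow r k) ≡⟨ solve 4 (λ o r n p → o :* (r :* p) :+ r :* (n :* p) := (o :+ n) :* (r :* p)) refl 1# r (nat (suc k)) (pow r k) ⟩
    (1# + nat (suc k)) * (r * pow r k)               ∎

  -- The root is built row by row: with X = [[r, 0], [w, X′]] the lower left block of Xᵏ is H w, where H = Σ r^a X′^b is lower triangular.
  lower-root : ∀ k {n} (T : Mat n) (ρ : Fin n → Fin q) → Lower T → (∀ i → T i i ≡ pow (ρ i) k) →
    (∀ i j → i ≢ j → h k (ρ i) (ρ j) ≢ 0#) → ∃ λ X → (mp X k ≋ T) × Lower X × (∀ i → X i i ≡ ρ i)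
  lower-root k {zero} T ρ lt diag nz = (λ ()) , (λ ()) , (λ ()) , (λ ())
  lower-root k {suc n} T ρ lt diag nz with lower-root k (λ i j → T (suc i) (suc j)) (λ i → ρ (suc i)) (λ i j l → lt (suc i) (suc j) (ℕ.s≤s l))
      (λ i → diag (suc i)) (λ i j ne → nz (suc i) (suc j) (λ e → ne (Fin.suc-injective e)))
  ... | X′ , X′ᵏ , lX′ , dX′ = X , X^k , lX , dX
    where
    r : Fin q
    r = ρ zero
    H : ℕ → Mat n
    H zero i j = 0#
    H (suc m) i j = pow r m * I i j + mul X′ (H m) i j
    lH : ∀ m → Lower (H m)
    lH zero i j _ = refl
    lH (suc m) i j i<j = trans (cong₂ _+_ (trans (cong (pow r m *_) (I-off (Fin.<⇒≢ i<j))) (zeroʳ _)) (lower-mul lX′ (lH m) i j i<j)) (+-identityˡ 0#)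
    dH : ∀ m i → H m i i ≡ h m r (ρ (suc i))
    dH zero i = refl
    dH (suc m) i = cong₂ _+_ (trans (cong (pow r m *_) (I-diag i)) (*-identityʳ _)) (trans (diag-mul lX′ (lH m) i) (cong₂ _*_ (dX′ i) (dH m i)))
    -- The new column w of the root has to satisfy `H k` w = the first column of T below the corner.
    -- The diagonal of the lower triangular `H k` consists of values of h that `nz` keeps away from
    -- 0, so w exists.
    solution = forward-substitution (H k) (lH k) (λ i e → nz zero (suc i) (λ ()) (trans (sym (dH k i)) e)) (λ i → T (suc i) zero)
    w : Fin n → Fin q
    w = proj₁ solution
    X : Mat (suc n)
    X zero zero = r
    X zero (suc j) = 0#
    X (suc i) zero = w i
    X (suc i) (suc j) = X′ i j
    lX : Lower X
    lX zero (suc j) _ = refl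
    lX (suc i) (suc j) (ℕ.s≤s l) = lX′ i j l
    dX : ∀ i → X i i ≡ ρ i
    dX zero = refl
    dX (suc i) = dX′ i
    H-suc : ∀ m i → mv (H (suc m)) w i ≡ pow r m * w i + mv X′ (mv (H m) w) i
    H-suc m i = begin
      sum (λ j → (pow r m * I i j + mul X′ (H m) i j) * w j)                             ≡⟨ sum-cong (λ j → solve 4 (λ p d x w → (p :* d :+ x) :* w := p :* (d :* w) :+ x :* w) refl (pow r m) (I i j) (mul X′ (H m) i j) (w j)) ⟩
      sum (λ j → pow r m * (I i j * w j) + mul X′ (H m) i j * w j)                       ≡⟨ sum-+ _ _ ⟩
      sum (λ j → pow r m * (I i j * w j)) + sum (λ j → mul X′ (H m) i j * w j)           ≡⟨ cong₂ _+_ (trans (sym (*-sum (pow r m) _)) (cong (pow r m *_) (sum-I i w))) assoc ⟩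
      pow r m * w i + mv X′ (mv (H m) w) i                                               ∎
      where
      assoc : sum (λ j → mul X′ (H m) i j * w j) ≡ mv X′ (mv (H m) w) i
      assoc = trans (sum-cong (λ j → sum-* (w j) _)) (trans (sum-swap _) (sum-cong (λ l → trans (sum-cong (λ j → *-assoc _ _ _)) (sym (*-sum (X′ i l) _)))))
    entry₀₀ : ∀ m → mp X m zero zero ≡ pow r m
    entry₀₀ zero = refl
    entry₀₀ (suc m) = trans (sum-suc _) (trans (cong₂ _+_ (cong (r *_) (entry₀₀ m)) (sum-zero (λ j → zeroˡ _))) (+-identityʳ _))
    entry₀₁ : ∀ m j → mp X m zero (suc j) ≡ 0#
    entry₀₁ zero j = refl
    entry₀₁ (suc m) j = trans (sum-suc _) (trans (cong₂ _+_ (trans (cong (r *_) (entry₀₁ m j)) (zeroʳ _)) (sum-zero (λ i → zeroˡ _))) (+-identityʳ _))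
    entry₁₀ : ∀ m i → mp X m (suc i) zero ≡ mv (H m) w i
    entry₁₀ zero i = sym (sum-zero (λ j → zeroˡ _))
    entry₁₀ (suc m) i = trans (sum-suc _) (trans (cong₂ _+_ (trans (cong (w i *_) (entry₀₀ m)) (*-comm _ _)) (sum-cong (λ j → cong (X′ i j *_) (entry₁₀ m j)))) (sym (H-suc m i)))
    entry₁₁ : ∀ m i j → mp X m (suc i) (suc j) ≡ mp X′ m i j
    entry₁₁ zero i j = I-suc i j
    entry₁₁ (suc m) i j = trans (sum-suc _) (trans (cong₂ _+_ (trans (cong (w i *_) (entry₀₁ m j)) (zeroʳ _)) (sum-cong (λ l → cong (X′ i l *_) (entry₁₁ m l j)))) (+-identityˡ _))
    X^k : mp X k ≋ T
    X^k zero zero = trans (entry₀₀ k) (sym (diag zero))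
    X^k zero (suc j) = trans (entry₀₁ k j) (sym (lt zero (suc j) (ℕ.s≤s ℕ.z≤n)))
    X^k (suc i) zero = trans (entry₁₀ k i) (proj₂ solution i)
    X^k (suc i) (suc j) = trans (entry₁₁ k i j) (X′ᵏ i j)

  module Triangular (k : ℕ) (1≤k : 1 ℕ.≤ k) (nat-k≢0 : nat k ≢ 0#) where
    open Sums k

    -- A choice of k-th root depending only on the value.
    root : Fin q → Fin q
    root v with Fin.any? (λ y → pow y k Fin.≟ v)
    ... | yes (y , _) = y
    ... | no _ = 0#

    root-pow : ∀ x → pow (root (pow x k)) k ≡ pow x k
    root-pow x with Fin.any? (λ y → pow y k Fin.≟ pow x k)
    ... | yes (_ , e) = e
    ... | no none = ⊥-elim (none (x , refl))

    -- If the two powers differ, h times the difference of the roots is the difference of the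
    -- powers. If they agree, `root` returns the same r for both and h is k r^(k-1), where r ≠ 0
    -- because only one diagonal entry may vanish.
    h-root≢0 : ∀ {n} {x : Fin n → Fin q} → AtMostOneZero x → ∀ i j → i ≢ j → h k (root (pow (x i) k)) (root (pow (x j) k)) ≢ 0#
    h-root≢0 {x = x} amo i j i≢j h≡0 with pow (x i) k Fin.≟ pow (x j) k
    ... | yes e = go k refl
      where
      r : Fin q
      r = root (pow (x i) k)
      r≢0 : r ≢ 0#
      r≢0 r≡0 = i≢j (amo i j (pow≡0⇒ k xᵢ≡0) (pow≡0⇒ k (trans (sym e) xᵢ≡0)))
        where
        xᵢ≡0 : pow (x i) k ≡ 0#
        xᵢ≡0 = trans (sym (root-pow (x i))) (trans (cong (λ z → pow z k) r≡0) (pow-0# 1≤k))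
      go : ∀ m → m ≡ k → ⊥
      go zero refl = ℕ.<⇒≱ 1≤k ℕ.z≤n
      go (suc m) refl = *-≢0 nat-k≢0 (pow-≢0 m r≢0) (trans (sym (h-diagonal m r)) (trans (cong (λ v → h (suc m) r (root v)) e) h≡0))
    ... | no ne = ne (sym (x-y≡0⇒x≡y (begin
      pow (x j) k - pow (x i) k                                      ≡⟨ cong₂ (λ a b → a - b) (root-pow (x j)) (root-pow (x i)) ⟨
      pow rⱼ k - pow rᵢ k                                            ≡⟨ h-difference k rᵢ rⱼ ⟨
      (rⱼ - rᵢ) * h k rᵢ rⱼ                                          ≡⟨ cong ((rⱼ - rᵢ) *_) h≡0 ⟩
      (rⱼ - rᵢ) * 0#                                                 ≡⟨ zeroʳ _ ⟩
      0#                                                             ∎)))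
      where
      rᵢ = root (pow (x i) k)
      rⱼ = root (pow (x j) k)

    lower-is-power : ∀ {n} (T : Mat n) (x : Fin n → Fin q) → AtMostOneZero x → Lower T → (∀ i → T i i ≡ pow (x i) k) → ∃ λ X → mp X k ≋ T
    lower-is-power T x amo lt diag with lower-root k T (λ i → root (pow (x i) k)) lt (λ i → trans (diag i) (sym (root-pow (x i)))) (h-root≢0 amo)
    ... | X , eq , _ = X , eq

    diagonal-SumOfTwo : ∀ {n} (M : Mat n) (x y : Fin n → Fin q) → AtMostOneZero x → AtMostOneZero y →
      (∀ i → M i i ≡ pow (x i) k + pow (y i) k) → SumOfTwo M
    diagonal-SumOfTwo {n} M x y ax ay diag = conclude (lower-is-power L x ax lL dL) (lower-is-power (U ᵀ) y ay lU dU)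
      where
      L U : Mat n
      L i j with Fin.<-cmp i j
      ... | tri< _ _ _ = 0#
      ... | tri≈ _ _ _ = pow (x i) k
      ... | tri> _ _ _ = M i j
      U i j with Fin.<-cmp i j
      ... | tri< _ _ _ = M i j
      ... | tri≈ _ _ _ = pow (y i) k
      ... | tri> _ _ _ = 0#
      lL : Lower L
      lL i j i<j with Fin.<-cmp i j
      ... | tri< _ _ _ = refl
      ... | tri≈ i≮j _ _ = ⊥-elim (i≮j i<j)
      ... | tri> i≮j _ _ = ⊥-elim (i≮j i<j)
      lU : Lower (U ᵀ)
      lU i j i<j with Fin.<-cmp j i
      ... | tri< _ _ i≮j = ⊥-elim (i≮j i<j)
      ... | tri≈ _ _ i≮j = ⊥-elim (i≮j i<j)
      ... | tri> _ _ _ = refl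
      dL : ∀ i → L i i ≡ pow (x i) k
      dL i with Fin.<-cmp i i
      ... | tri< _ ne _ = ⊥-elim (ne refl)
      ... | tri≈ _ _ _ = refl
      ... | tri> _ ne _ = ⊥-elim (ne refl)
      dU : ∀ i → U i i ≡ pow (y i) k
      dU i with Fin.<-cmp i i
      ... | tri< _ ne _ = ⊥-elim (ne refl)
      ... | tri≈ _ _ _ = refl
      ... | tri> _ ne _ = ⊥-elim (ne refl)
      split : ∀ i j → M i j ≡ L i j + U i j
      split i j with Fin.<-cmp i j
      ... | tri< _ _ _ = sym (+-identityˡ _)
      ... | tri≈ _ refl _ = diag i
      ... | tri> _ _ _ = sym (+-identityʳ _)
      conclude : (∃ λ X → mp X k ≋ L) → (∃ λ Y → mp Y k ≋ (U ᵀ)) → SumOfTwo M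
      conclude (X , eX) (Y , eY) = X , Y ᵀ , λ i j → trans (split i j) (sym (cong₂ _+_ (eX i j) (trans (mp-ᵀ Y k i j) (eY j i))))

  -- `E r` is I plus the matrix with row r at position a. If r vanishes at a, the inverse has -r in
  -- place of r, and conjugation adds the combination r of the rows to row a, then subtracts `r b`
  -- times column a from each column b.
  module Transvection {n : ℕ} (a : Fin n) where
    E : (Fin n → Fin q) → Mat n
    E r i j = I i j + I i a * r j

    mul-E : ∀ r X i b → mul (E r) X i b ≡ X i b + I i a * sum (λ m → r m * X m b)
    mul-E r X i b = begin
      sum (λ m → (I i m + I i a * r m) * X m b)                       ≡⟨ sum-cong (λ m → solve 4 (λ d e r x → (d :+ e :* r) :* x := d :* x :+ e :* (r :* x)) refl (I i m) (I i a) (r m) (X m b)) ⟩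
      sum (λ m → I i m * X m b + I i a * (r m * X m b))               ≡⟨ sum-+ _ _ ⟩
      sum (λ m → I i m * X m b) + sum (λ m → I i a * (r m * X m b))   ≡⟨ cong₂ _+_ (sum-I i (λ m → X m b)) (sym (*-sum (I i a) _)) ⟩
      X i b + I i a * sum (λ m → r m * X m b)                         ∎

    E-mul : ∀ r X i b → mul X (E r) i b ≡ X i b + X i a * r b
    E-mul r X i b = begin
      sum (λ m → X i m * (I m b + I m a * r b))                       ≡⟨ sum-cong (λ m → solve 4 (λ d e r x → x :* (d :+ e :* r) := x :* d :+ x :* e :* r) refl (I m b) (I m a) (r b) (X i m)) ⟩
      sum (λ m → X i m * I m b + X i m * I m a * r b)                 ≡⟨ sum-+ _ _ ⟩
      sum (λ m → X i m * I m b) + sum (λ m → X i m * I m a * r b)     ≡⟨ cong₂ _+_ (sum-Iʳ b (X i)) (trans (sym (sum-* (r b) _)) (cong (_* r b) (sum-Iʳ a (X i)))) ⟩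
      X i b + X i a * r b                                             ∎

    E-inverse : ∀ {r r′} → r a ≡ 0# → (∀ b → r b + r′ b ≡ 0#) → mul (E r) (E r′) ≋ I
    E-inverse {r} {r′} ra opp i b = begin
      mul (E r) (E r′) i b                                   ≡⟨ E-mul r′ (E r) i b ⟩
      (I i b + I i a * r b) + (I i a + I i a * r a) * r′ b   ≡⟨ cong (λ z → (I i b + I i a * r b) + (I i a + I i a * z) * r′ b) ra ⟩
      (I i b + I i a * r b) + (I i a + I i a * 0#) * r′ b    ≡⟨ cong (λ z → (I i b + I i a * r b) + z * r′ b) (trans (cong (I i a +_) (zeroʳ _)) (+-identityʳ _)) ⟩
      (I i b + I i a * r b) + I i a * r′ b                   ≡⟨ solve 4 (λ d e r s → (d :+ e :* r) :+ e :* s := d :+ e :* (r :+ s)) refl (I i b) (I i a) (r b) (r′ b) ⟩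
      I i b + I i a * (r b + r′ b)                           ≡⟨ cong (λ z → I i b + I i a * z) (opp b) ⟩
      I i b + I i a * 0#                                     ≡⟨ trans (cong (I i b +_) (zeroʳ _)) (+-identityʳ _) ⟩
      I i b                                                  ∎

    conj : (Fin n → Fin q) → Mat n → Mat n
    conj r M i b = Y i b - Y i a * r b
      where
      Y : Mat n
      Y i b = M i b + I i a * sum (λ m → r m * M m b)

    similar-conj : ∀ r → r a ≡ 0# → ∀ M → Similar M (conj r M)
    similar-conj r ra M = record
      { S = E r ; T = E (λ b → - r b)
      ; ST = E-inverse ra (λ b → -‿inverseʳ (r b))
      ; TS = E-inverse (trans (cong -_ ra) -0#≡0#) (λ b → -‿inverseˡ (r b))
      ; N≋ = λ i b → sym (trans (E-mul (λ b → - r b) (mul (E r) M) i b)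
          (trans (cong₂ (λ u v → u + v * - r b) (mul-E r M i b) (mul-E r M i a))
            (solve 3 (λ u v r → u :+ v :* (:- r) := u :- v :* r) refl _ _ (r b)))) }

    conj-other-row : ∀ r M {i} → i ≢ a → ∀ b → conj r M i b ≡ M i b - M i a * r b
    conj-other-row r M {i} i≢a b = cong₂ (λ u v → u - v * r b) (row b) (row a)
      where
      row : ∀ b → M i b + I i a * sum (λ m → r m * M m b) ≡ M i b
      row b = trans (cong (M i b +_) (trans (cong (_* sum (λ m → r m * M m b)) (I-off i≢a)) (zeroˡ _))) (+-identityʳ _)

    conj-row : ∀ r M b → conj r M a b ≡ (M a b + sum (λ m → r m * M m b)) - (M a a + sum (λ m → r m * M m a)) * r b
    conj-row r M b = cong₂ (λ u v → u - v * r b) (row b) (row a)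
      where
      row : ∀ b → M a b + I a a * sum (λ m → r m * M m b) ≡ M a b + sum (λ m → r m * M m b)
      row b = cong (M a b +_) (trans (cong (_* sum (λ m → r m * M m b)) (I-diag a)) (*-identityˡ _))

  open Transvection using (conj; similar-conj; conj-other-row; conj-row)

  NonScalar : ∀ {n} → Mat (suc n) → Set
  NonScalar M = ∃₂ λ i j → M i j ≢ M zero zero * I i j

  nonScalar? : ∀ {n} (M : Mat (suc n)) → Dec (NonScalar M)
  nonScalar? M = Fin.any? (λ i → Fin.any? (λ j → ¬? (M i j Fin.≟ M zero zero * I i j)))

  minor : ∀ {n} → Mat (suc n) → Mat n
  minor M i j = M (suc i) (suc j)

  -- Conjugation by the block matrix diag(1, S) leaves the corner entry alone and acts on the minor
  -- as S does.
  extend : ∀ {n} {M : Mat (suc n)} {N′ : Mat n} → Similar (minor M) N′ → ∃ λ N → Similar M N × N zero zero ≡ M zero zero × (minor N ≋ N′)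
  extend {n} {M} {N′} sim = mul (mul (bd S) M) (bd T) , record { S = bd S ; T = bd T ; ST = bd-inverse ST ; TS = bd-inverse TS ; N≋ = λ _ _ → refl } ,
    corner , (λ i j → trans (block i j) (sym (N≋ i j)))
    where
    open Similar sim
    bd : Mat n → Mat (suc n)
    bd A zero zero = 1#
    bd A zero (suc j) = 0#
    bd A (suc i) zero = 0#
    bd A (suc i) (suc j) = A i j
    bd-left₀ : ∀ A X b → mul (bd A) X zero b ≡ X zero b
    bd-left₀ A X b = trans (sum-suc _) (trans (cong₂ _+_ (*-identityˡ _) (sum-zero (λ m → zeroˡ _))) (+-identityʳ _))
    bd-left₁ : ∀ A X i b → mul (bd A) X (suc i) b ≡ sum (λ m → A i m * X (suc m) b)
    bd-left₁ A X i b = trans (sum-suc _) (trans (cong (_+ sum (λ m → A i m * X (suc m) b)) (zeroˡ _)) (+-identityˡ _))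
    bd-right₀ : ∀ X A i → mul X (bd A) i zero ≡ X i zero
    bd-right₀ X A i = trans (sum-suc _) (trans (cong₂ _+_ (*-identityʳ _) (sum-zero (λ m → zeroʳ _))) (+-identityʳ _))
    bd-right₁ : ∀ X A i b → mul X (bd A) i (suc b) ≡ sum (λ m → X i (suc m) * A m b)
    bd-right₁ X A i b = trans (sum-suc _) (trans (cong (_+ sum (λ m → X i (suc m) * A m b)) (zeroʳ _)) (+-identityˡ _))
    bd-inverse : ∀ {A B} → mul A B ≋ I → mul (bd A) (bd B) ≋ I
    bd-inverse {A} {B} ab zero zero = trans (bd-left₀ A (bd B) zero) refl
    bd-inverse {A} {B} ab zero (suc j) = bd-left₀ A (bd B) (suc j)
    bd-inverse {A} {B} ab (suc i) zero = trans (bd-left₁ A (bd B) i zero) (sum-zero (λ m → zeroʳ _))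
    bd-inverse {A} {B} ab (suc i) (suc j) = trans (bd-left₁ A (bd B) i (suc j)) (trans (ab i j) (sym (I-suc i j)))
    corner : mul (mul (bd S) M) (bd T) zero zero ≡ M zero zero
    corner = trans (bd-right₀ (mul (bd S) M) T zero) (bd-left₀ S M zero)
    block : ∀ i j → mul (mul (bd S) M) (bd T) (suc i) (suc j) ≡ mul (mul S (minor M)) T i j
    block i j = trans (bd-right₁ (mul (bd S) M) T (suc i) j) (sum-cong (λ m → cong (_* T m j) (bd-left₁ S M i (suc m))))

  -- Fillmore's theorem, for fields with a third element g: the diagonal is adjusted one entry at a
  -- time, and the remaining minor is kept nonscalar so that the induction can continue.
  module Fillmore (g : Fin q) (g≢0 : g ≢ 0#) (g≢1 : g ≢ 1#) where
    entry-in-row : ∀ {n} (M : Mat (suc n)) → NonScalar M → ∃ λ N → Similar M N × ∃ λ j → N zero (suc j) ≢ 0#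
    entry-in-row {n} M (i , j , ne) with Fin.any? (λ j → ¬? (M zero (suc j) Fin.≟ 0#))
    ... | yes (j , M₀ⱼ≢0) = M , similar-refl M , j , M₀ⱼ≢0
    ... | no none = go i j ne
      where
      row-zero : ∀ j → M zero (suc j) ≡ 0#
      row-zero j with M zero (suc j) Fin.≟ 0#
      ... | yes e = e
      ... | no ne = ⊥-elim (none (j , ne))
      r : Fin q → Fin n → Fin (suc n) → Fin q
      r c i b = c * I (suc i) b
      r-0 : ∀ c i → r c i zero ≡ 0#
      r-0 c i = zeroʳ c
      N : Fin q → Fin n → Mat (suc n)
      N c i = conj zero (r c i) M
      sim : ∀ c i → Similar M (N c i)
      sim c i = similar-conj zero (r c i) (r-0 c i) M
      pick : ∀ c i b → sum (λ m → r c i m * M m b) ≡ c * M (suc i) b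
      pick c i b = trans (sum-cong (λ m → *-assoc _ _ _)) (trans (sym (*-sum c _)) (cong (c *_) (sum-I (suc i) (λ m → M m b))))
      N-entry : ∀ c i j → N c i zero (suc j) ≡ c * M (suc i) (suc j) - (M zero zero + c * M (suc i) zero) * (c * I (suc i) (suc j))
      N-entry c i j = trans (conj-row zero (r c i) M (suc j)) (cong₂ (λ u v → u - v * r c i (suc j))
        (trans (cong₂ _+_ (row-zero j) (pick c i (suc j))) (+-identityˡ _)) (cong (M zero zero +_) (pick c i zero)))
      N-diag : ∀ c i → N c i zero (suc i) ≡ c * (M (suc i) (suc i) - M zero zero - c * M (suc i) zero)
      N-diag c i = trans (N-entry c i i) (trans (cong (λ z → c * M (suc i) (suc i) - (M zero zero + c * M (suc i) zero) * (c * z)) (I-diag (suc i)))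
        (trans (cong (λ z → c * M (suc i) (suc i) - (M zero zero + c * M (suc i) zero) * z) (*-identityʳ c))
          (solve 4 (λ c m z e → c :* m :- (z :+ c :* e) :* c := c :* (m :- z :- c :* e)) refl c (M (suc i) (suc i)) (M zero zero) (M (suc i) zero))))
      -- The entry created is c (δ - c μ), with δ the difference of the two diagonal entries and μ
      -- the entry in column zero. If c = 1 gives zero, then δ = μ ≠ 0, and c = g gives g (1 - g) μ
      -- ≠ 0.
      choose : ∀ i → (M (suc i) (suc i) ≢ M zero zero ⊎ M (suc i) zero ≢ 0#) → ∃ λ N → Similar M N × ∃ λ j → N zero (suc j) ≢ 0#
      choose i h with M (suc i) (suc i) - M zero zero - 1# * M (suc i) zero Fin.≟ 0#
      ... | no ok = N 1# i , sim 1# i , i , (λ e → *-≢0 1≢0 ok (trans (sym (N-diag 1# i)) e))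
      ... | yes bad = N g i , sim g i , i , (λ e → *-≢0 g≢0 ok (trans (sym (N-diag g i)) e))
        where
        μ : Fin q
        μ = M (suc i) zero
        μ≡ : M (suc i) (suc i) - M zero zero ≡ μ
        μ≡ = trans (x-y≡0⇒x≡y bad) (*-identityˡ μ)
        μ≢0 : μ ≢ 0#
        μ≢0 e = case h
          where
          case : (M (suc i) (suc i) ≢ M zero zero ⊎ μ ≢ 0#) → ⊥
          case (inj₁ d) = d (x-y≡0⇒x≡y (trans μ≡ e))
          case (inj₂ d) = d e
        ok : M (suc i) (suc i) - M zero zero - g * μ ≢ 0#
        ok e = *-≢0 (λ e → g≢1 (sym (x-y≡0⇒x≡y e))) μ≢0 (begin
          (1# - g) * μ                                ≡⟨ solve 3 (λ o g m → (o :- g) :* m := o :* m :- g :* m) refl 1# g μ ⟩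
          1# * μ - g * μ                              ≡⟨ cong (_- g * μ) (trans (*-identityˡ μ) (sym μ≡)) ⟩
          M (suc i) (suc i) - M zero zero - g * μ     ≡⟨ e ⟩
          0#                                          ∎)
      go : ∀ i j → M i j ≢ M zero zero * I i j → ∃ λ N → Similar M N × ∃ λ j → N zero (suc j) ≢ 0#
      go zero zero ne = ⊥-elim (ne (sym (*-identityʳ _)))
      go zero (suc j) ne = ⊥-elim (ne (trans (row-zero j) (sym (zeroʳ _))))
      go (suc i) zero ne = choose i (inj₂ (λ e → ne (trans e (sym (zeroʳ _)))))
      go (suc i) (suc j) ne = off (i Fin.≟ j)
        where
        off : Dec (i ≡ j) → ∃ λ N → Similar M N × ∃ λ j → N zero (suc j) ≢ 0#
        off (yes refl) = choose i (inj₁ (λ e → ne (trans e (sym (trans (cong (M zero zero *_) (I-diag (suc i))) (*-identityʳ _))))))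
        off (no i≢j) = N 1# i , sim 1# i , j , (λ e → ne′ (trans (sym value) e))
          where
          Iᵢⱼ : I (suc i) (suc j) ≡ 0#
          Iᵢⱼ = I-off (λ e → i≢j (Fin.suc-injective e))
          ne′ : M (suc i) (suc j) ≢ 0#
          ne′ e = ne (trans e (sym (trans (cong (M zero zero *_) Iᵢⱼ) (zeroʳ _))))
          value : N 1# i zero (suc j) ≡ M (suc i) (suc j)
          value = trans (N-entry 1# i j) (trans (cong₂ (λ u v → u - (M zero zero + 1# * M (suc i) zero) * (1# * v)) (*-identityˡ _) Iᵢⱼ)
            (trans (cong (λ z → M (suc i) (suc j) - z) (trans (cong ((M zero zero + 1# * M (suc i) zero) *_) (zeroʳ 1#)) (zeroʳ _))) (x-0≡x _)))

    -- The nonzero entry is a pivot: subtracting multiples of its column sets the rest of row zero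
    -- at will, and the accompanying row operation changes only row `suc j`.
    set-row : ∀ {n} (M : Mat (suc n)) γ j → M zero (suc j) ≢ 0# →
      ∃ λ N → Similar M N × N zero zero ≡ γ × N zero (suc j) ≢ 0# × (∀ l → l ≢ j → N zero (suc l) ≡ 0#)
    set-row {n} M γ j ne = N , similar-conj (suc j) r r-j M , first , (λ e → ne (trans (sym same) e)) , others
      where
      target : Fin (suc n) → Fin q
      target zero = γ
      target (suc l) = 0#
      r : Fin (suc n) → Fin q
      r b with b Fin.≟ suc j
      ... | yes _ = 0#
      ... | no _ = inv (M zero (suc j)) * (M zero b - target b)
      r-j : r (suc j) ≡ 0#
      r-j with suc j Fin.≟ suc j
      ... | yes _ = refl
      ... | no ne = ⊥-elim (ne refl)
      r-other : ∀ b → b ≢ suc j → r b ≡ inv (M zero (suc j)) * (M zero b - target b)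
      r-other b b≢ with b Fin.≟ suc j
      ... | yes e = ⊥-elim (b≢ e)
      ... | no _ = refl
      N : Mat (suc n)
      N = conj (suc j) r M
      row : ∀ b → b ≢ suc j → N zero b ≡ target b
      row b b≢ = begin
        N zero b                                                             ≡⟨ conj-other-row (suc j) r M (λ ()) b ⟩
        M zero b - M zero (suc j) * r b                                      ≡⟨ cong (λ z → M zero b - M zero (suc j) * z) (r-other b b≢) ⟩
        M zero b - M zero (suc j) * (inv (M zero (suc j)) * (M zero b - target b))  ≡⟨ cong (λ z → M zero b - z) (*-cancel-inv _ ne) ⟩
        M zero b - (M zero b - target b)                                     ≡⟨ solve 2 (λ m t → m :- (m :- t) := t) refl (M zero b) (target b) ⟩
        target b                                                             ∎
      first : N zero zero ≡ γ
      first = row zero (λ ())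
      same : N zero (suc j) ≡ M zero (suc j)
      same = trans (conj-other-row (suc j) r M (λ ()) (suc j)) (trans (cong (λ z → M zero (suc j) - M zero (suc j) * z) r-j) (trans (cong (λ z → M zero (suc j) - z) (zeroʳ _)) (x-0≡x _)))
      others : ∀ l → l ≢ j → N zero (suc l) ≡ 0#
      others l l≢j = row (suc l) (λ e → l≢j (Fin.suc-injective e))

    off-diagonal⇒nonScalar : ∀ {n} (M : Mat (suc n)) i j → i ≢ j → M i j ≢ 0# → NonScalar M
    off-diagonal⇒nonScalar M i j i≢j ne = i , j , λ e → ne (trans e (trans (cong (M zero zero *_) (I-off i≢j)) (zeroʳ _)))

    -- If an off-diagonal entry (l, j) of the minor is zero, adding row zero to row l brings in the
    -- nonzero pivot. The accompanying column operation leaves the corner alone since row zero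
    -- vanishes at l.
    nonscalar-minor : ∀ {n} (M : Mat (suc (suc (suc n)))) γ j → M zero zero ≡ γ → M zero (suc j) ≢ 0# → (∀ l → l ≢ j → M zero (suc l) ≡ 0#) →
      ∃ λ N → Similar M N × N zero zero ≡ γ × NonScalar (minor N)
    nonscalar-minor {n} M γ j M₀₀ ne zeros = with-row (other j)
      where
      other : ∀ j → ∃ λ (l : Fin (suc (suc n))) → l ≢ j
      other zero = suc zero , λ ()
      other (suc j) = zero , λ ()
      with-row : (∃ λ l → l ≢ j) → ∃ λ N → Similar M N × N zero zero ≡ γ × NonScalar (minor N)
      with-row (l , l≢j) with M (suc l) (suc j) Fin.≟ 0#
      ... | no entry≢0 = M , similar-refl M , M₀₀ , off-diagonal⇒nonScalar (minor M) l j l≢j entry≢0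
      ... | yes entry≡0 = N , similar-conj (suc l) r refl M , corner , off-diagonal⇒nonScalar (minor N) l j l≢j (λ e → ne (trans (sym entry) e))
        where
        r : Fin (suc (suc (suc n))) → Fin q
        r b = I zero b
        N : Mat (suc (suc (suc n)))
        N = conj (suc l) r M
        corner : N zero zero ≡ γ
        corner = trans (conj-other-row (suc l) r M (λ ()) zero) (trans (cong (λ z → M zero zero - z * 1#) (zeros l l≢j)) (trans (cong (λ z → M zero zero - z) (zeroˡ 1#)) (trans (x-0≡x _) M₀₀)))
        entry : N (suc l) (suc j) ≡ M zero (suc j)
        entry = trans (conj-row (suc l) r M (suc j)) (trans (cong₂ (λ u v → u - v)
          (trans (cong₂ _+_ entry≡0 (sum-I zero (λ m → M m (suc j)))) (+-identityˡ _))
          (zeroʳ (M (suc l) (suc l) + sum (λ m → r m * M m (suc l))))) (x-0≡x _))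

    -- A 1 by 1 matrix is scalar, but there the trace alone determines the entry; hence the
    -- alternative n = 0.
    prescribed-diagonal : ∀ n (M : Mat (suc n)) (γ : Fin (suc n) → Fin q) → trace M ≡ sum γ → n ≡ 0 ⊎ NonScalar M →
      ∃ λ N → Similar M N × (∀ i → N i i ≡ γ i)
    prescribed-diagonal zero M γ tr _ = M , similar-refl M , λ { zero → begin
      M zero zero                  ≡⟨ sum-single (λ i → M i i) zero (λ { zero ne → ⊥-elim (ne refl) }) ⟨
      trace M                      ≡⟨ tr ⟩
      sum γ                        ≡⟨ sum-single γ zero (λ { zero ne → ⊥-elim (ne refl) }) ⟩
      γ zero                       ∎ }
    prescribed-diagonal (suc n) M γ tr (inj₂ ns) with entry-in-row M ns
    ... | M₁ , s₁ , j , ne₁ with set-row M₁ (γ zero) j ne₁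
    ... | M₂ , s₂ , c₂ , ne₂ , zeros with last-step n M₂ j c₂ ne₂ zeros
      where
      last-step : ∀ n (M : Mat (suc (suc n))) {γ₀} j → M zero zero ≡ γ₀ → M zero (suc j) ≢ 0# → (∀ l → l ≢ j → M zero (suc l) ≡ 0#) →
        ∃ λ N → Similar M N × N zero zero ≡ γ₀ × (n ≡ 0 ⊎ NonScalar (minor N))
      last-step zero M j c _ _ = M , similar-refl M , c , inj₁ refl
      last-step (suc n) M j c ne zeros with nonscalar-minor M _ j c ne zeros
      ... | N , s , c′ , ns = N , s , c′ , inj₂ ns
    ... | M₃ , s₃ , c₃ , cond = conclude (prescribed-diagonal n (minor M₃) (λ i → γ (suc i)) tr′ cond)
      where
      s₁₃ : Similar M M₃
      s₁₃ = similar-trans s₁ (similar-trans s₂ s₃)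
      tr′ : trace (minor M₃) ≡ sum (λ i → γ (suc i))
      tr′ = begin
        trace (minor M₃)                                          ≡⟨ solve 2 (λ x t → t := x :+ t :- x) refl (M₃ zero zero) (trace (minor M₃)) ⟩
        M₃ zero zero + trace (minor M₃) - M₃ zero zero            ≡⟨ cong (_- M₃ zero zero) (trans (sym (sum-suc (λ i → M₃ i i))) (trans (similar-trace s₁₃) (trans tr (sum-suc γ)))) ⟩
        γ zero + sum (λ i → γ (suc i)) - M₃ zero zero             ≡⟨ cong (λ z → γ zero + sum (λ i → γ (suc i)) - z) c₃ ⟩
        γ zero + sum (λ i → γ (suc i)) - γ zero                   ≡⟨ solve 2 (λ x t → x :+ t :- x := t) refl (γ zero) (sum (λ i → γ (suc i))) ⟩
        sum (λ i → γ (suc i))                                     ∎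
      conclude : (∃ λ N′ → Similar (minor M₃) N′ × (∀ i → N′ i i ≡ γ (suc i))) → ∃ λ N → Similar M N × (∀ i → N i i ≡ γ i)
      conclude (N′ , s′ , d′) with extend {M = M₃} s′
      ... | N , s , c , blk = N , similar-trans s₁₃ s , λ { zero → trans c c₃ ; (suc i) → trans (blk i i) (d′ i) }

-- The two cases of the theorem

open import Data.Nat using (_+_; _*_; _∸_; _^_; _≤_; _<_)

-- Logarithms and fractions are cleared: n > 4 ln(k-1)/ln q reads (k - 1)⁴ < qⁿ, for k = 1 in
-- accordance with ln 0 = -∞, and n > (d-1)/2 reads d - 1 < 2n. Truncated subtraction is exact here
-- since k and d are at least 1.
Hypotheses : (q n k : ℕ) → Set
Hypotheses q n k = let d = gcd k (q ∸ 1) in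
  (3 * d + 1 ≤ q × ((2 < d × d ∸ 1 < 2 * n × (k ∸ 1) ^ 4 < q ^ n) ⊎ d ≡ 2))
  ⊎ (q ≡ 2 * d + 1 × ((2 < d × 2 * d ∸ 1 < n × (k ∸ 1) ^ 4 < q ^ n) ⊎ d ≡ 2))

module OverFinite {q : ℕ} (G : FiniteField q) {p l : ℕ} (pp : Prime p) (q≡p^l : q ≡ p ^ l) (n′ k : ℕ) (1≤n′ : 1 ≤ n′) (1≤k : 1 ≤ k)
  (gen : ∀ x → FieldOps.SumOfPowers (FiniteField.asField G) k x) (p∤k : ¬ p ∣ k) (hyp : Hypotheses q (suc n′) k) where
  private
    n = suc n′
    d = gcd k (q ∸ 1)
    module F = Arithmetic G
    module M = Matrices G
  open PowerSums G k 1≤k using (t; D; 1≤D; #nonzero≡Dt)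
  open TraceSplitting G k 1≤k gen
  open M.Sums k using (SumOfTwo; similar-SumOfTwo; scalar-SumOfTwo)
  open M.Triangular k 1≤k (F.Characteristic.nat≢0 {p} {l} pp q≡p^l p∤k) using (diagonal-SumOfTwo)

  Dt≡ : D * t ≡ q ∸ 1
  Dt≡ = sym (trans F.q∸1≡#nonzero #nonzero≡Dt)

  2≤d : 2 ≤ d
  2≤d = go hyp
    where
    go : Hypotheses q n k → 2 ≤ d
    go (inj₁ (_ , inj₁ (2<d , _))) = ℕ.<⇒≤ 2<d
    go (inj₁ (_ , inj₂ d≡2)) = ℕ.≤-reflexive (sym d≡2)
    go (inj₂ (_ , inj₁ (2<d , _))) = ℕ.<⇒≤ 2<d
    go (inj₂ (_ , inj₂ d≡2)) = ℕ.≤-reflexive (sym d≡2)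

  1≤d : 1 ≤ d
  1≤d = ℕ.<⇒≤ 2≤d

  D≤d : D ≤ d
  D≤d = ℕ.≤-trans (#-mono (λ x → F.pow x k Fin.≟ F.1#) (λ x → F.pow x d Fin.≟ F.1#) lem) (F.#pow≡1≤ 1≤d)
    where
    lem : ∀ x → F.pow x k ≡ F.1# → F.pow x d ≡ F.1#
    lem x e = F.pow-gcd x k (λ x≡0 → F.1≢0 (trans (sym e) (trans (cong (λ z → F.pow z k) x≡0) (F.pow-0# 1≤k)))) e

  -- With D t = q - 1 and D ≤ d, the first case yields t ≥ 3 and the second t ≥ 2.
  t≥ : ∀ c → c * d ≤ q ∸ 1 → c ≤ t
  t≥ c le = ℕ.*-cancelˡ-≤ D {{ℕ.>-nonZero 1≤D}} (ℕ.≤-trans (ℕ.*-monoˡ-≤ c D≤d) (ℕ.≤-trans (ℕ.≤-reflexive (ℕ.*-comm d c)) (ℕ.≤-trans le (ℕ.≤-reflexive (sym Dt≡)))))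

  n+n≡2*n : n + n ≡ 2 * n
  n+n≡2*n = cong (n +_) (sym (ℕ.+-identityʳ n))

  2≤n : 2 ≤ n
  2≤n = ℕ.s≤s 1≤n′

  split : ∀ τ → Split n τ
  split = split-cases hyp
   where
   split-cases : Hypotheses q n k → ∀ τ → Split n τ
   split-cases (inj₁ (3d<q , sub)) = large nonInvolution?
    where
    3≤t : 3 ≤ t
    3≤t = t≥ 3 (ℕ.≤-trans (ℕ.≤-reflexive (sym (ℕ.m+n∸n≡m (3 * d) 1))) (ℕ.∸-monoˡ-≤ 1 3d<q))
    d≤2n : d ≤ 2 * n
    d≤2n = go sub
      where
      go : (2 < d × d ∸ 1 < 2 * n × (k ∸ 1) ^ 4 < q ^ n) ⊎ d ≡ 2 → d ≤ 2 * n
      go (inj₁ (2<d , lt , _)) = ℕ.≤-trans (ℕ.≤-reflexive (sym (ℕ.m+[n∸m]≡n 1≤d))) lt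
      go (inj₂ d≡2) = ℕ.≤-trans (ℕ.≤-reflexive d≡2) (ℕ.*-monoʳ-≤ 2 (ℕ.≤-trans (ℕ.s≤s ℕ.z≤n) 2≤n))
    large : Dec NonInvolution → ∀ τ → Split n τ
    large (yes ni) = Large.split ni n 2≤n 3≤t (ℕ.≤-trans D≤d (ℕ.≤-trans d≤2n (ℕ.≤-reflexive (sym n+n≡2*n))))
    large (no none) = ⊥-elim (ℕ.<⇒≱ 3≤t (involutions⇒t≤2 none))
   split-cases (inj₂ (q≡ , sub)) = small nonInvolution?
    where
    2≤t : 2 ≤ t
    2≤t = t≥ 2 (ℕ.≤-reflexive (sym (trans (cong (_∸ 1) q≡) (ℕ.m+n∸n≡m (2 * d) 1))))
    d≤n : d ≤ n
    d≤n = go sub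
      where
      go : (2 < d × 2 * d ∸ 1 < n × (k ∸ 1) ^ 4 < q ^ n) ⊎ d ≡ 2 → d ≤ n
      go (inj₂ d≡2) = ℕ.≤-trans (ℕ.≤-reflexive d≡2) 2≤n
      go (inj₁ (2<d , lt , _)) = ℕ.≤-trans (ℕ.m≤m+n d (d + 0)) (ℕ.≤-trans (ℕ.≤-reflexive (sym (ℕ.m+[n∸m]≡n (ℕ.≤-trans 1≤d (ℕ.m≤m+n d (d + 0)))))) lt)
    small : Dec NonInvolution → ∀ τ → Split n τ
    -- D ≤ n gives D < 2n, one summand beyond what nonzero traces require, so trace 0 is reached as
    -- well and t ≥ 3 is not asked for.
    small (yes ni) = Large.split-strict ni n (ℕ.≤-<-trans (ℕ.≤-trans D≤d d≤n) (ℕ.m<m+n n (ℕ.s≤s ℕ.z≤n)))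
    small (no none) = PlusMinusOne.split none 2≤t n (ℕ.≤-trans D≤d d≤n)

  3≤q : 3 ≤ q
  3≤q = go hyp
    where
    go : Hypotheses q n k → 3 ≤ q
    go (inj₁ (3d<q , _)) = ℕ.≤-trans (ℕ.≤-trans (ℕ.*-monoʳ-≤ 3 1≤d) (ℕ.m≤m+n (3 * d) 1)) 3d<q
    go (inj₂ (q≡ , _)) = ℕ.≤-trans (ℕ.+-monoˡ-≤ 1 (ℕ.*-monoʳ-≤ 2 1≤d)) (ℕ.≤-reflexive (sym q≡))

  3≤qⁿ : 3 ≤ q ^ n
  3≤qⁿ = ℕ.≤-trans 3≤q (ℕ.≤-trans (ℕ.≤-reflexive (sym (ℕ.*-identityʳ q))) (ℕ.*-monoʳ-≤ q (ℕ.≤-trans (ℕ.≤-reflexive (sym (ℕ.^-zeroˡ n′))) (ℕ.^-monoˡ-≤ n′ (ℕ.≤-trans (ℕ.s≤s ℕ.z≤n) 3≤q)))))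

  twoPowers : d ≡ 2 → ∀ c → TwoPower c
  twoPowers d≡2 = go nonInvolution?
    where
    D≤2 : D ≤ 2
    D≤2 = ℕ.≤-trans D≤d (ℕ.≤-reflexive d≡2)
    2d≤ : Hypotheses q n k → 2 * d ≤ q ∸ 1
    2d≤ (inj₁ (3d<q , _)) = ℕ.≤-trans (ℕ.≤-trans (ℕ.*-monoˡ-≤ d (ℕ.m≤m+n 2 1)) (ℕ.≤-reflexive (sym (ℕ.m+n∸n≡m (3 * d) 1)))) (ℕ.∸-monoˡ-≤ 1 3d<q)
    2d≤ (inj₂ (q≡ , _)) = ℕ.≤-reflexive (sym (trans (cong (_∸ 1) q≡) (ℕ.m+n∸n≡m (2 * d) 1)))
    go : Dec NonInvolution → ∀ c → TwoPower c
    go (yes ni) = Large.twoPower ni D≤2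
    go (no none) = PlusMinusOne.twoPower none (t≥ 2 (2d≤ hyp)) D≤2

  scalar : ∀ (A : F.Mat n) c → (∀ i j → A i j ≡ c F.* F.I i j) → SumOfTwo A
  scalar A c A≡ = go (cases hyp)
    where
    cases : Hypotheses q n k → d ≡ 2 ⊎ (k ∸ 1) ^ 4 < q ^ n
    cases (inj₁ (_ , inj₁ (_ , _ , lt))) = inj₂ lt
    cases (inj₁ (_ , inj₂ e)) = inj₁ e
    cases (inj₂ (_ , inj₁ (_ , _ , lt))) = inj₂ lt
    cases (inj₂ (_ , inj₂ e)) = inj₁ e
    go : d ≡ 2 ⊎ (k ∸ 1) ^ 4 < q ^ n → SumOfTwo A
    go (inj₁ d≡2) = let x , y , e = twoPowers d≡2 c in scalar-SumOfTwo c x y A≡ e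
    go (inj₂ lt) = let B , C , e = Extension.scalar-is-sum-of-powers G {p} {l} pp q≡p^l n′ 1≤k lt 3≤qⁿ c in
      B , C , λ i j → trans (A≡ i j) (trans (sym (e i j)) (cong₂ F._+_ (M.mpow≡mp B k i j) (M.mpow≡mp C k i j)))

  -- The element asked for by Fillmore's argument; both cases force q ≥ 3.
  third : ∃ λ g → g ≢ F.0# × g ≢ F.1#
  third with Fin.any? (λ g → F.nonzero? g ×-dec ¬? (g Fin.≟ F.1#))
  ... | yes r = r
  ... | no none = ⊥-elim (ℕ.<⇒≱ 3≤q (ℕ.≤-trans (ℕ.≤-reflexive (sym F.#nonzero)) (ℕ.s≤s (ℕ.≤-trans (#-mono F.nonzero? (Fin._≟ F.1#) lem) (ℕ.≤-reflexive (#-point F.1#))))))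
    where
    lem : ∀ z → z ≢ F.0# → z ≡ F.1#
    lem z z≢0 with z Fin.≟ F.1#
    ... | yes e = e
    ... | no ne = ⊥-elim (none (z , z≢0 , ne))

  sumOfTwo : ∀ (A : F.Mat n) → SumOfTwo A
  sumOfTwo A = go (M.nonScalar? A)
    where
    go : Dec (M.NonScalar A) → SumOfTwo A
    go (no scal) = scalar A (A zero zero) (λ i j → eq i j (A i j Fin.≟ A zero zero F.* F.I i j))
      where
      eq : ∀ i j → Dec (A i j ≡ A zero zero F.* F.I i j) → A i j ≡ A zero zero F.* F.I i j
      eq i j (yes e) = e
      eq i j (no ne) = ⊥-elim (scal (i , j , ne))
    go (yes ns) = conclude (split (M.trace A))
      where
      conclude : Split n (M.trace A) → SumOfTwo A
      conclude (x , y , ax , ay , e) =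
        let N , sim , diag = M.Fillmore.prescribed-diagonal (proj₁ third) (proj₁ (proj₂ third)) (proj₂ (proj₂ third)) n′ A
                               (λ i → F.pow (x i) k F.+ F.pow (y i) k) (sym e) (inj₂ ns)
        in similar-SumOfTwo sim (diagonal-SumOfTwo N x y ax ay diag)

  powers : ∀ (A : F.Mat n) → ∃₂ λ (B C : F.Mat n) → ∀ i j → A i j ≡ F.mpow B k i j F.+ F.mpow C k i j
  powers A = let B , C , e = sumOfTwo A in B , C , λ i j → trans (e i j) (sym (cong₂ F._+_ (M.mpow≡mp B k i j) (M.mpow≡mp C k i j)))

-- The condition ℓ = l takes the form `∀ x → SumOfPowers k x`: the finite sums of k-th powers then
-- make up all of F.
theorem1p17 : ∀ {c ℓ} (F : Field c ℓ) (p l q n k : ℕ) →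
    let open FieldOps F in
    Prime p → q ≡ p ^ l → HasSize q →
    2 ≤ n → 1 ≤ k →
    (∀ x → SumOfPowers k x) →
    ¬ (p ∣ k) →
    (let d = gcd k (q ∸ 1) in
    (3 * d + 1 ≤ q × ((2 < d × d ∸ 1 < 2 * n × (k ∸ 1) ^ 4 < q ^ n) ⊎ d ≡ 2))
    ⊎ (q ≡ 2 * d + 1 × ((2 < d × 2 * d ∸ 1 < n × (k ∸ 1) ^ 4 < q ^ n) ⊎ d ≡ 2))) →
    ∀ (M : Mat n) → ∃₂ λ (A B : Mat n) → M ≋ (mpow A k ⊕ mpow B k)
theorem1p17 F p l q (suc n′) k pp q≡p^l size (ℕ.s≤s 1≤n′) 1≤k gen p∤k hyp M =
  let A , B , eq = OverFinite.powers T.finiteField {p} {l} pp q≡p^l n′ k 1≤n′ 1≤k gen′ p∤k hyp (λ i j → T.index (M i j))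
  in (λ i j → T.e (A i j)) , (λ i j → T.e (B i j)) , λ i j →
     F.trans (F.sym (T.e-index (M i j))) (F.trans (F.reflexive (cong T.e (eq i j))) (F.trans (T.e-+ _ _) (F.+-cong (T.e-mpow A k i j) (T.e-mpow B k i j))))
  where
  module F = Field F
  module T = Transport F size
  gen′ : ∀ x → T.GO.SumOfPowers k x
  gen′ x = subst (T.GO.SumOfPowers k) (T.e-injective (T.e-index (T.e x))) (T.sumOfPowers (gen (T.e x)))
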